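{- Let $p$ be a prime, $q=p^e$, $m\ge1$, and let $C\subseteq\mathbb{F}_{q^m}^n$ be a linear code with a generator matrix $G=(g_{ij})_{i\in[k],\,j\in[n]}$ over $\mathbb{F}_{q^m}$. Let $\mathrm{Tr}_{q^m/q}(C)=\{(\mathrm{Tr}_{q^m/q}(c_1),\dots,\mathrm{Tr}_{q^m/q}(c_n)):(c_1,\dots,c_n)\in C\}$ be its trace code over $\mathbb{F}_q$. Then the $p$-adic valuation of $\mathrm{Tr}_{q^m/q}(C)$ is equal to the minimum, over all $\boldsymbol{r}=(r_1,\dots,r_k)\in[0,q^m-1]^k$ with $|\boldsymbol{r}|=\sum_i r_i\equiv0\pmod{q-1}$ and $|\boldsymbol{r}|>0$, of \[\frac{1}{p-1}\sum_{i=1}^k S_p(r_i)+\nu_p\Big(\sum_{j=1}^n\prod_{i=1}^k T(g_{ij})^{r_i}\Big)-e.\]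
   Context: A linear code over $\mathbb{F}_q$ is $\Delta$-divisible if the Hamming weight of each codeword is divisible by $\Delta$; its $p$-adic valuation is the greatest integer $t$ such that it is $p^t$-divisible. $[a,b]=\{i\in\mathbb{Z}:a\le i\le b\}$, $[k]=[1,k]$. $S_p(a)$ is the sum of the base-$p$ digits of $a$. $T:\mathbb{F}_{q^m}\to\mathbb{Z}_p[\xi_{q^m-1}]$ is the Teichmüller lift: $T(0)=0$ and $T$ maps $\mathbb{F}_{q^m}^\times$ to the $(q^m-1)$-st roots of unity as the inverse of reduction modulo $p$; the convention $T(0)^0=1$ is used. $\nu_p$ is the $p$-adic valuation extended to the relevant cyclotomic extension of $\mathbb{Q}_p$ (with $\nu_p(0)=\infty$). -}

module Defs where

open import Algebra.Bundles using (CommutativeRing; Semiring)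
open import Algebra.Morphism.Structures using (module RingMorphisms)
import Algebra.Definitions.RawSemiring as RawSemiringOps
open import Data.Digit using (toDigits)
open import Data.Fin.Base using (Fin; toℕ)
import Data.Fin.Properties as Fin
open import Data.Integer.Base as ℤ using (ℤ; +_)
open import Data.Integer.Divisibility.Signed as ℤ∣
  using (∣m⇒∣-m; ∣m∣n⇒∣m+n; ∣n⇒∣m*n; ∣m⇒∣m*n)
import Data.Integer.Properties as ℤ
open import Data.Integer.Tactic.RingSolver using (solve-∀)
open import Data.List.Base as List using (List; allFin; filter; length)
import Data.Maybe.Base as Maybe
open import Data.Nat.Base as ℕ using (ℕ; suc; _≤_; _<_; _∸_; NonZero)
import Data.Nat.Divisibility as ℕ∣
import Data.Nat.ListAction as ListAction
import Data.Nat.Properties as ℕ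
open import Data.Nat.Primality using (Prime; prime⇒nonTrivial)
open import Data.Product.Base using (∃-syntax; Σ-syntax; _×_; _,_; proj₁)
open import Data.Rational.Base as ℚ using (ℚ)
open import Data.Sum.Base using (_⊎_)
open import Data.Vec.Functional as Vector using (Vector)
open import Function.Base using (_∘_)
open import Function.Bundles using (Inverse; _⇔_)
open import Function.Properties.Inverse using (Inverse⇒Injection)
open import Level using (_⊔_; Lift) renaming (suc to lsuc)
open import Relation.Binary.PropositionalEquality as ≡ using (_≡_)
import Relation.Binary.Construct.Add.Supremum.NonStrict as Supremum
open import Relation.Nullary.Construct.Add.Supremum using (_⁺; [_]; ⊤⁺)
open import Relation.Nullary.Decidable using (Dec; ¬?; via-injection; fromWitness)
open import Relation.Nullary.Negation using (¬_)
open import Relation.Unary using (Pred)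

module RingOps {c ℓ} (R : CommutativeRing c ℓ) where
  open RawSemiringOps (Semiring.rawSemiring (CommutativeRing.semiring R)) public
    using (_^_; _∣_; _∤_)
    renaming (sum to ∑; product to ∏; _×_ to _·_)

module _ {a ℓ₁ b ℓ₂} (R : CommutativeRing a ℓ₁) (S : CommutativeRing b ℓ₂) where
  open RingMorphisms (CommutativeRing.rawRing R) (CommutativeRing.rawRing S) public
    using () renaming ( IsRingHomomorphism to IsHomomorphism
                      ; IsRingMonomorphism to IsEmbedding )

record FiniteField c ℓ (q : ℕ) : Set (lsuc (c ⊔ ℓ)) where
  field
    commutativeRing : CommutativeRing c ℓ

  open CommutativeRing commutativeRing public
  open RingOps commutativeRing public

  field
    1≉0         : ¬ 1# ≈ 0#
    invertible  : ∀ x → ¬ x ≈ 0# → ∃[ y ] x * y ≈ 1#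
    enumeration : Inverse setoid (≡.setoid (Fin q))

  _≟_ : ∀ x y → Dec (x ≈ y)
  _≟_ = via-injection (Inverse⇒Injection enumeration) Fin._≟_

-- The ring ℤₚ as the inverse limit of the rings ℤ/pⁿ: the n-th entry of a
-- sequence represents a residue class modulo pⁿ.

record ℤₚ (p : ℕ) : Set where
  constructor mkℤₚ
  field
    residue  : ℕ → ℤ
    coherent : ∀ n → + (p ℕ.^ n) ℤ∣.∣ residue (suc n) ℤ.- residue n

open ℤₚ public

module _ (p : ℕ) where

  private
    infix 4 _≋_
    _≋_ : ℤₚ p → ℤₚ p → Set
    x ≋ y = ∀ n → + (p ℕ.^ n) ℤ∣.∣ residue x n ℤ.- residue y n

    pointwise : ∀ {x y} → (∀ n → residue x n ≡ residue y n) → x ≋ y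
    pointwise x≗y n = ℤ∣.divides ℤ.0ℤ (ℤ.i≡j⇒i-j≡0 (x≗y n))

    along : ∀ {k i j} → i ≡ j → k ℤ∣.∣ i → k ℤ∣.∣ j
    along ≡.refl d = d

    sub-+ : ∀ a b c d → (a ℤ.- b) ℤ.+ (c ℤ.- d) ≡ (a ℤ.+ c) ℤ.- (b ℤ.+ d)
    sub-+ = solve-∀

    sub-* : ∀ a b c d → (a ℤ.- b) ℤ.* c ℤ.+ b ℤ.* (c ℤ.- d) ≡ a ℤ.* c ℤ.- b ℤ.* d
    sub-* = solve-∀

    sub-neg : ∀ a b → ℤ.- (a ℤ.- b) ≡ (ℤ.- a) ℤ.- (ℤ.- b)
    sub-neg = solve-∀

    sub-swap : ∀ a b → ℤ.- (a ℤ.- b) ≡ b ℤ.- a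
    sub-swap = solve-∀

    sub-trans : ∀ a b c → (a ℤ.- b) ℤ.+ (b ℤ.- c) ≡ a ℤ.- c
    sub-trans = solve-∀

    mod-+ : ∀ {k} a b c d → k ℤ∣.∣ a ℤ.- b → k ℤ∣.∣ c ℤ.- d →
            k ℤ∣.∣ (a ℤ.+ c) ℤ.- (b ℤ.+ d)
    mod-+ a b c d u v = along (sub-+ a b c d) (∣m∣n⇒∣m+n u v)

    mod-* : ∀ {k} a b c d → k ℤ∣.∣ a ℤ.- b → k ℤ∣.∣ c ℤ.- d →
            k ℤ∣.∣ a ℤ.* c ℤ.- b ℤ.* d
    mod-* a b c d u v =
      along (sub-* a b c d) (∣m∣n⇒∣m+n (∣m⇒∣m*n c u) (∣n⇒∣m*n b v))

    mod-neg : ∀ {k} a b → k ℤ∣.∣ a ℤ.- b → k ℤ∣.∣ (ℤ.- a) ℤ.- (ℤ.- b)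
    mod-neg a b u = along (sub-neg a b) (∣m⇒∣-m u)

    constant : ℤ → ℤₚ p
    constant a = mkℤₚ (λ _ → a)
      λ n → ℤ∣.divides ℤ.0ℤ (ℤ.i≡j⇒i-j≡0 {a} ≡.refl)

    add mul : ℤₚ p → ℤₚ p → ℤₚ p
    add (mkℤₚ x cx) (mkℤₚ y cy) =
      mkℤₚ (λ n → x n ℤ.+ y n) λ n → mod-+ (x (suc n)) (x n) (y (suc n)) (y n) (cx n) (cy n)
    mul (mkℤₚ x cx) (mkℤₚ y cy) =
      mkℤₚ (λ n → x n ℤ.* y n) λ n → mod-* (x (suc n)) (x n) (y (suc n)) (y n) (cx n) (cy n)

    neg : ℤₚ p → ℤₚ p
    neg (mkℤₚ x cx) = mkℤₚ (λ n → ℤ.- x n) λ n → mod-neg (x (suc n)) (x n) (cx n)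

  ℤₚ-commutativeRing : CommutativeRing _ _
  ℤₚ-commutativeRing = record
    { Carrier = ℤₚ p
    ; _≈_ = _≋_
    ; _+_ = add
    ; _*_ = mul
    ; -_  = neg
    ; 0#  = constant ℤ.0ℤ
    ; 1#  = constant ℤ.1ℤ
    ; isCommutativeRing = record
      { isRing = record
        { +-isAbelianGroup = record
          { isGroup = record
            { isMonoid = record
              { isSemigroup = record
                { isMagma = record
                  { isEquivalence = record
                    { refl  = λ {x} → pointwise {x} {x} λ _ → ≡.refl
                    ; sym   = λ {x} {y} u n →
                        along (sub-swap (residue x n) (residue y n)) (∣m⇒∣-m (u n))
                    ; trans = λ {x} {y} {z} u v n →
                        along (sub-trans (residue x n) (residue y n) (residue z n))
                                 (∣m∣n⇒∣m+n (u n) (v n))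
                    }
                  ; ∙-cong = λ {x} {y} {u} {v} s t n →
                      mod-+ (residue x n) (residue y n) (residue u n) (residue v n) (s n) (t n)
                  }
                ; assoc = λ x y z → pointwise {add (add x y) z} {add x (add y z)}
                    λ n → ℤ.+-assoc (residue x n) (residue y n) (residue z n)
                }
              ; identity =
                  (λ x → pointwise {add (constant ℤ.0ℤ) x} {x} λ n → ℤ.+-identityˡ (residue x n))
                , (λ x → pointwise {add x (constant ℤ.0ℤ)} {x} λ n → ℤ.+-identityʳ (residue x n))
              }
            ; inverse =
                (λ x → pointwise {add (neg x) x} {constant ℤ.0ℤ} λ n → ℤ.+-inverseˡ (residue x n))
              , (λ x → pointwise {add x (neg x)} {constant ℤ.0ℤ} λ n → ℤ.+-inverseʳ (residue x n))
            ; ⁻¹-cong = λ {x} {y} s n → mod-neg (residue x n) (residue y n) (s n)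
            }
          ; comm = λ x y → pointwise {add x y} {add y x} λ n → ℤ.+-comm (residue x n) (residue y n)
          }
        ; *-cong = λ {x} {y} {u} {v} s t n →
            mod-* (residue x n) (residue y n) (residue u n) (residue v n) (s n) (t n)
        ; *-assoc = λ x y z → pointwise {mul (mul x y) z} {mul x (mul y z)}
            λ n → ℤ.*-assoc (residue x n) (residue y n) (residue z n)
        ; *-identity =
            (λ x → pointwise {mul (constant ℤ.1ℤ) x} {x} λ n → ℤ.*-identityˡ (residue x n))
          , (λ x → pointwise {mul x (constant ℤ.1ℤ)} {x} λ n → ℤ.*-identityʳ (residue x n))
        ; distrib =
            (λ x y z → pointwise {mul x (add y z)} {add (mul x y) (mul x z)}
               λ n → ℤ.*-distribˡ-+ (residue x n) (residue y n) (residue z n))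
          , (λ x y z → pointwise {mul (add y z) x} {add (mul y x) (mul z x)}
               λ n → ℤ.*-distribʳ-+ (residue x n) (residue y n) (residue z n))
        }
      ; *-comm = λ x y → pointwise {mul x y} {mul y x} λ n → ℤ.*-comm (residue x n) (residue y n)
      }
    }

-- The ring ℤₚ[ξ], ξ a primitive N-th root of unity, given up to isomorphism
-- as a domain containing ℤₚ and generated over it by an element of
-- multiplicative order N.  Since zero is not decidable in ℤₚ, "domain" is
-- phrased as cancellation of non-zero factors.

record ℤₚ[ξ_] (N : ℕ) (p : ℕ) c ℓ : Set (lsuc (c ⊔ ℓ)) where
  field
    commutativeRing : CommutativeRing c ℓ

  open CommutativeRing commutativeRing public
  open RingOps commutativeRing public

  field
    noZeroDivisors : ∀ x y → ¬ x ≈ 0# → x * y ≈ 0# → y ≈ 0#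
    embed          : ℤₚ p → Carrier
    isEmbedding    : IsEmbedding (ℤₚ-commutativeRing p) commutativeRing embed
    ξ              : Carrier
    ξ^N≈1          : ξ ^ N ≈ 1#
    ξ-primitive    : ∀ i → 0 < i → i < N → ¬ ξ ^ i ≈ 1#
    generated      : ∀ x → ∃[ d ] Σ[ a ∈ Vector (ℤₚ p) d ] x ≈ ∑ (λ i → embed (a i) * ξ ^ toℕ i)

  -- The graph of νₚ.  For p ∤ N the ring is the valuation ring of the
  -- unramified extension ℚₚ(ξ) with uniformiser p, so the extension of νₚ
  -- is the exponent of p.
  ν : Carrier → ℕ ⁺ → Set (c ⊔ ℓ)
  ν x [ t ] = (p · 1#) ^ t ∣ x × (p · 1#) ^ suc t ∤ x
  ν x ⊤⁺    = Lift (c ⊔ ℓ) (x ≈ 0#)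

-- Reduction modulo p, identifying the residue field ℤₚ[ξ]/(p) with L.

record IsReduction {c₁ ℓ₁ c₂ ℓ₂ N p Q}
  (R : ℤₚ[ξ N ] p c₁ ℓ₁) (L : FiniteField c₂ ℓ₂ Q)
  (ρ : ℤₚ[ξ_].Carrier R → FiniteField.Carrier L) : Set (c₁ ⊔ ℓ₁ ⊔ c₂ ⊔ ℓ₂) where
  private
    module R = ℤₚ[ξ_] R
    module L = FiniteField L
  field
    isHomomorphism : IsHomomorphism R.commutativeRing L.commutativeRing ρ
    surjective     : ∀ y → ∃[ x ] ρ x L.≈ y
    kernel         : ∀ x → (ρ x L.≈ L.0#) ⇔ (p R.· R.1#) R.∣ x

record IsTeichmüller {c₁ ℓ₁ c₂ ℓ₂ N p Q}
  (R : ℤₚ[ξ N ] p c₁ ℓ₁) (L : FiniteField c₂ ℓ₂ Q)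
  (ρ : ℤₚ[ξ_].Carrier R → FiniteField.Carrier L)
  (T : FiniteField.Carrier L → ℤₚ[ξ_].Carrier R) : Set (c₁ ⊔ ℓ₁ ⊔ c₂ ⊔ ℓ₂) where
  private
    module R = ℤₚ[ξ_] R
    module L = FiniteField L
  field
    cong          : ∀ {x y} → x L.≈ y → T x R.≈ T y
    T0≈0          : T L.0# R.≈ R.0#
    rootOfUnity   : ∀ x → ¬ x L.≈ L.0# → T x R.^ (Q ∸ 1) R.≈ R.1#
    ρ∘T           : ∀ x → ¬ x L.≈ L.0# → ρ (T x) L.≈ x
    T∘ρ           : ∀ ζ → ζ R.^ (Q ∸ 1) R.≈ R.1# → T (ρ ζ) R.≈ ζ

module _ {c ℓ q} (F : FiniteField c ℓ q) where
  open FiniteField F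

  record LinearCode (n : ℕ) a : Set (c ⊔ ℓ ⊔ lsuc a) where
    field
      Codeword : Pred (Vector Carrier n) a
      resp     : ∀ {x y} → (∀ j → x j ≈ y j) → Codeword x → Codeword y
      0-closed : Codeword (λ _ → 0#)
      +-closed : ∀ {x y} → Codeword x → Codeword y → Codeword (λ j → x j + y j)
      *-closed : ∀ s {x} → Codeword x → Codeword (λ j → s * x j)

  record IsGeneratorMatrix {k n a} (C : LinearCode n a)
    (G : Fin k → Fin n → Carrier) : Set (c ⊔ ℓ ⊔ a) where
    open LinearCode C
    field
      rows        : ∀ i → Codeword (G i)
      spanning    : ∀ {x} → Codeword x →
                    Σ[ s ∈ Vector Carrier k ] ∀ j → x j ≈ ∑ (λ i → s i * G i j)
      independent : ∀ (s : Vector Carrier k) →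
                    (∀ j → ∑ (λ i → s i * G i j) ≈ 0#) → ∀ i → s i ≈ 0#

  weight : ∀ {n} → Vector Carrier n → ℕ
  weight x = length (filter (λ j → ¬? (x j ≟ 0#)) (allFin _))

  module _ {n a} (D : Pred (Vector Carrier n) a) where

    Divisible : ℕ → Set (c ⊔ a)
    Divisible Δ = ∀ x → D x → Δ ℕ∣.∣ weight x

    -- The zero code is divisible by every power of p; its valuation is ⊤⁺.
    CodeValuation : ℕ → ℕ ⁺ → Set (c ⊔ a)
    CodeValuation p [ t ] = Divisible (p ℕ.^ t) × (∀ s → Divisible (p ℕ.^ s) → s ≤ t)
    CodeValuation p ⊤⁺    = ∀ s → Divisible (p ℕ.^ s)

module _ {c₁ ℓ₁ c₂ ℓ₂ q m}
  (K : FiniteField c₁ ℓ₁ q) (L : FiniteField c₂ ℓ₂ (q ℕ.^ m))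
  (ι : FiniteField.Carrier K → FiniteField.Carrier L) where
  private
    module K = FiniteField K
    module L = FiniteField L

  -- y is the trace x + x^q + ⋯ + x^(q^(m-1)) of x, regarded as an element
  -- of K via the embedding ι.
  IsTrace : L.Carrier → K.Carrier → Set ℓ₂
  IsTrace x y = ι y L.≈ L.∑ {m} (λ i → x L.^ (q ℕ.^ toℕ i))

  TraceCode : ∀ {n a} → LinearCode L n a → Pred (Vector K.Carrier n) (c₂ ⊔ ℓ₂ ⊔ a)
  TraceCode C y = ∃[ x ] LinearCode.Codeword C x × (∀ j → IsTrace (x j) (y j))

digitSum : ∀ {p} → Prime p → ℕ → ℕ
digitSum {p} pr a = ListAction.sum (List.map toℕ digits)
  where
  digits : List (Fin p)
  digits = proj₁
    (toDigits p {fromWitness (ℕ.nonTrivial⇒n>1 p {{prime⇒nonTrivial pr}})} a)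

∑ℕ : ∀ {k} → Vector ℕ k → ℕ
∑ℕ = Vector.foldr ℕ._+_ 0

ℕ⇒ℚ : ℕ → ℚ
ℕ⇒ℚ t = + t ℚ./ 1

_/[_-1] : ∀ {p} → ℕ → Prime p → ℚ
_/[_-1] {p} S pr = (+ S) ℚ./ (p ∸ 1)
  where instance
    p-1≢0 : NonZero (p ∸ 1)
    p-1≢0 = ℕ.>-nonZero (ℕ.m<n⇒0<n∸m (ℕ.nonTrivial⇒n>1 p {{prime⇒nonTrivial pr}}))

Admissible : ∀ {k Q} → ℕ → (Fin k → Fin Q) → Set
Admissible q r = (q ∸ 1) ℕ∣.∣ ∑ℕ (toℕ ∘ r) × 0 < ∑ℕ (toℕ ∘ r)

module _ {c₁ ℓ₁ c₂ ℓ₂ p e m k n} (pr : Prime p)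
  (L : FiniteField c₁ ℓ₁ ((p ℕ.^ e) ℕ.^ m))
  (R : ℤₚ[ξ ((p ℕ.^ e) ℕ.^ m ∸ 1) ] p c₂ ℓ₂)
  (T : FiniteField.Carrier L → ℤₚ[ξ_].Carrier R)
  (G : Fin k → Fin n → FiniteField.Carrier L) where
  open ℤₚ[ξ_] R

  -- T(0)⁰ = 1 holds by definition of _^_.
  powerSum : (Fin k → Fin ((p ℕ.^ e) ℕ.^ m)) → Carrier
  powerSum r = ∑ (λ j → ∏ (λ i → T (G i j) ^ toℕ (r i)))

  -- A subset of ℚ ∪ {∞}.  As ν is only available as a graph (equality with
  -- zero is undecidable), r contributes the value at any t with ν (powerSum r) t.
  Value : ℚ ⁺ → Set (c₂ ⊔ ℓ₂)
  Value v = ∃[ r ] ∃[ t ]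
    Admissible (p ℕ.^ e) r × ν (powerSum r) t ×
    v ≡ Maybe.map (λ t′ →
          ∑ℕ (λ i → digitSum pr (toℕ (r i))) /[ pr -1] ℚ.+ ℕ⇒ℚ t′ ℚ.- ℕ⇒ℚ e) t

-- Minimum of a subset of ℚ ∪ {∞}; that of the empty set is ∞.
IsMinimum : ∀ {a} → Pred (ℚ ⁺) a → ℚ ⁺ → Set a
IsMinimum P v = (v ≡ ⊤⁺ ⊎ P v) × (∀ w → P w → v ≤⁺ w)
  where open Supremum ℚ._≤_

{-# OPTIONS --safe #-}
module Submission where

open import Defs
open import Algebra.Bundles using (CommutativeRing)
open import Algebra.Morphism.Structures using (module RingMorphisms)
import Algebra.Properties.CommutativeMonoid.Sum
import Algebra.Properties.CommutativeSemiring.Binomial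
import Algebra.Properties.CommutativeSemiring.Exp
import Algebra.Properties.Ring
import Algebra.Properties.Semiring.Exp
import Algebra.Properties.Semiring.Mult
import Algebra.Properties.Semiring.Sum
import Algebra.Solver.Ring.NaturalCoefficients.Default as NaturalCoefficients
open import Data.Digit using (fromDigits; toDigits)
open import Data.Fin.Base using (Fin; zero; suc; toℕ; fromℕ; fromℕ<; inject₁; punchOut)
open import Data.Fin.Permutation using (Permutation; permutation; _⟨$⟩ʳ_)
import Data.Fin.Properties as Fin
import Data.Integer.Base as ℤ
import Data.Integer.Divisibility.Signed as ℤ∣
import Data.Integer.Properties as ℤ
open import Data.List.Base as List using (List; []; _∷_; length; filter; allFin)
open import Data.List.Properties using (filter-≐; filter-none)
import Data.List.Relation.Unary.All as All
open import Data.Maybe.Base using (map)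
open import Data.Nat.Base as ℕ using (ℕ; zero; suc; _∸_; _≤_; _<_; NonZero; s≤s; z≤n; z<s)
open import Data.Nat.Combinatorics using (nC1≡n; nCn≡1; nCk+nC[k+1]≡[n+1]C[k+1]; k>n⇒nCk≡0) renaming (_C_ to _choose_)
open import Data.Nat.Coprimality using (coprime-Bézout; prime⇒coprime)
import Data.Nat.Divisibility as ℕ∣
import Data.Nat.DivMod as ℕ
open import Data.Nat.GCD using (module Bézout)
open import Data.Nat.Induction using (<-rec)
import Data.Nat.ListAction as ListAction
open import Data.Nat.Primality using (Prime; euclidsLemma; prime⇒nonTrivial; prime⇒nonZero)
import Data.Nat.Properties as ℕ
open import Data.Nat.Tactic.RingSolver using (solve-∀)
open import Data.Product.Base using (∃-syntax; _×_; _,_; proj₁; proj₂)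
open import Data.Rational.Base as ℚ using (ℚ)
import Data.Rational.Properties as ℚ
import Data.Rational.Unnormalised.Base as ℚᵘ
import Data.Rational.Unnormalised.Properties as ℚᵘ
open import Data.Sum.Base using (inj₁; inj₂)
open import Data.Vec.Base using (Vec; []; _∷_; lookup; tabulate)
open import Data.Vec.Functional using (Vector)
import Data.Vec.Properties as Vec
open import Function.Base using (_∘_)
open import Function.Bundles using (Inverse; Equivalence)
open import Level using (Level; _⊔_)
open import Relation.Binary.Definitions using (tri<; tri≈; tri>)
import Relation.Binary.Construct.Add.Supremum.NonStrict as Supremum
open import Relation.Binary.PropositionalEquality as ≡ using (_≡_; _≢_)
import Relation.Binary.Reasoning.Setoid as SetoidReasoning
open import Relation.Nullary.Construct.Add.Supremum using (_⁺; [_]; ⊤⁺)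
open import Relation.Nullary.Decidable using (Dec; yes; no; map′; ¬?; decidable-stable; fromWitness; _×-dec_)
open import Relation.Nullary.Negation using (¬_; contradiction)
open import Relation.Unary using (Pred)

-- For x ∈ 𝔽_{q^m} let E(x) be q − 1 if tr x = 0 and −1 otherwise.  Expand
-- x ↦ E(x₁ + ⋯ + x_k) in the monomials T(x)^r with coefficients e_r.  Then e_r = 0
-- unless (q − 1) ∣ |r|, and q times the weight of a codeword of the trace code is
-- −∑_{r ≠ 0} e_r (∑_j ∏_i T(g_ij)^(r_i)) T(s)^r, where s are its coordinates.  The
-- monomials form a basis of the functions on 𝔽_{q^m}^k whose dual basis is
-- integral, so the minimal valuation of the weights is that of the coefficients,
-- and it remains to see that ν(e_r) = ∑ S(r_i) / (p − 1).
--
-- Lower bound: h(x) = ∑_i ∑_j T(x_i)^(q^j) lifts the trace, so h^((q−1)p^u) tends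
-- p-adically to the indicator of tr ≠ 0.  Since p-th powers preserve the span
-- of the p^a T^s with ∑ S(s_i) ≤ 1 + (p − 1) a, the power h^((q−1)p^u) lies in the span
-- of the p^a T^s with ∑ S(s_i) ≤ (p − 1)(e + a).
--
-- Equality: q [tr t = 0] E(s) = ∑_{c ∈ 𝔽_q} E(s − c t) evaluates the correlations of
-- E, whence e_r e_{r*} is a unit times the power of p predicted by the sum of
-- the two lower bounds, where r*_i = q^m − 1 − r_i (and q^m − 1 if r_i = q^m − 1).

-- With p-th roots of unity at hand, `E` is a sum of additive characters, the coefficients e_r are
-- essentially products of Gauss sums, and their valuation is Stickelberger's theorem. The ring
-- ℤₚ[ξ] need not contain such roots, so only the integer values of `E` are used, and a squeeze
-- replaces Stickelberger's congruence: the two factors of e_r e_{r*} have lower bounds whose sum is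
-- the exact valuation of the product, so neither bound can be strict. The weight p - 1 of a factor
-- p is that of a uniformiser π with π^(p-1) of the size of p: digit sums play the role of π-adic
-- valuations. The term - e of the theorem comes from the factor q = p^e between a weight and its
-- character sum. Equality with zero is undecidable in the ring, but divisibility by a fixed power
-- of p is decidable through the residue field. Valuations are therefore treated as families of
-- divisibilities, and the exponent attaining the minimum is found by a finite search.

-- Digit sums in base p

module DigitSums {p} (p-prime : Prime p) where
  open import Data.Nat.Base
  open import Data.Nat.DivMod
  open import Data.Nat.Properties
  open ≡ using (refl; sym; trans; cong; cong₂; subst; module ≡-Reasoning)

  opaque
    S : ℕ → ℕ
    S = digitSum p-prime

    S≡digitSum : ∀ n → S n ≡ digitSum p-prime n
    S≡digitSum n = refl

  private instance
    p≢0 : NonZero p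
    p≢0 = prime⇒nonZero p-prime

  1<p : 1 < p
  1<p = nonTrivial⇒n>1 p {{prime⇒nonTrivial p-prime}}

  divMod-unique : ∀ {a b} n m → a < p → b < p → a + n * p ≡ b + m * p → a ≡ b × n ≡ m
  divMod-unique {a} {b} n m a<p b<p eq = a≡b , *-cancelʳ-≡ n m p (+-cancelˡ-≡ a _ _ (trans eq (cong (_+ m * p) (sym a≡b))))
    where
    a≡b : a ≡ b
    a≡b = begin
      a  ≡⟨ m<n⇒m%n≡m a<p ⟨
      a % p  ≡⟨ [m+kn]%n≡m%n a n p ⟨
      (a + n * p) % p  ≡⟨ cong (_% p) eq ⟩
      (b + m * p) % p  ≡⟨ [m+kn]%n≡m%n b m p ⟩
      b % p  ≡⟨ m<n⇒m%n≡m b<p ⟩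
      b  ∎
      where open ≡-Reasoning

  private
    total : List (Fin p) → ℕ
    total ds = ListAction.sum (List.map toℕ ds)

  zero-digits : ∀ (ds : List (Fin p)) → 0 ≡ fromDigits ds → total ds ≡ 0
  zero-digits []       _  = refl
  zero-digits (d ∷ ds) eq with divMod-unique 0 (fromDigits ds) (<-trans z<s 1<p) (Fin.toℕ<n d) eq
  ... | d≡0 , ds≡0 = cong₂ _+_ (sym d≡0) (zero-digits ds ds≡0)

  -- Expansions may end in different numbers of zero digits, so the lists themselves need not agree;
  -- only their totals do.
  digits-unique : ∀ (ds ds′ : List (Fin p)) → fromDigits ds ≡ fromDigits ds′ → total ds ≡ total ds′
  digits-unique []       ds′        eq = sym (zero-digits ds′ eq)
  digits-unique (d ∷ ds) []         eq = zero-digits (d ∷ ds) (sym eq)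
  digits-unique (d ∷ ds) (d′ ∷ ds′) eq
    with divMod-unique (fromDigits ds) (fromDigits ds′) (Fin.toℕ<n d) (Fin.toℕ<n d′) eq
  ... | d≡d′ , ds≡ds′ = cong₂ _+_ d≡d′ (digits-unique ds ds′ ds≡ds′)

  private
    expand : ∀ n → ∃[ ds ] fromDigits ds ≡ n
    expand = toDigits p {fromWitness 1<p}

  opaque
    unfolding S

    S-0 : S 0 ≡ 0
    S-0 = digits-unique (proj₁ (expand 0)) [] (proj₂ (expand 0))

    S-digit : ∀ {d} n → d < p → S (d + n * p) ≡ d + S n
    S-digit {d} n d<p = trans
      (digits-unique (proj₁ (expand (d + n * p))) (fromℕ< d<p ∷ proj₁ (expand n))
        (trans (proj₂ (expand (d + n * p)))
          (sym (cong₂ (λ a b → a + b * p) (Fin.toℕ-fromℕ< d<p) (proj₂ (expand n))))))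
      (cong (_+ S n) (Fin.toℕ-fromℕ< d<p))

  S-shift : ∀ n → S (n * p) ≡ S n
  S-shift n = S-digit n (<-trans z<s 1<p)

  S-1 : S 1 ≡ 1
  S-1 = trans (S-digit 0 1<p) (cong suc S-0)

  S-p^ : ∀ u → S (p ^ u) ≡ 1
  S-p^ zero    = S-1
  S-p^ (suc u) = trans (cong S (*-comm p (p ^ u))) (trans (S-shift (p ^ u)) (S-p^ u))

  private
    splitting : ∀ n → n ≡ n % p + n / p * p
    splitting n = m≡m%n+[m/n]*n n p

    quotient< : ∀ n .{{_ : NonZero n}} → n / p < n
    quotient< n = m/n<m n p 1<p

  -- Without a carry the digit sum grows by exactly 1; with one, the last digit p - 1 is lost and
  -- induction applies to the quotient.
  S-suc : ∀ n → S (suc n) ≤ suc (S n)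
  S-suc = <-rec _ step
    where
    step : ∀ n → (∀ {m} → m < n → S (suc m) ≤ suc (S m)) → S (suc n) ≤ suc (S n)
    step zero      _   = ≤-reflexive (trans S-1 (cong suc (sym S-0)))
    step n@(suc _) rec with suc (n % p) <? p
    ... | yes d<p = ≤-reflexive (begin
      S (suc n)  ≡⟨ cong (λ i → S (suc i)) (splitting n) ⟩
      S (suc (n % p) + n / p * p)  ≡⟨ S-digit (n / p) d<p ⟩
      suc (n % p + S (n / p))  ≡⟨ cong suc (S-digit (n / p) (m%n<n n p)) ⟨
      suc (S (n % p + n / p * p))  ≡⟨ cong (λ i → suc (S i)) (splitting n) ⟨
      suc (S n)  ∎)
      where open ≡-Reasoning
    ... | no d≮p = begin
      S (suc n)  ≡⟨ cong (λ i → S (suc i)) (splitting n) ⟩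
      S (suc (n % p) + n / p * p)  ≡⟨ cong (λ i → S (i + n / p * p)) (≤-antisym (m%n<n n p) (≮⇒≥ d≮p)) ⟩
      S (suc (n / p) * p)  ≡⟨ S-shift (suc (n / p)) ⟩
      S (suc (n / p))  ≤⟨ rec (quotient< n) ⟩
      suc (S (n / p))  ≤⟨ s≤s (m≤n+m (S (n / p)) (n % p)) ⟩
      suc (n % p + S (n / p))  ≡⟨ cong suc (S-digit (n / p) (m%n<n n p)) ⟨
      suc (S (n % p + n / p * p))  ≡⟨ cong (λ i → suc (S i)) (splitting n) ⟨
      suc (S n)  ∎
      where open ≤-Reasoning

  S-+ˡ : ∀ c n → S (c + n) ≤ c + S n
  S-+ˡ zero    n = ≤-refl
  S-+ˡ (suc c) n = ≤-trans (S-suc (c + n)) (s≤s (S-+ˡ c n))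

  -- Here `d` need not be a digit: a carry of c into the next place removes c p units and adds at
  -- most c to the digit sum there.
  S-carry : ∀ d n → S (d + n * p) ≤ d + S n
  S-carry d n = begin
    S (d + n * p)  ≡⟨ cong (λ i → S (i + n * p)) (splitting d) ⟩
    S (d % p + d / p * p + n * p)  ≡⟨ cong S (lemma (d % p) (d / p) n p) ⟩
    S (d % p + (d / p + n) * p)  ≡⟨ S-digit (d / p + n) (m%n<n d p) ⟩
    d % p + S (d / p + n)  ≤⟨ +-monoʳ-≤ (d % p) (S-+ˡ (d / p) n) ⟩
    d % p + (d / p + S n)  ≤⟨ +-monoʳ-≤ (d % p) (+-monoˡ-≤ (S n) (m≤m*n (d / p) p)) ⟩
    d % p + (d / p * p + S n)  ≡⟨ +-assoc (d % p) (d / p * p) (S n) ⟨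
    d % p + d / p * p + S n  ≡⟨ cong (_+ S n) (splitting d) ⟨
    d + S n  ∎
    where
    open ≤-Reasoning
    lemma : ∀ a b c d → a + b * d + c * d ≡ a + (b + c) * d
    lemma = solve-∀

  S-subadditive : ∀ a b → S (a + b) ≤ S a + S b
  S-subadditive = <-rec _ step
    where
    step : ∀ a → (∀ {a′} → a′ < a → ∀ b → S (a′ + b) ≤ S a′ + S b) → ∀ b → S (a + b) ≤ S a + S b
    step zero      _   b = m≤n+m (S b) (S 0)
    step a@(suc _) rec b = begin
      S (a + b)  ≡⟨ cong₂ (λ i j → S (i + j)) (splitting a) (splitting b) ⟩
      S (a % p + a / p * p + (b % p + b / p * p))  ≡⟨ cong S (lemma (a % p) (a / p) p (b % p) (b / p)) ⟩
      S (a % p + b % p + (a / p + b / p) * p)  ≤⟨ S-carry (a % p + b % p) (a / p + b / p) ⟩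
      a % p + b % p + S (a / p + b / p)  ≤⟨ +-monoʳ-≤ (a % p + b % p) (rec (quotient< a) (b / p)) ⟩
      a % p + b % p + (S (a / p) + S (b / p))  ≡⟨ lemma′ (a % p) (b % p) (S (a / p)) (S (b / p)) ⟩
      (a % p + S (a / p)) + (b % p + S (b / p))  ≡⟨ cong₂ _+_ (S-digit (a / p) (m%n<n a p)) (S-digit (b / p) (m%n<n b p)) ⟨
      S (a % p + a / p * p) + S (b % p + b / p * p)  ≡⟨ cong₂ (λ i j → S i + S j) (splitting a) (splitting b) ⟨
      S a + S b  ∎
      where
      open ≤-Reasoning
      lemma : ∀ a b c d e → a + b * c + (d + e * c) ≡ a + d + (b + e) * c
      lemma = solve-∀
      lemma′ : ∀ a b c d → a + b + (c + d) ≡ (a + c) + (b + d)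
      lemma′ = solve-∀

  S-block : ∀ j {a} b → a < p ^ j → S (a + b * p ^ j) ≡ S a + S b
  S-block zero    {zero} b _ = trans (cong S (*-identityʳ b)) (cong (_+ S b) (sym S-0))
  S-block zero    {suc _} b (s≤s ())
  S-block (suc j) {a} b a<p^ = begin
    S (a + b * (p * p ^ j))  ≡⟨ cong (λ i → S (i + b * (p * p ^ j))) (splitting a) ⟩
    S (a % p + a / p * p + b * (p * p ^ j))  ≡⟨ cong S (lemma (a % p) (a / p) p b (p ^ j)) ⟩
    S (a % p + (a / p + b * p ^ j) * p)  ≡⟨ S-digit (a / p + b * p ^ j) (m%n<n a p) ⟩
    a % p + S (a / p + b * p ^ j)  ≡⟨ cong (a % p +_) (S-block j b (m<n*o⇒m/o<n (subst (a <_) (*-comm p (p ^ j)) a<p^))) ⟩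
    a % p + (S (a / p) + S b)  ≡⟨ +-assoc (a % p) (S (a / p)) (S b) ⟨
    a % p + S (a / p) + S b  ≡⟨ cong (_+ S b) (S-digit (a / p) (m%n<n a p)) ⟨
    S (a % p + a / p * p) + S b  ≡⟨ cong (λ i → S i + S b) (splitting a) ⟨
    S a + S b  ∎
    where
    open ≡-Reasoning
    lemma : ∀ a b c d e → a + b * c + d * (c * e) ≡ a + (b + d * e) * c
    lemma = solve-∀

  -- All j digits of p^j - 1 equal p - 1, so adding a and b produces no carry and their digits are
  -- complementary place by place.
  S-complement : ∀ j a b → suc (a + b) ≡ p ^ j → S a + S b ≡ (p ∸ 1) * j
  S-complement zero    a b eq = begin
    S a + S b  ≡⟨ cong₂ (λ i j → S i + S j) (m+n≡0⇒m≡0 a (suc-injective eq)) (m+n≡0⇒n≡0 a (suc-injective eq)) ⟩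
    S 0 + S 0  ≡⟨ cong (λ i → i + i) S-0 ⟩
    0  ≡⟨ *-zeroʳ (p ∸ 1) ⟨
    (p ∸ 1) * 0  ∎
    where open ≡-Reasoning
  S-complement (suc j) a b eq = begin
    S a + S b  ≡⟨ cong (_+ S b) (trans (cong S (splitting a)) (S-digit a′ (m%n<n a p))) ⟩
    (a % p + S a′) + S b  ≡⟨ cong (λ i → (a % p + S a′) + S i) b≡ ⟩
    (a % p + S a′) + S (d′ + b′ * p)  ≡⟨ cong ((a % p + S a′) +_) (S-digit b′ d′<p) ⟩
    (a % p + S a′) + (d′ + S b′)  ≡⟨ lemma (a % p) (S a′) d′ (S b′) ⟩
    (a % p + d′) + (S a′ + S b′)  ≡⟨ cong₂ _+_ d+d′ (S-complement j a′ b′ a′+b′) ⟩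
    (p ∸ 1) + (p ∸ 1) * j  ≡⟨ *-suc (p ∸ 1) j ⟨
    (p ∸ 1) * suc j  ∎
    where
    open ≡-Reasoning
    a′ d′ b′ : ℕ
    a′ = a / p
    d′ = p ∸ 1 ∸ a % p
    b′ = p ^ j ∸ suc a′
    lemma : ∀ a b c d → (a + b) + (c + d) ≡ (a + c) + (b + d)
    lemma = solve-∀
    lemma′ : ∀ a b c d e → suc (a + b * e + (c + d * e)) ≡ suc (a + c) + (b + d) * e
    lemma′ = solve-∀
    1+[p∸1] : suc (p ∸ 1) ≡ p
    1+[p∸1] = suc-pred p
    d+d′ : a % p + d′ ≡ p ∸ 1
    d+d′ = m+[n∸m]≡n (s≤s⁻¹ (subst (a % p <_) (sym 1+[p∸1]) (m%n<n a p)))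
    d′<p : d′ < p
    d′<p = ≤-trans (s≤s (m∸n≤m (p ∸ 1) (a % p))) (≤-reflexive 1+[p∸1])
    a<p^ : a < p ^ suc j
    a<p^ = subst (a <_) eq (s≤s (m≤m+n a b))
    a′+b′ : suc (a′ + b′) ≡ p ^ j
    a′+b′ = m+[n∸m]≡n (m<n*o⇒m/o<n (subst (a <_) (*-comm p (p ^ j)) a<p^))
    b≡ : b ≡ d′ + b′ * p
    b≡ = +-cancelˡ-≡ (suc a) _ _ (begin
      suc a + b  ≡⟨ eq ⟩
      p * p ^ j  ≡⟨ cong (p *_) a′+b′ ⟨
      p * suc (a′ + b′)  ≡⟨ *-comm p (suc (a′ + b′)) ⟩
      p + (a′ + b′) * p  ≡⟨ cong (_+ (a′ + b′) * p) (trans (cong suc d+d′) 1+[p∸1]) ⟨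
      suc (a % p + d′) + (a′ + b′) * p  ≡⟨ lemma′ (a % p) a′ d′ b′ p ⟨
      suc (a % p + a′ * p + (d′ + b′ * p))  ≡⟨ cong (λ i → suc (i + (d′ + b′ * p))) (splitting a) ⟨
      suc a + (d′ + b′ * p)  ∎)

  -- Because p ≡ 1 modulo p - 1. This is what makes the digit sums of admissible exponents divisible
  -- by p - 1.
  S-congruence : ∀ n → ∃[ c ] n ≡ S n + c * (p ∸ 1)
  S-congruence = <-rec _ step
    where
    step : ∀ n → (∀ {m} → m < n → ∃[ c ] m ≡ S m + c * (p ∸ 1)) → ∃[ c ] n ≡ S n + c * (p ∸ 1)
    step zero      _   = 0 , sym (trans (+-identityʳ (S 0)) S-0)
    step n@(suc _) rec with c , eq ← rec (quotient< n) = n / p + c , (begin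
      n  ≡⟨ splitting n ⟩
      n % p + n / p * p  ≡⟨ cong (λ i → n % p + n / p * i) (suc-pred p) ⟨
      n % p + n / p * suc (p ∸ 1)  ≡⟨ lemma (n % p) (n / p) (p ∸ 1) ⟩
      n % p + n / p + n / p * (p ∸ 1)  ≡⟨ cong (λ i → n % p + i + n / p * (p ∸ 1)) eq ⟩
      n % p + (S (n / p) + c * (p ∸ 1)) + n / p * (p ∸ 1)  ≡⟨ lemma′ (n % p) (S (n / p)) c (p ∸ 1) (n / p) ⟩
      n % p + S (n / p) + (n / p + c) * (p ∸ 1)  ≡⟨ cong (_+ (n / p + c) * (p ∸ 1)) (S-digit (n / p) (m%n<n n p)) ⟨
      S (n % p + n / p * p) + (n / p + c) * (p ∸ 1)  ≡⟨ cong (λ i → S i + (n / p + c) * (p ∸ 1)) (splitting n) ⟨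
      S n + (n / p + c) * (p ∸ 1)  ∎)
      where
      open ≡-Reasoning
      lemma : ∀ a b c → a + b * suc c ≡ a + b + b * c
      lemma = solve-∀
      lemma′ : ∀ a b c d e → a + (b + c * d) + e * d ≡ a + b + (e + c) * d
      lemma′ = solve-∀

  -- Adding up the base-pʲ digits of n neither changes n modulo pʲ − 1 nor
  -- increases its digit sum.
  S-reduce : ∀ j → 1 < p ^ j → ∀ n → 0 < n → ∃[ r ] ∃[ c ]
    0 < r × r < p ^ j × n ≡ r + c * (p ^ j ∸ 1) × S r ≤ S n
  S-reduce j 1<Q = <-rec _ step
    where
    Q = p ^ j
    instance
      Q≢0 : NonZero Q
      Q≢0 = m^n≢0 p j
    step : ∀ n → (∀ {m} → m < n → 0 < m → ∃[ r ] ∃[ c ] 0 < r × r < Q × m ≡ r + c * (Q ∸ 1) × S r ≤ S m) →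
      0 < n → ∃[ r ] ∃[ c ] 0 < r × r < Q × n ≡ r + c * (Q ∸ 1) × S r ≤ S n
    step n rec 0<n with n <? Q
    ... | yes n<Q = n , 0 , 0<n , n<Q , sym (+-identityʳ n) , ≤-refl
    ... | no n≮Q =
      let r , c , 0<r , r<Q , m≡ , Sr≤ = rec m<n 0<m
      in r , c + b , 0<r , r<Q , n≡ r c m≡ , ≤-trans Sr≤ Sm≤
      where
      a = n % Q
      b = n / Q
      m = a + b
      0<b : 0 < b
      0<b = m≥n⇒m/n>0 (≮⇒≥ n≮Q)
      0<m : 0 < m
      0<m = ≤-trans 0<b (m≤n+m b a)
      m+ : n ≡ m + b * (Q ∸ 1)
      m+ = begin
        n  ≡⟨ m≡m%n+[m/n]*n n Q ⟩
        a + b * Q  ≡⟨ cong (λ i → a + b * i) (suc-pred Q) ⟨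
        a + b * suc (Q ∸ 1)  ≡⟨ cong (a +_) (*-suc b (Q ∸ 1)) ⟩
        a + (b + b * (Q ∸ 1))  ≡⟨ +-assoc a b _ ⟨
        m + b * (Q ∸ 1)  ∎
        where open ≡-Reasoning
      m<n : m < n
      m<n = subst (m <_) (sym m+) (m<m+n m (*-mono-≤ 0<b (m<n⇒0<n∸m 1<Q)))
      n≡ : ∀ r c → m ≡ r + c * (Q ∸ 1) → n ≡ r + (c + b) * (Q ∸ 1)
      n≡ r c m≡ = begin
        n  ≡⟨ m+ ⟩
        m + b * (Q ∸ 1)  ≡⟨ cong (_+ b * (Q ∸ 1)) m≡ ⟩
        r + c * (Q ∸ 1) + b * (Q ∸ 1)  ≡⟨ +-assoc r _ _ ⟩
        r + (c * (Q ∸ 1) + b * (Q ∸ 1))  ≡⟨ cong (r +_) (*-distribʳ-+ (Q ∸ 1) c b) ⟨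
        r + (c + b) * (Q ∸ 1)  ∎
        where open ≡-Reasoning
      Sm≤ : S m ≤ S n
      Sm≤ = begin
        S (a + b)  ≤⟨ S-subadditive a b ⟩
        S a + S b  ≡⟨ S-block j b (m%n<n n Q) ⟨
        S (a + b * Q)  ≡⟨ cong S (m≡m%n+[m/n]*n n Q) ⟨
        S n  ∎
        where open ≤-Reasoning

-- Finite sums and products in a commutative ring

module Sums {c ℓ} (A : CommutativeRing c ℓ) where
  open CommutativeRing A hiding (zero)
  open RingOps A hiding (∑; ∏)
  private module Ops = RingOps A
  open Algebra.Properties.Ring ring public
    using (-1*x≈-x; -‿distribˡ-*; -‿distribʳ-*; -0#≈0#; -‿involutive; +-cancelʳ; [y-z]x≈yx-zx; x[y-z]≈xy-xz)
  open Algebra.Properties.Semiring.Exp semiring public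
    using (^-congˡ; ^-congʳ; ^-homo-*; ^-assocʳ)
  open Algebra.Properties.Semiring.Mult semiring public
    using (×-congˡ; ×-congʳ; ×-homo-1; ×-homo-+; ×-assoc-*; ×1-homo-*)
  open Algebra.Properties.CommutativeSemiring.Exp commutativeSemiring public
    using (^-distrib-*)
  private
    module S = Algebra.Properties.Semiring.Sum semiring
    module M = Algebra.Properties.CommutativeMonoid.Sum *-commutativeMonoid
  open SetoidReasoning setoid
  module Solver = NaturalCoefficients commutativeSemiring

  -- Sealed, so that unification can read off the summand.
  opaque
    ∑ ∏ : ∀ {n} → (Fin n → Carrier) → Carrier
    ∑ = Ops.∑
    ∏ = Ops.∏

    ∑≈ : ∀ {n} (f : Fin n → Carrier) → Ops.∑ f ≈ ∑ f
    ∑≈ _ = refl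

    ∏≈ : ∀ {n} (f : Fin n → Carrier) → Ops.∏ f ≈ ∏ f
    ∏≈ _ = refl

    ∑-zero : ∀ {f : Fin 0 → Carrier} → ∑ f ≈ 0#
    ∑-zero = refl

    ∑-suc : ∀ {n} (f : Fin (suc n) → Carrier) → ∑ f ≈ f zero + ∑ (f ∘ suc)
    ∑-suc _ = refl

    ∏-zero : ∀ {f : Fin 0 → Carrier} → ∏ f ≈ 1#
    ∏-zero = refl

    ∏-suc : ∀ {n} (f : Fin (suc n) → Carrier) → ∏ f ≈ f zero * ∏ (f ∘ suc)
    ∏-suc _ = refl

    ∑-cong : ∀ {n} {f g : Fin n → Carrier} → (∀ i → f i ≈ g i) → ∑ f ≈ ∑ g
    ∑-cong = S.sum-cong-≋

    ∏-cong : ∀ {n} {f g : Fin n → Carrier} → (∀ i → f i ≈ g i) → ∏ f ≈ ∏ g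
    ∏-cong = M.sum-cong-≋

    ∑-distrib-+ : ∀ {n} (f g : Fin n → Carrier) → ∑ (λ i → f i + g i) ≈ ∑ f + ∑ g
    ∑-distrib-+ = S.∑-distrib-+

    ∏-distrib-* : ∀ {n} (f g : Fin n → Carrier) → ∏ (λ i → f i * g i) ≈ ∏ f * ∏ g
    ∏-distrib-* = M.∑-distrib-+

    ∑-comm : ∀ {m n} (f : Fin m → Fin n → Carrier) → ∑ (λ i → ∑ λ j → f i j) ≈ ∑ λ j → ∑ λ i → f i j
    ∑-comm = S.∑-comm

    *-distribˡ-∑ : ∀ {n} x (f : Fin n → Carrier) → x * ∑ f ≈ ∑ λ i → x * f i
    *-distribˡ-∑ = S.*-distribˡ-sum

    *-distribʳ-∑ : ∀ {n} x (f : Fin n → Carrier) → ∑ f * x ≈ ∑ λ i → f i * x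
    *-distribʳ-∑ = S.*-distribʳ-sum

    ∑-permute : ∀ {n} (f : Fin n → Carrier) (π : Permutation n n) → ∑ f ≈ ∑ λ i → f (π ⟨$⟩ʳ i)
    ∑-permute = S.∑-permute

    ∏-permute : ∀ {n} (f : Fin n → Carrier) (π : Permutation n n) → ∏ f ≈ ∏ λ i → f (π ⟨$⟩ʳ i)
    ∏-permute = M.∑-permute

    ∑-0 : ∀ {n} {f : Fin n → Carrier} → (∀ i → f i ≈ 0#) → ∑ f ≈ 0#
    ∑-0 {n} f≈0 = trans (S.sum-cong-≋ f≈0) (S.sum-replicate-zero n)

    ∑-replicate : ∀ n x → ∑ {n} (λ _ → x) ≈ n · x
    ∑-replicate n x = S.sum-replicate n

    ∏-replicate : ∀ n x → ∏ {n} (λ _ → x) ≈ x ^ n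
    ∏-replicate n x = M.sum-replicate n

    ∑-init-last : ∀ {n} (f : Fin (suc n) → Carrier) → ∑ f ≈ ∑ (f ∘ inject₁) + f (fromℕ n)
    ∑-init-last = S.sum-init-last

    ∏-1 : ∀ {k} {f : Fin k → Carrier} → (∀ i → f i ≈ 1#) → ∏ f ≈ 1#
    ∏-1 {zero}  f≈1 = refl
    ∏-1 {suc k} f≈1 = trans (*-cong (f≈1 zero) (∏-1 (f≈1 ∘ suc))) (*-identityˡ 1#)

    ∏-0 : ∀ {k} {f : Fin k → Carrier} i → f i ≈ 0# → ∏ f ≈ 0#
    ∏-0 zero    fi≈0 = trans (*-congʳ fi≈0) (zeroˡ _)
    ∏-0 (suc i) fi≈0 = trans (*-congˡ (∏-0 i fi≈0)) (zeroʳ _)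

    ∏-^ : ∀ {k} x (r : Fin k → ℕ) → ∏ (λ i → x ^ r i) ≈ x ^ ∑ℕ r
    ∏-^ {zero}  x r = refl
    ∏-^ {suc k} x r = trans (*-congˡ (∏-^ x (r ∘ suc))) (sym (^-homo-* x (r zero) _))

    ∑-single : ∀ {n} (f : Fin n → Carrier) i → (∀ j → j ≢ i → f j ≈ 0#) → ∑ f ≈ f i
    ∑-single f zero    f≈0 = trans (+-congˡ (∑-0 (λ j → f≈0 (suc j) λ ()))) (+-identityʳ _)
    ∑-single f (suc i) f≈0 =
      trans (+-cong (f≈0 zero λ ()) (∑-single (f ∘ suc) i λ j j≢i → f≈0 (suc j) (j≢i ∘ Fin.suc-injective)))
            (+-identityˡ _)

    ∑-toℕ : ∀ {n m} → n ≡ suc m → (f : ℕ → Carrier) →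
            ∑ {n} (f ∘ toℕ) ≈ f 0 + ∑ {m} (λ i → f (suc (toℕ i)))
    ∑-toℕ ≡.refl f = refl

  0^ : ∀ {n} → 0 ℕ.< n → 0# ^ n ≈ 0#
  0^ {suc n} _ = zeroˡ _

  1^ : ∀ n → 1# ^ n ≈ 1#
  1^ zero    = refl
  1^ (suc n) = trans (*-identityˡ _) (1^ n)

  ×-*ˡ : ∀ n x → n · x ≈ (n · 1#) * x
  ×-*ˡ n x = trans (×-congʳ n (sym (*-identityˡ x))) (sym (×-assoc-* n 1# x))

  ∑-const : ∀ n x → ∑ {n} (λ _ → x) ≈ (n · 1#) * x
  ∑-const n x = trans (∑-replicate n x) (×-*ˡ n x)

  ×1-homo-^ : ∀ n k → (n ℕ.^ k) · 1# ≈ (n · 1#) ^ k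
  ×1-homo-^ n zero    = ×-homo-1 1#
  ×1-homo-^ n (suc k) = trans (×1-homo-* n (n ℕ.^ k)) (*-congˡ (×1-homo-^ n k))

  if : ∀ {a} {X : Set a} → Dec X → Carrier
  if (yes _) = 1#
  if (no _)  = 0#

  if-yes : ∀ {a} {X : Set a} (d : Dec X) → X → if d ≈ 1#
  if-yes (yes _) _ = refl
  if-yes (no ¬x) x = contradiction x ¬x

  if-no : ∀ {a} {X : Set a} (d : Dec X) → ¬ X → if d ≈ 0#
  if-no (yes x) ¬x = contradiction x ¬x
  if-no (no _)  _  = refl

  if-cong : ∀ {a b} {X : Set a} {Y : Set b} (d : Dec X) (d′ : Dec Y) → (X → Y) → (Y → X) → if d ≈ if d′
  if-cong (yes x) d′ f g = sym (if-yes d′ (f x))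
  if-cong (no ¬x) d′ f g = sym (if-no d′ (¬x ∘ g))

  -- This is (x - y) G = x^n - y^n with the negative terms moved across, so that the solver for
  -- commutative semirings applies.
  geometric : ∀ n x y →
    y * ∑ {n} (λ i → x ^ (n ∸ suc (toℕ i)) * y ^ toℕ i) + x ^ n ≈
    x * ∑ {n} (λ i → x ^ (n ∸ suc (toℕ i)) * y ^ toℕ i) + y ^ n
  geometric zero    x y = +-congʳ (trans (*-congˡ ∑-zero) (trans (zeroʳ y) (sym (trans (*-congˡ ∑-zero) (zeroʳ x)))))
  geometric (suc n) x y = begin
    y * G′ + x * x ^ n  ≈⟨ +-congʳ (*-congˡ G′≈) ⟩
    y * (x ^ n + y * G) + x * x ^ n  ≈⟨ solve 4 (λ x y a b → y :* (a :+ y :* b) :+ x :* a := x :* a :+ y :* (y :* b :+ a)) refl x y (x ^ n) G ⟩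
    x * x ^ n + y * (y * G + x ^ n)  ≈⟨ +-congˡ (*-congˡ (geometric n x y)) ⟩
    x * x ^ n + y * (x * G + y ^ n)  ≈⟨ solve 5 (λ x y a b c → x :* a :+ y :* (x :* b :+ c) := x :* (a :+ y :* b) :+ y :* c) refl x y (x ^ n) G (y ^ n) ⟩
    x * (x ^ n + y * G) + y * y ^ n  ≈⟨ +-congʳ (*-congˡ G′≈) ⟨
    x * G′ + y * y ^ n  ∎
    where
    open Solver
    G  = ∑ {n} (λ i → x ^ (n ∸ suc (toℕ i)) * y ^ toℕ i)
    G′ = ∑ {suc n} (λ i → x ^ (n ∸ toℕ i) * y ^ toℕ i)
    G′≈ : G′ ≈ x ^ n + y * G
    G′≈ = trans (∑-suc _) (+-cong (*-identityʳ (x ^ n))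
      (trans (∑-cong {n} λ i → solve 3 (λ a y b → a :* (y :* b) := y :* (a :* b)) refl (x ^ (n ∸ suc (toℕ i))) y (y ^ toℕ i))
             (sym (*-distribˡ-∑ y _))))

  -- Index tuples are vectors rather than functions, so that comparing two of them needs no
  -- extensionality; `∑ᵛ-single` depends on this.
  ∑ᵛ : ∀ k {n} → (Vec (Fin n) k → Carrier) → Carrier
  ∑ᵛ zero    f = f []
  ∑ᵛ (suc k) f = ∑ λ a → ∑ᵛ k λ v → f (a ∷ v)

  ∑ᵛ-cong : ∀ k {n} {f g : Vec (Fin n) k → Carrier} → (∀ v → f v ≈ g v) → ∑ᵛ k f ≈ ∑ᵛ k g
  ∑ᵛ-cong zero    f≈g = f≈g []
  ∑ᵛ-cong (suc k) f≈g = ∑-cong λ a → ∑ᵛ-cong k λ v → f≈g (a ∷ v)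

  ∑ᵛ-distrib-+ : ∀ k {n} (f g : Vec (Fin n) k → Carrier) → ∑ᵛ k (λ v → f v + g v) ≈ ∑ᵛ k f + ∑ᵛ k g
  ∑ᵛ-distrib-+ zero    f g = refl
  ∑ᵛ-distrib-+ (suc k) f g = trans (∑-cong λ a → ∑ᵛ-distrib-+ k _ _) (∑-distrib-+ _ _)

  *-distribˡ-∑ᵛ : ∀ k {n} x (f : Vec (Fin n) k → Carrier) → x * ∑ᵛ k f ≈ ∑ᵛ k (λ v → x * f v)
  *-distribˡ-∑ᵛ zero    x f = refl
  *-distribˡ-∑ᵛ (suc k) x f = trans (*-distribˡ-∑ x _) (∑-cong λ a → *-distribˡ-∑ᵛ k x _)

  *-distribʳ-∑ᵛ : ∀ k {n} x (f : Vec (Fin n) k → Carrier) → ∑ᵛ k f * x ≈ ∑ᵛ k (λ v → f v * x)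
  *-distribʳ-∑ᵛ k x f = trans (*-comm _ x) (trans (*-distribˡ-∑ᵛ k x f) (∑ᵛ-cong k λ v → *-comm x (f v)))

  ∑ᵛ-0 : ∀ k {n} {f : Vec (Fin n) k → Carrier} → (∀ v → f v ≈ 0#) → ∑ᵛ k f ≈ 0#
  ∑ᵛ-0 zero    f≈0 = f≈0 []
  ∑ᵛ-0 (suc k) f≈0 = ∑-0 λ a → ∑ᵛ-0 k λ v → f≈0 (a ∷ v)

  ∑ᵛ-const : ∀ k {n} x → ∑ᵛ k {n} (λ _ → x) ≈ (n · 1#) ^ k * x
  ∑ᵛ-const zero    x = sym (*-identityˡ x)
  ∑ᵛ-const (suc k) {n} x = begin
    ∑ {n} (λ _ → ∑ᵛ k {n} λ _ → x)  ≈⟨ ∑-cong {n} (λ _ → ∑ᵛ-const k {n} x) ⟩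
    ∑ {n} (λ _ → (n · 1#) ^ k * x)  ≈⟨ ∑-const n _ ⟩
    (n · 1#) * ((n · 1#) ^ k * x)  ≈⟨ *-assoc _ _ _ ⟨
    (n · 1#) ^ suc k * x  ∎

  ∑-∑ᵛ-comm : ∀ k {n l} (f : Fin l → Vec (Fin n) k → Carrier) →
              ∑ (λ i → ∑ᵛ k (f i)) ≈ ∑ᵛ k λ v → ∑ λ i → f i v
  ∑-∑ᵛ-comm zero    f = refl
  ∑-∑ᵛ-comm (suc k) f = trans (∑-comm _) (∑-cong λ a → ∑-∑ᵛ-comm k _)

  ∑ᵛ-comm : ∀ k l {m n} (f : Vec (Fin m) k → Vec (Fin n) l → Carrier) →
            ∑ᵛ k (λ v → ∑ᵛ l (f v)) ≈ ∑ᵛ l λ u → ∑ᵛ k λ v → f v u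
  ∑ᵛ-comm zero    l f = refl
  ∑ᵛ-comm (suc k) l f = trans (∑-cong λ a → ∑ᵛ-comm k l _) (∑-∑ᵛ-comm l _)

  ∑ᵛ-∏ : ∀ k {n} (f : Fin k → Fin n → Carrier) →
         ∑ᵛ k (λ v → ∏ λ i → f i (lookup v i)) ≈ ∏ λ i → ∑ (f i)
  ∑ᵛ-∏ zero    f = trans ∏-zero (sym ∏-zero)
  ∑ᵛ-∏ (suc k) f = begin
    ∑ (λ a → ∑ᵛ k λ v → ∏ λ i → f i (lookup (a ∷ v) i))  ≈⟨ ∑-cong (λ a → trans (*-distribˡ-∑ᵛ k (f zero a) _) (sym (∑ᵛ-cong k λ v → ∏-suc _))) ⟨
    ∑ (λ a → f zero a * ∑ᵛ k λ v → ∏ λ i → f (suc i) (lookup v i))  ≈⟨ *-distribʳ-∑ _ (f zero) ⟨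
    ∑ (f zero) * (∑ᵛ k λ v → ∏ λ i → f (suc i) (lookup v i))  ≈⟨ *-congˡ (∑ᵛ-∏ k (f ∘ suc)) ⟩
    ∑ (f zero) * (∏ λ i → ∑ (f (suc i)))  ≈⟨ ∏-suc _ ⟨
    ∏ (λ i → ∑ (f i))  ∎

  ∑ᵛ-permute : ∀ k {n} (f : Vec (Fin n) k → Carrier) (π : Fin k → Permutation n n) →
    ∑ᵛ k f ≈ ∑ᵛ k λ v → f (tabulate λ i → π i ⟨$⟩ʳ lookup v i)
  ∑ᵛ-permute zero    f π = refl
  ∑ᵛ-permute (suc k) f π = trans (∑-permute _ (π zero)) (∑-cong λ a → ∑ᵛ-permute k _ (π ∘ suc))

  ∑ᵛ-single : ∀ k {n} (f : Vec (Fin n) k → Carrier) u → (∀ v → v ≢ u → f v ≈ 0#) → ∑ᵛ k f ≈ f u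
  ∑ᵛ-single zero    f []      f≈0 = refl
  ∑ᵛ-single (suc k) f (a ∷ u) f≈0 = trans
    (∑-single _ a λ b b≢a → ∑ᵛ-0 k λ v → f≈0 (b ∷ v) λ { ≡.refl → b≢a ≡.refl })
    (∑ᵛ-single k _ u λ v v≢u → f≈0 (a ∷ v) λ { ≡.refl → v≢u ≡.refl })

-- Binomial coefficients and p-th powers

absorption : ∀ n k → suc k ℕ.* (suc n choose suc k) ≡ suc n ℕ.* (n choose k)
absorption n       zero    = ≡.trans (ℕ.+-identityʳ _) (≡.trans (nC1≡n (suc n)) (≡.sym (ℕ.*-identityʳ (suc n))))
absorption zero    (suc k) = ≡.trans (≡.cong (suc (suc k) ℕ.*_) (k>n⇒nCk≡0 {1} {suc (suc k)} (ℕ.s≤s (ℕ.s≤s ℕ.z≤n))))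
                                     (ℕ.*-zeroʳ (suc (suc k)))
absorption (suc n) (suc k) = begin
  suc (suc k) ℕ.* (suc (suc n) choose suc (suc k))  ≡⟨ ≡.cong (suc (suc k) ℕ.*_) (nCk+nC[k+1]≡[n+1]C[k+1] (suc n) (suc k)) ⟨
  suc (suc k) ℕ.* (c ℕ.+ suc n choose suc (suc k))  ≡⟨ lemma (suc k) c (suc n choose suc (suc k)) ⟩
  c ℕ.+ suc k ℕ.* c ℕ.+ suc (suc k) ℕ.* (suc n choose suc (suc k))
    ≡⟨ ≡.cong₂ (λ i j → c ℕ.+ i ℕ.+ j) (absorption n k) (absorption n (suc k)) ⟩
  c ℕ.+ suc n ℕ.* (n choose k) ℕ.+ suc n ℕ.* (n choose suc k)  ≡⟨ lemma′ c (suc n) (n choose k) (n choose suc k) ⟩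
  c ℕ.+ suc n ℕ.* (n choose k ℕ.+ n choose suc k)  ≡⟨ ≡.cong (λ i → c ℕ.+ suc n ℕ.* i) (nCk+nC[k+1]≡[n+1]C[k+1] n k) ⟩
  suc (suc n) ℕ.* c  ∎
  where
  open ≡.≡-Reasoning
  c = suc n choose suc k
  lemma : ∀ k c d → suc k ℕ.* (c ℕ.+ d) ≡ c ℕ.+ k ℕ.* c ℕ.+ suc k ℕ.* d
  lemma = solve-∀
  lemma′ : ∀ c n a b → c ℕ.+ n ℕ.* a ℕ.+ n ℕ.* b ≡ c ℕ.+ n ℕ.* (a ℕ.+ b)
  lemma′ = solve-∀

-- By `absorption` p divides k (p choose k), and it cannot divide the smaller positive k.
p∣pCk : ∀ {p} → Prime p → ∀ k → 0 < k → k < p → p ℕ∣.∣ p choose k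
p∣pCk {suc n} p-prime (suc k) _ k<p
  with euclidsLemma (suc k) (suc n choose suc k) p-prime
         (ℕ∣.divides (n choose k) (≡.trans (absorption n k) (ℕ.*-comm (suc n) (n choose k))))
... | inj₁ p∣k = contradiction (ℕ∣.∣⇒≤ p∣k) (ℕ.<⇒≱ k<p)
... | inj₂ p∣C = p∣C

module Frobenius {c ℓ} (A : CommutativeRing c ℓ) {p} (p-prime : Prime p) where
  open CommutativeRing A hiding (zero)
  open RingOps A hiding (∑; ∏)
  open Sums A
  open SetoidReasoning setoid
  private instance
    p≢0 : NonZero p
    p≢0 = prime⇒nonZero p-prime

  term : ∀ x y → ℕ → Carrier
  term x y i = (p choose i) · (x ^ i * y ^ (p ∸ i))

  binomial : ∀ x y → (x + y) ^ p ≈ ∑ {suc p} (λ i → term x y (toℕ i))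
  binomial x y = trans (Algebra.Properties.CommutativeSemiring.Binomial.theorem commutativeSemiring p x y) (∑≈ _)

  p∣term : ∀ x y i → 0 < i → i < p → ∃[ c ] term x y i ≈ (p · 1#) * ((c · 1#) * (x ^ i * y ^ (p ∸ i)))
  p∣term x y i 0<i i<p with ℕ∣.divides c eq ← p∣pCk p-prime i 0<i i<p = c , (begin
    (p choose i) · z  ≈⟨ ×-*ˡ (p choose i) z ⟩
    ((p choose i) · 1#) * z  ≈⟨ *-congʳ (×-congˡ {1#} (≡.trans eq (ℕ.*-comm c p))) ⟩
    ((p ℕ.* c) · 1#) * z  ≈⟨ *-congʳ (×1-homo-* p c) ⟩
    ((p · 1#) * (c · 1#)) * z  ≈⟨ *-assoc _ _ _ ⟩
    (p · 1#) * ((c · 1#) * z)  ∎)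
    where z = x ^ i * y ^ (p ∸ i)

  term-0 : ∀ x y → term x y 0 ≈ y ^ p
  term-0 x y = trans (×-homo-1 _) (*-identityˡ _)

  term-p : ∀ x y → term x y p ≈ x ^ p
  term-p x y = begin
    (p choose p) · (x ^ p * y ^ (p ∸ p))  ≈⟨ ×-congˡ (nCn≡1 p) ⟩
    1 · (x ^ p * y ^ (p ∸ p))  ≈⟨ ×-homo-1 _ ⟩
    x ^ p * y ^ (p ∸ p)  ≈⟨ *-congˡ (^-congʳ y (ℕ.n∸n≡0 p)) ⟩
    x ^ p * 1#  ≈⟨ *-identityʳ _ ⟩
    x ^ p  ∎

  module _ (p≈0 : p · 1# ≈ 0#) where

    freshman : ∀ x y → (x + y) ^ p ≈ x ^ p + y ^ p
    freshman x y = begin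
      (x + y) ^ p  ≈⟨ binomial x y ⟩
      ∑ {suc p} (term x y ∘ toℕ)  ≈⟨ ∑-init-last {p} _ ⟩
      ∑ {p} (λ i → term x y (toℕ (inject₁ i))) + term x y (toℕ (fromℕ p))
        ≈⟨ +-cong first (trans (reflexive (≡.cong (term x y) (Fin.toℕ-fromℕ p))) (term-p x y)) ⟩
      y ^ p + x ^ p  ≈⟨ +-comm _ _ ⟩
      x ^ p + y ^ p  ∎
      where
      first : ∑ {p} (λ i → term x y (toℕ (inject₁ i))) ≈ y ^ p
      first = begin
        ∑ {p} (λ i → term x y (toℕ (inject₁ i)))  ≈⟨ ∑-cong {p} (λ i → reflexive (≡.cong (term x y) (Fin.toℕ-inject₁ i))) ⟩
        ∑ {p} (λ i → term x y (toℕ i))  ≈⟨ ∑-toℕ (≡.sym (ℕ.suc-pred p)) (term x y) ⟩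
        term x y 0 + ∑ {ℕ.pred p} (λ i → term x y (suc (toℕ i)))  ≈⟨ +-cong (term-0 x y) (∑-0 vanish) ⟩
        y ^ p + 0#  ≈⟨ +-identityʳ _ ⟩
        y ^ p  ∎
        where
        vanish : ∀ (i : Fin (ℕ.pred p)) → term x y (suc (toℕ i)) ≈ 0#
        vanish i with _ , eq ← p∣term x y (suc (toℕ i)) (ℕ.s≤s ℕ.z≤n)
                        (≡.subst (suc (toℕ i) <_) (ℕ.suc-pred p) (ℕ.s≤s (Fin.toℕ<n i)))
          = trans eq (trans (*-congʳ p≈0) (zeroˡ _))

    freshman-^ : ∀ n x y → (x + y) ^ (p ℕ.^ n) ≈ x ^ (p ℕ.^ n) + y ^ (p ℕ.^ n)
    freshman-^ zero    x y = trans (*-identityʳ _) (sym (+-cong (*-identityʳ x) (*-identityʳ y)))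
    freshman-^ (suc n) x y = begin
      (x + y) ^ (p ℕ.* p ℕ.^ n)  ≈⟨ ^-assocʳ (x + y) p (p ℕ.^ n) ⟨
      ((x + y) ^ p) ^ (p ℕ.^ n)  ≈⟨ ^-congˡ (p ℕ.^ n) (freshman x y) ⟩
      (x ^ p + y ^ p) ^ (p ℕ.^ n)  ≈⟨ freshman-^ n (x ^ p) (y ^ p) ⟩
      (x ^ p) ^ (p ℕ.^ n) + (y ^ p) ^ (p ℕ.^ n)  ≈⟨ +-cong (^-assocʳ x p (p ℕ.^ n)) (^-assocʳ y p (p ℕ.^ n)) ⟩
      x ^ (p ℕ.* p ℕ.^ n) + y ^ (p ℕ.* p ℕ.^ n)  ∎

    ∑-freshman : ∀ n {l} (f : Fin l → Carrier) → ∑ f ^ (p ℕ.^ n) ≈ ∑ λ i → f i ^ (p ℕ.^ n)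
    ∑-freshman n {zero}  f = trans (^-congˡ (p ℕ.^ n) ∑-zero) (trans (0^ (ℕ.m^n>0 p n)) (sym ∑-zero))
    ∑-freshman n {suc l} f = begin
      ∑ f ^ (p ℕ.^ n)  ≈⟨ ^-congˡ (p ℕ.^ n) (∑-suc f) ⟩
      (f zero + ∑ (f ∘ suc)) ^ (p ℕ.^ n)  ≈⟨ freshman-^ n _ _ ⟩
      f zero ^ (p ℕ.^ n) + ∑ (f ∘ suc) ^ (p ℕ.^ n)  ≈⟨ +-congˡ (∑-freshman n (f ∘ suc)) ⟩
      f zero ^ (p ℕ.^ n) + ∑ (λ i → f (suc i) ^ (p ℕ.^ n))  ≈⟨ ∑-suc _ ⟨
      ∑ (λ i → f i ^ (p ℕ.^ n))  ∎

  [1+w]^n : ∀ n w → ∃[ c ] (1# + w) ^ n ≈ 1# + (n · 1#) * w + w * w * c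
  [1+w]^n zero    w = 0# , sym (trans (+-cong (trans (+-congˡ (zeroˡ w)) (+-identityʳ 1#)) (zeroʳ _)) (+-identityʳ 1#))
  [1+w]^n (suc n) w with c , eq ← [1+w]^n n w = (n · 1#) + (1# + w) * c , (begin
    (1# + w) * (1# + w) ^ n  ≈⟨ *-congˡ eq ⟩
    (1# + w) * (1# + (n · 1#) * w + w * w * c)
      ≈⟨ solve 3 (λ w n c → (con 1 :+ w) :* (con 1 :+ n :* w :+ w :* w :* c) :=
                            con 1 :+ (con 1 :+ n) :* w :+ w :* w :* (n :+ (con 1 :+ w) :* c)) refl w (n · 1#) c ⟩
    1# + (1# + n · 1#) * w + w * w * ((n · 1#) + (1# + w) * c)  ∎)
    where open Solver

  -- Each p-th power gains a factor p: for w divisible by p^(n+1), both p w and w² are divisible by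
  -- p^(n+2), and (1 + w)^p has no other terms beyond 1.
  lift-1 : ∀ n z → ∃[ z′ ] (1# + (p · 1#) * z) ^ (p ℕ.^ n) ≈ 1# + (p · 1#) ^ suc n * z′
  lift-1 zero    z = z , trans (*-identityʳ _) (+-congˡ (*-congʳ (sym (*-identityʳ _))))
  lift-1 (suc n) z with z′ , eq ← lift-1 n z with c , eq′ ← [1+w]^n p ((p · 1#) ^ suc n * z′)
    = z′ + (p · 1#) ^ n * z′ * z′ * c , (begin
    (1# + P * z) ^ (p ℕ.* p ℕ.^ n)  ≈⟨ ^-congʳ _ (ℕ.*-comm p (p ℕ.^ n)) ⟩
    (1# + P * z) ^ (p ℕ.^ n ℕ.* p)  ≈⟨ ^-assocʳ _ (p ℕ.^ n) p ⟨
    ((1# + P * z) ^ (p ℕ.^ n)) ^ p  ≈⟨ ^-congˡ p eq ⟩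
    (1# + P * P ^ n * z′) ^ p  ≈⟨ eq′ ⟩
    1# + P * (P * P ^ n * z′) + (P * P ^ n * z′) * (P * P ^ n * z′) * c
      ≈⟨ solve 4 (λ P Q z c → con 1 :+ P :* (P :* Q :* z) :+ (P :* Q :* z) :* (P :* Q :* z) :* c :=
                              con 1 :+ P :* (P :* Q) :* (z :+ Q :* z :* z :* c)) refl P (P ^ n) z′ c ⟩
    1# + P * (P * P ^ n) * (z′ + P ^ n * z′ * z′ * c)  ∎)
    where
    open Solver
    P = p · 1#

-- Finite fields

module FieldProperties {c ℓ Q} (L : FiniteField c ℓ Q) where
  open FiniteField L hiding (zero; ∑; ∏)
  open Sums commutativeRing

  el : Fin Q → Carrier
  el = Inverse.from enumeration

  ix : Carrier → Fin Q
  ix = Inverse.to enumeration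

  el-ix : ∀ x → el (ix x) ≈ x
  el-ix x = Inverse.inverseʳ enumeration ≡.refl

  ix-el : ∀ i → ix (el i) ≡ i
  ix-el i = Inverse.inverseˡ enumeration refl

  ix-cong : ∀ {x y} → x ≈ y → ix x ≡ ix y
  ix-cong = Inverse.to-cong enumeration

  el-injective : ∀ {i j} → el i ≈ el j → i ≡ j
  el-injective {i} {j} eq = ≡.trans (≡.sym (ix-el i)) (≡.trans (ix-cong eq) (ix-el j))

  ix-injective : ∀ {x y} → ix x ≡ ix y → x ≈ y
  ix-injective {x} {y} eq = trans (sym (el-ix x)) (trans (reflexive (≡.cong el eq)) (el-ix y))

  domain : ∀ {x y} → ¬ x ≈ 0# → x * y ≈ 0# → y ≈ 0#
  domain {x} {y} x≉0 xy≈0 with x⁻¹ , xx⁻¹≈1 ← invertible x x≉0 = begin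
    y  ≈⟨ *-identityˡ y ⟨
    1# * y  ≈⟨ *-congʳ (trans (*-comm x⁻¹ x) xx⁻¹≈1) ⟨
    x⁻¹ * x * y  ≈⟨ *-assoc x⁻¹ x y ⟩
    x⁻¹ * (x * y)  ≈⟨ *-congˡ xy≈0 ⟩
    x⁻¹ * 0#  ≈⟨ zeroʳ x⁻¹ ⟩
    0#  ∎
    where open SetoidReasoning setoid

  nonzero-* : ∀ {x y} → ¬ x ≈ 0# → ¬ y ≈ 0# → ¬ x * y ≈ 0#
  nonzero-* x≉0 y≉0 xy≈0 = y≉0 (domain x≉0 xy≈0)

  nonzero-^ : ∀ {x} n → ¬ x ≈ 0# → ¬ x ^ n ≈ 0#
  nonzero-^ zero    x≉0 = 1≉0
  nonzero-^ (suc n) x≉0 = nonzero-* x≉0 (nonzero-^ n x≉0)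

  1<Q : 1 < Q
  1<Q = two-elements (ix 0#) (ix 1#) λ eq → 1≉0 (trans (sym (el-ix 1#)) (trans (reflexive (≡.cong el (≡.sym eq))) (el-ix 0#)))
    where
    two-elements : ∀ {n} (i j : Fin n) → i ≢ j → 1 < n
    two-elements {suc zero}    zero zero i≢j = contradiction ≡.refl i≢j
    two-elements {suc (suc n)} _    _    _   = s≤s (s≤s z≤n)

  scale : ∀ x y → x * y ≈ 1# → Permutation Q Q
  scale x y xy≈1 = permutation (λ i → ix (x * el i)) (λ i → ix (y * el i))
    (λ i → cancel x y (trans xy≈1 refl) i) (λ i → cancel y x (trans (*-comm y x) xy≈1) i)
    where
    open SetoidReasoning setoid
    cancel : ∀ x y → x * y ≈ 1# → ∀ i → ix (x * el (ix (y * el i))) ≡ i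
    cancel x y xy≈1 i = ≡.trans (ix-cong (begin
      x * el (ix (y * el i))  ≈⟨ *-congˡ (el-ix _) ⟩
      x * (y * el i)  ≈⟨ *-assoc x y _ ⟨
      x * y * el i  ≈⟨ *-congʳ xy≈1 ⟩
      1# * el i  ≈⟨ *-identityˡ _ ⟩
      el i  ∎)) (ix-el i)

  translate : Carrier → Permutation Q Q
  translate t = permutation (λ i → ix (el i - t)) (λ i → ix (el i + t))
    (λ i → ≡.trans (ix-cong (begin
      el (ix (el i + t)) - t  ≈⟨ +-congʳ (el-ix _) ⟩
      el i + t - t  ≈⟨ +-assoc _ _ _ ⟩
      el i + (t - t)  ≈⟨ +-congˡ (-‿inverseʳ t) ⟩
      el i + 0#  ≈⟨ +-identityʳ _ ⟩
      el i  ∎)) (ix-el i))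
    (λ i → ≡.trans (ix-cong (begin
      el (ix (el i - t)) + t  ≈⟨ +-congʳ (el-ix _) ⟩
      el i - t + t  ≈⟨ +-assoc _ _ _ ⟩
      el i + (- t + t)  ≈⟨ +-congˡ (-‿inverseˡ t) ⟩
      el i + 0#  ≈⟨ +-identityʳ _ ⟩
      el i  ∎)) (ix-el i))
    where open SetoidReasoning setoid

  -- Multiplication by x permutes the non-zero elements, so their product is
  -- unchanged when multiplied by x^(Q − 1).
  fermat : ∀ x → ¬ x ≈ 0# → x ^ (Q ∸ 1) ≈ 1#
  fermat x x≉0 = *-cancelˡ-nonzero Π≉0 (begin
    ∏ h * x ^ (Q ∸ 1)  ≈⟨ *-congˡ g≈ ⟨
    ∏ h * ∏ g  ≈⟨ ∏-distrib-* h g ⟨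
    ∏ (λ i → h i * g i)  ≈⟨ ∏-cong h*g ⟩
    ∏ (λ i → h (π ⟨$⟩ʳ i))  ≈⟨ ∏-permute h π ⟨
    ∏ h  ≈⟨ *-identityʳ _ ⟨
    ∏ h * 1#  ∎)
    where
    open SetoidReasoning setoid
    *-cancelˡ-nonzero : ∀ {x y z} → ¬ x ≈ 0# → x * y ≈ x * z → y ≈ z
    *-cancelˡ-nonzero {x} {y} {z} x≉0 eq with x⁻¹ , xx⁻¹≈1 ← invertible x x≉0 = begin
      y  ≈⟨ lemma y ⟨
      x⁻¹ * (x * y)  ≈⟨ *-congˡ eq ⟩
      x⁻¹ * (x * z)  ≈⟨ lemma z ⟩
      z  ∎
      where
      lemma : ∀ y → x⁻¹ * (x * y) ≈ y
      lemma y = trans (sym (*-assoc _ _ _)) (trans (*-congʳ (trans (*-comm _ _) xx⁻¹≈1)) (*-identityˡ y))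
    π = scale x (proj₁ (invertible x x≉0)) (proj₂ (invertible x x≉0))
    nonzeroPart : ∀ {y} → Dec (y ≈ 0#) → Carrier → Carrier
    nonzeroPart (yes _) _ = 1#
    nonzeroPart (no _)  y = y
    h g : Fin Q → Carrier
    h i = nonzeroPart (el i ≟ 0#) (el i)
    g i = nonzeroPart (el i ≟ 0#) x
    h≉0 : ∀ i → ¬ h i ≈ 0#
    h≉0 i with el i ≟ 0#
    ... | yes _  = 1≉0
    ... | no y≉0 = y≉0
    ∏≉0 : ∀ {n} (f : Fin n → Carrier) → (∀ i → ¬ f i ≈ 0#) → ¬ ∏ f ≈ 0#
    ∏≉0 {zero}  f f≉0 eq = 1≉0 (trans (sym ∏-zero) eq)
    ∏≉0 {suc n} f f≉0 eq = nonzero-* (f≉0 zero) (∏≉0 (f ∘ suc) (f≉0 ∘ suc)) (trans (sym (∏-suc f)) eq)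
    Π≉0 : ¬ ∏ h ≈ 0#
    Π≉0 = ∏≉0 h h≉0
    h*g : ∀ i → h i * g i ≈ h (π ⟨$⟩ʳ i)
    h*g i with el i ≟ 0# | el (ix (x * el i)) ≟ 0#
    ... | yes y≈0 | yes _    = *-identityˡ 1#
    ... | yes y≈0 | no xy≉0  = contradiction (trans (el-ix _) (trans (*-congˡ y≈0) (zeroʳ x))) xy≉0
    ... | no y≉0  | yes xy≈0 = contradiction (trans (sym (el-ix _)) xy≈0) (nonzero-* x≉0 y≉0)
    ... | no y≉0  | no _     = trans (*-comm _ x) (sym (el-ix _))
    single-1 : ∀ {n} (f : Fin n → Carrier) i → f i ≈ 1# → (∀ j → j ≢ i → f j ≈ x) → ∏ f ≈ x ^ (n ∸ 1)
    single-1 {suc n} f zero    fi fj = trans (∏-suc f)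
      (trans (*-cong fi (trans (∏-cong λ j → fj (suc j) λ ()) (∏-replicate n x))) (*-identityˡ _))
    single-1 {suc (suc n)} f (suc i) fi fj = trans (∏-suc f)
      (*-cong (fj zero λ ()) (single-1 (f ∘ suc) i fi λ j j≢i → fj (suc j) (j≢i ∘ Fin.suc-injective)))
    g≈ : ∏ g ≈ x ^ (Q ∸ 1)
    g≈ = single-1 g (ix 0#) at-0 away
      where
      at-0 : g (ix 0#) ≈ 1#
      at-0 with el (ix 0#) ≟ 0#
      ... | yes _  = refl
      ... | no ≉0 = contradiction (el-ix 0#) ≉0
      away : ∀ j → j ≢ ix 0# → g j ≈ x
      away j j≢ with el j ≟ 0#
      ... | yes ≈0 = contradiction (≡.trans (≡.sym (ix-el j)) (ix-cong ≈0)) j≢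
      ... | no _   = refl

  x^Q≈x : ∀ x → x ^ Q ≈ x
  x^Q≈x x = trans (reflexive (≡.cong (x ^_) (≡.sym (ℕ.m+[n∸m]≡n (ℕ.<⇒≤ 1<Q))))) (step (x ≟ 0#))
    where
    step : Dec (x ≈ 0#) → x * x ^ (Q ∸ 1) ≈ x
    step (yes x≈0) = trans (*-congʳ x≈0) (trans (zeroˡ _) (sym x≈0))
    step (no x≉0)  = trans (*-congˡ (fermat x x≉0)) (*-identityʳ x)

-- Divisibility by powers of p in ℤₚ[ξ]

module _ {p} (p-prime : Prime p) where
  open import Data.Integer.Base using (+_)
  open CommutativeRing (ℤₚ-commutativeRing p) using (_≈_; 0#; 1#)
  open RingOps (ℤₚ-commutativeRing p) using (_·_)

  -- Level 2 of the inverse limit suffices: there p = 0 would say that p² divides p.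
  ℤₚ-char : ¬ p · 1# ≈ 0#
  ℤₚ-char eq = contradiction (ℕ∣.∣⇒≤ p²∣p) (ℕ.<⇒≱ (ℕ.m<m*n p (p ℕ.* 1) (≡.subst (1 <_) (≡.sym (ℕ.*-identityʳ p)) 1<p)))
    where
    instance
      p≢0 : NonZero p
      p≢0 = prime⇒nonZero p-prime
    1<p : 1 < p
    1<p = ℕ.nonTrivial⇒n>1 p {{prime⇒nonTrivial p-prime}}
    residue-· : ∀ n → residue (n · 1#) 2 ≡ + n
    residue-· zero    = ≡.refl
    residue-· (suc n) = ≡.cong (λ i → ℤ.1ℤ ℤ.+ i) (residue-· n)
    p²∣p : p ℕ.^ 2 ℕ∣.∣ p
    p²∣p = ℤ∣.∣⇒∣ᵤ (≡.subst (+ (p ℕ.^ 2) ℤ∣.∣_) (≡.trans (ℤ.+-identityʳ _) (residue-· p)) (eq 2))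

module Reduction {c₁ ℓ₁ c₂ ℓ₂ p f Q} (p-prime : Prime p) (Q≡p^f : Q ≡ p ℕ.^ f)
  (L : FiniteField c₁ ℓ₁ Q) (R : ℤₚ[ξ (Q ∸ 1) ] p c₂ ℓ₂)
  (ρ : ℤₚ[ξ_].Carrier R → FiniteField.Carrier L) (isReduction : IsReduction R L ρ) where

  module L where
    open FiniteField L hiding (∑; ∏; zero) public
    open Sums (FiniteField.commutativeRing L) public
    open FieldProperties L public
    open SetoidReasoning (FiniteField.setoid L) public
  open ℤₚ[ξ_] R hiding (zero; ∑; ∏)
  open Sums commutativeRing public
  open Solver using (solve; con; _:+_; _:*_; _:=_)
  open SetoidReasoning setoid

  N : ℕ
  N = Q ∸ 1

  instance
    p≢0 : NonZero p
    p≢0 = prime⇒nonZero p-prime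
    Q≢0 : NonZero Q
    Q≢0 = ℕ.>-nonZero (ℕ.<-trans z<s L.1<Q)
    N≢0 : NonZero N
    N≢0 = ℕ.>-nonZero (ℕ.m<n⇒0<n∸m L.1<Q)

  Q≡1+N : Q ≡ suc N
  Q≡1+N = ≡.sym (ℕ.suc-pred Q)

  private module I = IsReduction isReduction

  open RingMorphisms.IsRingHomomorphism I.isHomomorphism public
    renaming (⟦⟧-cong to ρ-cong; +-homo to ρ-+; *-homo to ρ-*; 0#-homo to ρ-0; 1#-homo to ρ-1; -‿homo to ρ-neg)
    using ()

  ρ-^ : ∀ x n → ρ (x ^ n) L.≈ ρ x L.^ n
  ρ-^ x zero    = ρ-1
  ρ-^ x (suc n) = L.trans (ρ-* x (x ^ n)) (L.*-congˡ (ρ-^ x n))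

  ρ-· : ∀ n → ρ (n · 1#) L.≈ n L.· L.1#
  ρ-· zero    = ρ-0
  ρ-· (suc n) = L.trans (ρ-+ 1# (n · 1#)) (L.+-cong ρ-1 (ρ-· n))

  ρ-∑ : ∀ {n} (f : Fin n → Carrier) → ρ (∑ f) L.≈ L.∑ (λ i → ρ (f i))
  ρ-∑ {zero}  f = L.trans (ρ-cong ∑-zero) (L.trans ρ-0 (L.sym L.∑-zero))
  ρ-∑ {suc n} f = L.trans (ρ-cong (∑-suc f)) (L.trans (ρ-+ _ _) (L.trans (L.+-congˡ (ρ-∑ (f ∘ suc))) (L.sym (L.∑-suc _))))

  P : Carrier
  P = p · 1#

  P≉0 : ¬ P ≈ 0#
  P≉0 P≈0 = ℤₚ-char p-prime (injective (trans (embed-· p) (trans P≈0 (sym 0#-homo))))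
    where
    open RingMorphisms.IsRingMonomorphism isEmbedding
    open CommutativeRing (ℤₚ-commutativeRing p) using () renaming (1# to 1ₚ)
    embed-· : ∀ n → embed (RingOps._·_ (ℤₚ-commutativeRing p) n 1ₚ) ≈ n · 1#
    embed-· zero    = 0#-homo
    embed-· (suc n) = trans (+-homo _ _) (+-cong 1#-homo (embed-· n))

  *-cancelˡ : ∀ {x y z} → ¬ x ≈ 0# → x * y ≈ x * z → y ≈ z
  *-cancelˡ {x} {y} {z} x≉0 eq = +-cancelʳ (- z) y z (trans (noZeroDivisors x (y - z) x≉0 (begin
    x * (y - z)  ≈⟨ x[y-z]≈xy-xz x y z ⟩
    x * y - x * z  ≈⟨ +-congʳ eq ⟩
    x * z - x * z  ≈⟨ -‿inverseʳ _ ⟩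
    0#  ∎)) (sym (-‿inverseʳ z)))

  P^≉0 : ∀ n → ¬ P ^ n ≈ 0#
  P^≉0 zero    1≈0 = L.1≉0 (L.trans (L.sym ρ-1) (L.trans (ρ-cong 1≈0) ρ-0))
  P^≉0 (suc n) eq  = P^≉0 n (noZeroDivisors P (P ^ n) P≉0 eq)

  infix 4 p^_∣_
  -- The exponent is a parameter of the record, so that unification can recover it; it could not in
  -- general be read off from `P ^ n`.
  record p^_∣_ (n : ℕ) (x : Carrier) : Set (c₂ ⊔ ℓ₂) where
    constructor _,_
    field
      quotient : Carrier
      equality : x ≈ P ^ n * quotient
  open p^_∣_

  ∣-cong : ∀ {n x y} → x ≈ y → p^ n ∣ x → p^ n ∣ y
  ∣-cong x≈y (z , eq) = z , trans (sym x≈y) eq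

  ∣-0 : ∀ {n x} → x ≈ 0# → p^ n ∣ x
  ∣-0 x≈0 = 0# , trans x≈0 (sym (zeroʳ _))

  ∣-+ : ∀ {n x y} → p^ n ∣ x → p^ n ∣ y → p^ n ∣ x + y
  ∣-+ (a , x≈) (b , y≈) = a + b , trans (+-cong x≈ y≈) (sym (distribˡ _ a b))

  ∣-*ˡ : ∀ {n x} y → p^ n ∣ x → p^ n ∣ y * x
  ∣-*ˡ {n} y (a , x≈) = y * a , (begin
    y * _  ≈⟨ *-congˡ x≈ ⟩
    y * (P ^ n * a)  ≈⟨ solve 3 (λ y q a → y :* (q :* a) := q :* (y :* a)) refl y (P ^ n) a ⟩
    P ^ n * (y * a)  ∎)

  ∣-*ʳ : ∀ {n x} y → p^ n ∣ x → p^ n ∣ x * y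
  ∣-*ʳ y d = ∣-cong (*-comm y _) (∣-*ˡ y d)

  ∣-neg : ∀ {n x} → p^ n ∣ x → p^ n ∣ - x
  ∣-neg (a , x≈) = - a , trans (-‿cong x≈) (-‿distribʳ-* _ a)

  ∣-∑ : ∀ {n l} {f : Fin l → Carrier} → (∀ i → p^ n ∣ f i) → p^ n ∣ ∑ f
  ∣-∑ {f = f} d = ∑ (λ i → quotient (d i)) , trans (∑-cong λ i → equality (d i)) (sym (*-distribˡ-∑ _ _))

  ∣-∑ᵛ : ∀ {n} k {l} {f : Vec (Fin l) k → Carrier} → (∀ v → p^ n ∣ f v) → p^ n ∣ ∑ᵛ k f
  ∣-∑ᵛ zero    d = d []
  ∣-∑ᵛ (suc k) d = ∣-∑ λ a → ∣-∑ᵛ k λ v → d (a ∷ v)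

  ∣-P^ : ∀ n x → p^ n ∣ P ^ n * x
  ∣-P^ n x = x , refl

  ∣-* : ∀ {m n x y} → p^ m ∣ x → p^ n ∣ y → p^ m ℕ.+ n ∣ x * y
  ∣-* {m} {n} {x} {y} (a , x≈) (b , y≈) = a * b , (begin
    x * y  ≈⟨ *-cong x≈ y≈ ⟩
    P ^ m * a * (P ^ n * b)  ≈⟨ solve 4 (λ q a r b → q :* a :* (r :* b) := q :* r :* (a :* b)) refl (P ^ m) a (P ^ n) b ⟩
    P ^ m * P ^ n * (a * b)  ≈⟨ *-congʳ (^-homo-* P m n) ⟨
    P ^ (m ℕ.+ n) * (a * b)  ∎)

  ∣-≤ : ∀ {m n x} → m ≤ n → p^ n ∣ x → p^ m ∣ x
  ∣-≤ {m} {n} {x} m≤n (a , x≈) = P ^ (n ∸ m) * a , (begin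
    x  ≈⟨ x≈ ⟩
    P ^ n * a  ≈⟨ *-congʳ (^-congʳ P (≡.sym (ℕ.m+[n∸m]≡n m≤n))) ⟩
    P ^ (m ℕ.+ (n ∸ m)) * a  ≈⟨ *-congʳ (^-homo-* P m (n ∸ m)) ⟩
    P ^ m * P ^ (n ∸ m) * a  ≈⟨ *-assoc _ _ _ ⟩
    P ^ m * (P ^ (n ∸ m) * a)  ∎)

  ∣-cancel : ∀ m {n x} → p^ m ℕ.+ n ∣ P ^ m * x → p^ n ∣ x
  ∣-cancel m {n} {x} (a , eq) = a , *-cancelˡ (P^≉0 m) (begin
    P ^ m * x  ≈⟨ eq ⟩
    P ^ (m ℕ.+ n) * a  ≈⟨ *-congʳ (^-homo-* P m n) ⟩
    P ^ m * P ^ n * a  ≈⟨ *-assoc _ _ _ ⟩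
    P ^ m * (P ^ n * a)  ∎)

  ρ≈0⇒p∣ : ∀ x → ρ x L.≈ L.0# → ∃[ y ] x ≈ P * y
  ρ≈0⇒p∣ x eq with Equivalence.to (I.kernel x) eq
  ... | record { quotient = y ; equality = yP≈x } = y , trans (sym yP≈x) (*-comm y P)

  ρP≈0 : ρ P L.≈ L.0#
  ρP≈0 = Equivalence.from (I.kernel P) (record { quotient = 1# ; equality = *-identityˡ P })

  p∣⇒ρ≈0 : ∀ x y → x ≈ P * y → ρ x L.≈ L.0#
  p∣⇒ρ≈0 x y eq = L.trans (ρ-cong eq) (L.trans (ρ-* P y) (L.trans (L.*-congʳ ρP≈0) (L.zeroˡ _)))

  L-char : p L.· L.1# L.≈ L.0#
  L-char = L.trans (L.sym (ρ-· p)) ρP≈0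

  -- Divisibility by `P` is vanishing of the reduction, which is decidable in `L`; after cancelling
  -- one `P` the question recurs for the quotient.
  p^_∣?_ : ∀ n x → Dec (p^ n ∣ x)
  p^ zero  ∣? x = yes (x , sym (*-identityˡ x))
  p^ suc n ∣? x with ρ x L.≟ L.0#
  ... | no ρx≉0 = no λ (y , eq) → ρx≉0 (p∣⇒ρ≈0 x (P ^ n * y) (trans eq (*-assoc _ _ _)))
  ... | yes ρx≈0 with y , x≈Py ← ρ≈0⇒p∣ x ρx≈0 =
    map′ (λ (z , eq) → z , trans x≈Py (trans (*-congˡ eq) (sym (*-assoc _ _ _))))
         (λ (z , eq) → z , *-cancelˡ P≉0 (trans (sym x≈Py) (trans eq (*-assoc _ _ _))))
         (p^ n ∣? y)

  -- A nonzero reduction instead of an inverse: this is all that divisibility by powers of `P` can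
  -- detect, and it is stable under products and passes to factors.
  Unit : Carrier → Set _
  Unit x = ¬ ρ x L.≈ L.0#

  unit-* : ∀ {x y} → Unit x → Unit y → Unit (x * y)
  unit-* {x} {y} ux uy eq = L.nonzero-* ux uy (L.trans (L.sym (ρ-* x y)) eq)

  unit-cong : ∀ {x y} → x ≈ y → Unit x → Unit y
  unit-cong x≈y ux eq = ux (L.trans (ρ-cong x≈y) eq)

  unit-1 : Unit 1#
  unit-1 eq = L.1≉0 (L.trans (L.sym ρ-1) eq)

  unit-^ : ∀ {x} n → Unit x → Unit (x ^ n)
  unit-^ zero    ux = unit-1
  unit-^ (suc n) ux = unit-* ux (unit-^ n ux)

  unit-∏ : ∀ {n} (f : Fin n → Carrier) → (∀ i → Unit (f i)) → Unit (∏ f)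
  unit-∏ {zero}  f u = unit-cong (sym ∏-zero) unit-1
  unit-∏ {suc n} f u = unit-cong (sym (∏-suc f)) (unit-* (u zero) (unit-∏ (f ∘ suc) (u ∘ suc)))

  unit-factorˡ : ∀ {x y} → Unit (x * y) → Unit x
  unit-factorˡ {x} {y} u eq = u (L.trans (ρ-* x y) (L.trans (L.*-congʳ eq) (L.zeroˡ _)))

  unit≉0 : ∀ {x} → Unit x → ¬ x ≈ 0#
  unit≉0 ux x≈0 = ux (L.trans (ρ-cong x≈0) ρ-0)

  -- The residue field is a domain, so the factors `P` of the product come off `x` one at a time.
  ∣-unit : ∀ n {u x} → Unit u → p^ n ∣ u * x → p^ n ∣ x
  ∣-unit zero    {u} {x} _  _ = x , sym (*-identityˡ x)
  ∣-unit (suc n) {u} {x} uu (y , eq)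
    with z , x≈Pz ← ρ≈0⇒p∣ x (L.domain uu (L.trans (L.sym (ρ-* u x)) (p∣⇒ρ≈0 (u * x) (P ^ n * y) (trans eq (*-assoc _ _ _)))))
    with w , z≈ ← ∣-unit n {u} {z} uu (y , *-cancelˡ P≉0 (begin
      P * (u * z)  ≈⟨ solve 3 (λ p u z → p :* (u :* z) := u :* (p :* z)) refl P u z ⟩
      u * (P * z)  ≈⟨ *-congˡ x≈Pz ⟨
      u * x  ≈⟨ eq ⟩
      P * P ^ n * y  ≈⟨ *-assoc _ _ _ ⟩
      P * (P ^ n * y)  ∎))
    = w , (begin
      x  ≈⟨ x≈Pz ⟩
      P * z  ≈⟨ *-congˡ z≈ ⟩
      P * (P ^ n * w)  ≈⟨ *-assoc _ _ _ ⟨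
      P * P ^ n * w  ∎)

  Q≈ : Q · 1# ≈ P ^ f
  Q≈ = trans (×-congˡ Q≡p^f) (×1-homo-^ p f)

  f>0 : 0 < f
  f>0 = positive f Q≡p^f
    where
    positive : ∀ f → Q ≡ p ℕ.^ f → 0 < f
    positive (suc _) _    = s≤s z≤n
    positive zero    Q≡1 = contradiction (≡.subst (1 <_) Q≡1 L.1<Q) (ℕ.<-irrefl ≡.refl)

  -- The number of nonzero elements of `L`, hence the normalising factor of the orthogonality
  -- relations below. It is congruent to -1 modulo p, and it is carried along rather than inverted.
  η : Carrier
  η = N · 1#

  1+η : Q · 1# ≈ 1# + η
  1+η = ×-congˡ Q≡1+N

  ρP^≈0 : ∀ {n} → 0 < n → ρ (P ^ n) L.≈ L.0#
  ρP^≈0 {suc n} _ = p∣⇒ρ≈0 _ (P ^ n) refl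

  unit-pred : ∀ {x n} → x + 1# ≈ P ^ n → 0 < n → Unit x
  unit-pred {x} {n} eq 0<n ρx≈0 = L.1≉0 (L.begin
    L.1#  L.≈⟨ L.+-identityˡ _ ⟨
    L.0# L.+ L.1#  L.≈⟨ L.+-cong ρx≈0 ρ-1 ⟨
    ρ x L.+ ρ 1#  L.≈⟨ ρ-+ x 1# ⟨
    ρ (x + 1#)  L.≈⟨ ρ-cong eq ⟩
    ρ (P ^ n)  L.≈⟨ ρP^≈0 0<n ⟩
    L.0#  L.∎)

  unit-η : Unit η
  unit-η = unit-pred (trans (+-comm _ _) (trans (sym 1+η) Q≈)) f>0

  -- Brings divisibility back from the ring to the integers. In `L`, where p = 0, a Bézout relation
  -- between p and n mod p shows that an n prime to p stays nonzero; so p divides n and can be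
  -- cancelled.
  p^∣·1⇒p^∣ : ∀ t n → p^ t ∣ n · 1# → p ℕ.^ t ℕ∣.∣ n
  p^∣·1⇒p^∣ zero    n _ = ℕ∣.1∣ n
  p^∣·1⇒p^∣ (suc t) n (y , eq) with n ℕ.% p ℕ.≟ 0
  ... | yes n%p≡0 = ≡.subst (p ℕ.* p ℕ.^ t ℕ∣.∣_) (≡.sym n≡) (ℕ∣.*-monoʳ-∣ p (p^∣·1⇒p^∣ t (n ℕ./ p)
                      (y , *-cancelˡ P≉0 (trans (sym (×1-homo-* p (n ℕ./ p))) (trans (×-congˡ (≡.sym n≡)) (trans eq (*-assoc _ _ _)))))))
    where
    n≡ : n ≡ p ℕ.* (n ℕ./ p)
    n≡ = ≡.trans (ℕ.m≡m%n+[m/n]*n n p) (≡.trans (≡.cong (ℕ._+ n ℕ./ p ℕ.* p) n%p≡0) (ℕ.*-comm (n ℕ./ p) p))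
  ... | no n%p≢0 = contradiction (L.trans (L.sym (ρ-· n)) (p∣⇒ρ≈0 (n · 1#) (P ^ t * y) (trans eq (*-assoc _ _ _)))) (char-coprime n n%p≢0)
    where
    multiple≈0 : ∀ m → (m ℕ.* p) L.· L.1# L.≈ L.0#
    multiple≈0 m = L.trans (L.×1-homo-* m p) (L.trans (L.*-congˡ L-char) (L.zeroʳ _))
    remainder : ∀ n → n L.· L.1# L.≈ (n ℕ.% p) L.· L.1#
    remainder n = L.trans (L.×-congˡ (ℕ.m≡m%n+[m/n]*n n p)) (L.trans (L.×-homo-+ L.1# (n ℕ.% p) _)
      (L.trans (L.+-congˡ (multiple≈0 (n ℕ./ p))) (L.+-identityʳ _)))
    impossible : ∀ x y → 1 ℕ.+ x ≡ y → x L.· L.1# L.≈ L.0# → ¬ y L.· L.1# L.≈ L.0#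
    impossible x y eq x≈0 y≈0 = L.1≉0 (L.trans (L.sym (L.+-identityʳ _)) (L.trans (L.+-congˡ (L.sym x≈0)) (L.trans (L.reflexive (≡.cong (L._· L.1#) eq)) y≈0)))
    multipleʳ≈0 : ∀ m d → d L.· L.1# L.≈ L.0# → (m ℕ.* d) L.· L.1# L.≈ L.0#
    multipleʳ≈0 m d d≈0 = L.trans (L.×1-homo-* m d) (L.trans (L.*-congˡ d≈0) (L.zeroʳ _))
    char-coprime : ∀ n → n ℕ.% p ≢ 0 → ¬ n L.· L.1# L.≈ L.0#
    char-coprime n d≢0 n≈0 with coprime-Bézout (prime⇒coprime p-prime {{ℕ.≢-nonZero d≢0}} (ℕ.m%n<n n p))
    ... | Bézout.Identity.+- x y eq = impossible (y ℕ.* (n ℕ.% p)) (x ℕ.* p) eq (multipleʳ≈0 y _ d≈0) (multiple≈0 x)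
      where d≈0 = L.trans (L.sym (remainder n)) n≈0
    ... | Bézout.Identity.-+ x y eq = impossible (x ℕ.* p) (y ℕ.* (n ℕ.% p)) eq (multiple≈0 x) (multipleʳ≈0 y _ d≈0)
      where d≈0 = L.trans (L.sym (remainder n)) n≈0

-- Teichmüller monomials in one variable and their dual functionals

module Teichmüller {c₁ ℓ₁ c₂ ℓ₂ p f Q} (p-prime : Prime p) (Q≡p^f : Q ≡ p ℕ.^ f)
  (L : FiniteField c₁ ℓ₁ Q) (R : ℤₚ[ξ (Q ∸ 1) ] p c₂ ℓ₂)
  (ρ : ℤₚ[ξ_].Carrier R → FiniteField.Carrier L) (isReduction : IsReduction R L ρ)
  (T : FiniteField.Carrier L → ℤₚ[ξ_].Carrier R) (isTeichmüller : IsTeichmüller R L ρ T) where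

  open Reduction {f = f} p-prime Q≡p^f L R ρ isReduction public
  open ℤₚ[ξ_] R hiding (zero; ∑; ∏)
  open Solver using (solve; con; _:+_; _:*_; _:=_)
  open SetoidReasoning setoid
  open IsTeichmüller isTeichmüller public using () renaming (cong to T-cong; T0≈0 to T-0; rootOfUnity to T^N≈1; T∘ρ to T-ρ)

  0<N : 0 < N
  0<N = ℕ.>-nonZero⁻¹ N

  T≈0 : ∀ {x} → x L.≈ L.0# → T x ≈ 0#
  T≈0 x≈0 = trans (T-cong x≈0) T-0

  ρT : ∀ x → ρ (T x) L.≈ x
  ρT x with x L.≟ L.0#
  ... | yes x≈0 = L.trans (ρ-cong (T≈0 x≈0)) (L.trans ρ-0 (L.sym x≈0))
  ... | no x≉0  = IsTeichmüller.ρ∘T isTeichmüller x x≉0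

  T-injective : ∀ {x y} → T x ≈ T y → x L.≈ y
  T-injective {x} {y} eq = L.trans (L.sym (ρT x)) (L.trans (ρ-cong eq) (ρT y))

  -- For nonzero arguments both sides are roots of unity with the same reduction, and `T` inverts
  -- reduction on roots of unity.
  T-* : ∀ x y → T (x L.* y) ≈ T x * T y
  T-* x y with x L.≟ L.0# | y L.≟ L.0#
  ... | yes x≈0 | _       = trans (T≈0 (L.trans (L.*-congʳ x≈0) (L.zeroˡ y))) (sym (trans (*-congʳ (T≈0 x≈0)) (zeroˡ _)))
  ... | no _    | yes y≈0 = trans (T≈0 (L.trans (L.*-congˡ y≈0) (L.zeroʳ x))) (sym (trans (*-congˡ (T≈0 y≈0)) (zeroʳ _)))
  ... | no x≉0  | no y≉0  = begin
    T (x L.* y)  ≈⟨ T-cong (L.trans (ρ-* _ _) (L.*-cong (ρT x) (ρT y))) ⟨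
    T (ρ (T x * T y))  ≈⟨ T-ρ _ (trans (^-distrib-* (T x) (T y) N) (trans (*-cong (T^N≈1 x x≉0) (T^N≈1 y y≉0)) (*-identityˡ 1#))) ⟩
    T x * T y  ∎

  T-1 : T L.1# ≈ 1#
  T-1 = trans (T-cong (L.sym ρ-1)) (T-ρ 1# (1^ N))

  T-^ : ∀ x n → T (x L.^ n) ≈ T x ^ n
  T-^ x zero    = T-1
  T-^ x (suc n) = trans (T-* x (x L.^ n)) (*-congˡ (T-^ x n))

  -- Since T(0)^0 = 1, the exponents 0 and `N` give different functions, and this indicator of zero
  -- is their difference. It causes the special treatment of both exponents below.
  z : L.Carrier → Carrier
  z x = if (x L.≟ L.0#)

  z-0 : ∀ {x} → x L.≈ L.0# → z x ≈ 1#
  z-0 {x} = if-yes (x L.≟ L.0#)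

  z-≉0 : ∀ {x} → ¬ x L.≈ L.0# → z x ≈ 0#
  z-≉0 {x} = if-no (x L.≟ L.0#)

  T^-0 : ∀ {x n} → 0 < n → x L.≈ L.0# → T x ^ n ≈ 0#
  T^-0 {x} {n} 0<n x≈0 = trans (^-congˡ n (T≈0 x≈0)) (0^ 0<n)

  T^N+z : ∀ x → T x ^ N + z x ≈ 1#
  T^N+z x with x L.≟ L.0#
  ... | yes x≈0 = trans (+-congʳ (T^-0 0<N x≈0)) (+-identityˡ 1#)
  ... | no x≉0  = trans (+-congʳ (T^N≈1 x x≉0)) (+-identityʳ 1#)

  T-periodic : ∀ x i → 0 < i → T x ^ (i ℕ.+ N) ≈ T x ^ i
  T-periodic x i 0<i with x L.≟ L.0#
  ... | yes x≈0 = trans (T^-0 (ℕ.≤-trans 0<i (ℕ.m≤m+n i N)) x≈0) (sym (T^-0 0<i x≈0))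
  ... | no x≉0  = trans (^-homo-* (T x) i N) (trans (*-congˡ (T^N≈1 x x≉0)) (*-identityʳ _))

  T-periodic-* : ∀ x i c → 0 < i → T x ^ (i ℕ.+ c ℕ.* N) ≈ T x ^ i
  T-periodic-* x i zero    0<i = ^-congʳ (T x) (ℕ.+-identityʳ i)
  T-periodic-* x i (suc c) 0<i = begin
    T x ^ (i ℕ.+ (N ℕ.+ c ℕ.* N))  ≈⟨ ^-congʳ (T x) (≡.cong (i ℕ.+_) (ℕ.+-comm N (c ℕ.* N))) ⟩
    T x ^ (i ℕ.+ (c ℕ.* N ℕ.+ N))  ≈⟨ ^-congʳ (T x) (ℕ.+-assoc i (c ℕ.* N) N) ⟨
    T x ^ (i ℕ.+ c ℕ.* N ℕ.+ N)  ≈⟨ T-periodic x (i ℕ.+ c ℕ.* N) (ℕ.≤-trans 0<i (ℕ.m≤m+n i _)) ⟩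
    T x ^ (i ℕ.+ c ℕ.* N)  ≈⟨ T-periodic-* x i c 0<i ⟩
    T x ^ i  ∎

  ∑-z : (g : L.Carrier → Carrier) → (∀ {x y} → x L.≈ y → g x ≈ g y) →
        ∑ (λ a → z (L.el a) * g (L.el a)) ≈ g L.0#
  ∑-z g g-cong = trans (∑-single _ (L.ix L.0#) away)
    (trans (*-cong (z-0 (L.el-ix L.0#)) (g-cong (L.el-ix L.0#))) (*-identityˡ _))
    where
    away : ∀ j → j ≢ L.ix L.0# → z (L.el j) * g (L.el j) ≈ 0#
    away j j≢ = trans (*-congʳ (z-≉0 λ eq → j≢ (≡.trans (≡.sym (L.ix-el j)) (L.ix-cong eq)))) (zeroˡ _)

  g : L.Carrier
  g = ρ ξ

  ρξ^ : ∀ n → T (g L.^ n) ≈ ξ ^ n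
  ρξ^ n = trans (T-^ g n) (^-congˡ n (T-ρ ξ ξ^N≈1))

  g^N≈1 : g L.* (g L.^ ℕ.pred N) L.≈ L.1#
  g^N≈1 = L.trans (L.reflexive (≡.cong (g L.^_) (ℕ.suc-pred N))) (L.trans (L.sym (ρ-^ ξ N)) (L.trans (ρ-cong ξ^N≈1) ρ-1))

  -- The ring is a domain and ξ^i is not 1. Typical use: a substitution preserves a sum and also
  -- multiplies it by ξ^i.
  ξ-fixed⇒0 : ∀ i x → 0 < i → i < N → ξ ^ i * x ≈ x → x ≈ 0#
  ξ-fixed⇒0 i x 0<i i<N eq = noZeroDivisors (ξ ^ i - 1#) x
    (λ eq′ → ξ-primitive i 0<i i<N (+-cancelʳ (- 1#) _ _ (trans eq′ (sym (-‿inverseʳ 1#)))))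
    (begin
      (ξ ^ i - 1#) * x  ≈⟨ [y-z]x≈yx-zx x (ξ ^ i) 1# ⟩
      ξ ^ i * x - 1# * x  ≈⟨ +-cong eq (-‿cong (*-identityˡ x)) ⟩
      x - x  ≈⟨ -‿inverseʳ x ⟩
      0#  ∎)

  σ : ℕ → Carrier
  σ i = ∑ λ a → T (L.el a) ^ i

  -- The substitution x ↦ g x permutes `L` and multiplies the sum by ξ^i.
  σ-mid : ∀ i → 0 < i → i < N → σ i ≈ 0#
  σ-mid i 0<i i<N = ξ-fixed⇒0 i (σ i) 0<i i<N (begin
    ξ ^ i * σ i  ≈⟨ *-distribˡ-∑ _ _ ⟩
    ∑ (λ a → ξ ^ i * T (L.el a) ^ i)  ≈⟨ ∑-cong step ⟨
    ∑ (λ a → T (L.el (π ⟨$⟩ʳ a)) ^ i)  ≈⟨ ∑-permute (λ a → T (L.el a) ^ i) π ⟨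
    σ i  ∎)
    where
    π = L.scale g _ g^N≈1
    step : ∀ a → T (L.el (π ⟨$⟩ʳ a)) ^ i ≈ ξ ^ i * T (L.el a) ^ i
    step a = trans (^-congˡ i (trans (T-cong (L.el-ix _)) (trans (T-* g (L.el a)) (*-congʳ (T-ρ ξ ξ^N≈1)))))
                   (^-distrib-* ξ _ i)

  σ-N : σ N ≈ η
  σ-N = +-cancelʳ 1# _ _ (begin
    σ N + 1#  ≈⟨ +-congˡ (∑-z (λ _ → 1#) (λ _ → refl)) ⟨
    σ N + ∑ (λ a → z (L.el a) * 1#)  ≈⟨ ∑-distrib-+ _ _ ⟨
    ∑ (λ a → T (L.el a) ^ N + z (L.el a) * 1#)  ≈⟨ ∑-cong (λ a → trans (+-congˡ (*-identityʳ _)) (T^N+z (L.el a))) ⟩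
    ∑ {Q} (λ _ → 1#)  ≈⟨ ∑-replicate Q 1# ⟩
    Q · 1#  ≈⟨ 1+η ⟩
    1# + η  ≈⟨ +-comm 1# η ⟩
    η + 1#  ∎)

  σ-periodic : ∀ i → 0 < i → σ (i ℕ.+ N) ≈ σ i
  σ-periodic i 0<i = ∑-cong λ a → T-periodic (L.el a) i 0<i

  data View : ℕ → Set where
    first  : View 0
    middle : ∀ r → 0 < r → r < N → View r
    last   : View N

  view : ∀ r → r ≤ N → View r
  view zero    _   = first
  view (suc r) r≤N with ℕ.m≤n⇒m<n∨m≡n r≤N
  ... | inj₁ r<N  = middle (suc r) z<s r<N
  ... | inj₂ eq = ≡.subst View (≡.sym eq) last

  toℕ≤N : ∀ (r : Fin Q) → toℕ r ≤ N
  toℕ≤N r = ℕ.s≤s⁻¹ (≡.subst (toℕ r <_) Q≡1+N (Fin.toℕ<n r))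

  -- Up to the factor η, the basis of linear functionals on functions on L that
  -- is dual to the functions x ↦ T x ^ r, 0 ≤ r ≤ N.
  w : ℕ → L.Carrier → Carrier
  w r x with r ℕ.≟ 0 | r ℕ.≟ N
  ... | yes _ | _     = η * z x
  ... | no _  | yes _ = T x ^ N + - (η * z x)
  ... | no _  | no _  = T x ^ (N ∸ r)

  w-last : ∀ x → w N x ≈ T x ^ N + - (η * z x)
  w-last x with N ℕ.≟ 0 | N ℕ.≟ N
  ... | yes N≡0 | _     = contradiction N≡0 (ℕ.>⇒≢ 0<N)
  ... | no _    | yes _ = refl
  ... | no _    | no ≢  = contradiction ≡.refl ≢

  w-middle : ∀ {r} x → 0 < r → r < N → w r x ≈ T x ^ (N ∸ r)
  w-middle {r} x 0<r r<N with r ℕ.≟ 0 | r ℕ.≟ N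
  ... | yes r≡0 | _       = contradiction r≡0 (ℕ.>⇒≢ 0<r)
  ... | no _    | yes r≡N = contradiction r≡N (ℕ.<⇒≢ r<N)
  ... | no _    | no _    = refl

  z-cong : ∀ {x y} → x L.≈ y → z x ≈ z y
  z-cong {x} {y} x≈y = if-cong (x L.≟ L.0#) (y L.≟ L.0#) (L.trans (L.sym x≈y)) (L.trans x≈y)

  w-cong : ∀ r {x y} → x L.≈ y → w r x ≈ w r y
  w-cong r x≈y with r ℕ.≟ 0 | r ℕ.≟ N
  ... | yes _ | _     = *-congˡ (z-cong x≈y)
  ... | no _  | yes _ = +-cong (^-congˡ N (T-cong x≈y)) (-‿cong (*-congˡ (z-cong x≈y)))
  ... | no _  | no _  = ^-congˡ (N ∸ r) (T-cong x≈y)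

  private
    ∑-ηz : ∀ s → ∑ (λ a → η * z (L.el a) * T (L.el a) ^ s) ≈ η * 0# ^ s
    ∑-ηz s = begin
      ∑ (λ a → η * z (L.el a) * T (L.el a) ^ s)  ≈⟨ ∑-cong (λ a → *-assoc _ _ _) ⟩
      ∑ (λ a → η * (z (L.el a) * T (L.el a) ^ s))  ≈⟨ *-distribˡ-∑ _ _ ⟨
      η * ∑ (λ a → z (L.el a) * T (L.el a) ^ s)  ≈⟨ *-congˡ (∑-z (λ x → T x ^ s) (λ x≈y → ^-congˡ s (T-cong x≈y))) ⟩
      η * T L.0# ^ s  ≈⟨ *-congˡ (^-congˡ s T-0) ⟩
      η * 0# ^ s  ∎

    ∑-last : ∀ s → ∑ (λ a → w N (L.el a) * T (L.el a) ^ s) ≈ σ (N ℕ.+ s) + - (η * 0# ^ s)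
    ∑-last s = begin
      ∑ (λ a → w N (L.el a) * T (L.el a) ^ s)  ≈⟨ ∑-cong (λ a → step (L.el a)) ⟩
      ∑ (λ a → T (L.el a) ^ (N ℕ.+ s) + - 1# * (η * z (L.el a) * T (L.el a) ^ s))
        ≈⟨ ∑-distrib-+ _ _ ⟩
      σ (N ℕ.+ s) + ∑ (λ a → - 1# * (η * z (L.el a) * T (L.el a) ^ s))
        ≈⟨ +-congˡ (*-distribˡ-∑ _ _) ⟨
      σ (N ℕ.+ s) + - 1# * ∑ (λ a → η * z (L.el a) * T (L.el a) ^ s)
        ≈⟨ +-congˡ (trans (*-congˡ (∑-ηz s)) (-1*x≈-x _)) ⟩
      σ (N ℕ.+ s) + - (η * 0# ^ s)  ∎
      where
      step : ∀ x → w N x * T x ^ s ≈ T x ^ (N ℕ.+ s) + - 1# * (η * z x * T x ^ s)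
      step x = begin
        w N x * T x ^ s  ≈⟨ *-congʳ (w-last x) ⟩
        (T x ^ N + - (η * z x)) * T x ^ s  ≈⟨ distribʳ _ _ _ ⟩
        T x ^ N * T x ^ s + - (η * z x) * T x ^ s  ≈⟨ +-cong (sym (^-homo-* (T x) N s)) (trans (sym (-‿distribˡ-* _ _)) (sym (-1*x≈-x _))) ⟩
        T x ^ (N ℕ.+ s) + - 1# * (η * z x * T x ^ s)  ∎

    ∑-middle : ∀ r s → 0 < r → r < N → ∑ (λ a → w r (L.el a) * T (L.el a) ^ s) ≈ σ (N ∸ r ℕ.+ s)
    ∑-middle r s 0<r r<N = ∑-cong λ a → trans (*-congʳ (w-middle (L.el a) 0<r r<N)) (sym (^-homo-* _ (N ∸ r) s))

  orthogonal-≡ : ∀ {r} → r ≤ N → ∑ (λ a → w r (L.el a) * T (L.el a) ^ r) ≈ η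
  orthogonal-≡ {r} r≤N with view r r≤N
  ... | first            = trans (∑-ηz 0) (*-identityʳ η)
  ... | middle _ 0<r r<N = trans (∑-middle r r 0<r r<N) (trans (reflexive (≡.cong σ (ℕ.m∸n+n≡m r≤N))) σ-N)
  ... | last             = begin
    ∑ (λ a → w N (L.el a) * T (L.el a) ^ N)  ≈⟨ ∑-last N ⟩
    σ (N ℕ.+ N) + - (η * 0# ^ N)  ≈⟨ +-cong (trans (σ-periodic N 0<N) σ-N) (-‿cong (trans (*-congˡ (0^ 0<N)) (zeroʳ η))) ⟩
    η + - 0#  ≈⟨ trans (+-congˡ -0#≈0#) (+-identityʳ η) ⟩
    η  ∎

  orthogonal-≢ : ∀ {r s} → r ≤ N → s ≤ N → r ≢ s → ∑ (λ a → w r (L.el a) * T (L.el a) ^ s) ≈ 0#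
  orthogonal-≢ {r} {s} r≤N s≤N r≢s with view r r≤N
  ... | first            = trans (∑-ηz s) (trans (*-congˡ (0^ (ℕ.n≢0⇒n>0 (r≢s ∘ ≡.sym)))) (zeroʳ η))
  ... | middle _ 0<r r<N = trans (∑-middle r s 0<r r<N) vanish
    where
    vanish : σ (N ∸ r ℕ.+ s) ≈ 0#
    vanish with ℕ.<-cmp s r
    ... | tri≈ _ s≡r _ = contradiction (≡.sym s≡r) r≢s
    ... | tri< s<r _ _ = σ-mid _ (ℕ.≤-trans (ℕ.m<n⇒0<n∸m r<N) (ℕ.m≤m+n (N ∸ r) s))
                           (≡.subst (N ∸ r ℕ.+ s <_) (ℕ.m∸n+n≡m r≤N) (ℕ.+-monoʳ-< (N ∸ r) s<r))
    -- The exponent N - r + s wraps around past `N`, so one period is taken off.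
    ... | tri> _ _ r<s = trans (reflexive (≡.cong σ eq)) (trans (σ-periodic (s ∸ r) (ℕ.m<n⇒0<n∸m r<s))
                           (σ-mid (s ∸ r) (ℕ.m<n⇒0<n∸m r<s) (ℕ.≤-trans (ℕ.∸-monoʳ-< 0<r (ℕ.<⇒≤ r<s)) s≤N)))
      where
      eq : N ∸ r ℕ.+ s ≡ s ∸ r ℕ.+ N
      eq = ≡.trans (ℕ.+-comm (N ∸ r) s) (≡.trans (≡.sym (ℕ.+-∸-assoc s r≤N))
        (≡.trans (≡.cong (_∸ r) (ℕ.+-comm s N)) (≡.trans (ℕ.+-∸-assoc N (ℕ.<⇒≤ r<s)) (ℕ.+-comm N (s ∸ r)))))
  ... | last = trans (∑-last s) (vanish s s≤N r≢s)
    where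
    vanish : ∀ s → s ≤ N → N ≢ s → σ (N ℕ.+ s) + - (η * 0# ^ s) ≈ 0#
    vanish zero    _   _   = trans (+-cong (trans (reflexive (≡.cong σ (ℕ.+-identityʳ N))) σ-N) (-‿cong (*-identityʳ η))) (-‿inverseʳ η)
    vanish (suc s) s≤N N≢s = trans (+-cong
      (trans (reflexive (≡.cong σ (ℕ.+-comm N (suc s)))) (trans (σ-periodic (suc s) z<s) (σ-mid (suc s) z<s (ℕ.≤∧≢⇒< s≤N (N≢s ∘ ≡.sym)))))
      (trans (-‿cong (trans (*-congˡ (zeroˡ _)) (zeroʳ η))) -0#≈0#)) (+-identityˡ 0#)

  private
    w-T-suc : ∀ {x} (i : Fin N) → ¬ x L.≈ L.0# → w (suc (toℕ i)) x ≈ T x ^ (N ∸ suc (toℕ i))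
    w-T-suc {x} i x≉0 with ℕ.m≤n⇒m<n∨m≡n (Fin.toℕ<n i)
    ... | inj₁ i<N = w-middle x z<s i<N
    ... | inj₂ i≡N = begin
      w (suc (toℕ i)) x  ≡⟨ ≡.cong (λ j → w j x) i≡N ⟩
      w N x  ≈⟨ w-last x ⟩
      T x ^ N + - (η * z x)  ≈⟨ +-cong (T^N≈1 x x≉0) (trans (-‿cong (trans (*-congˡ (z-≉0 x≉0)) (zeroʳ η))) -0#≈0#) ⟩
      1# + 0#  ≈⟨ +-identityʳ 1# ⟩
      1#  ≡⟨ ≡.cong (T x ^_) (ℕ.n∸n≡0 N) ⟨
      T x ^ (N ∸ N)  ≡⟨ ≡.cong (λ j → T x ^ (N ∸ j)) i≡N ⟨
      T x ^ (N ∸ suc (toℕ i))  ∎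

    G : L.Carrier → L.Carrier → Carrier
    G x y = ∑ λ (i : Fin N) → T x ^ (N ∸ suc (toℕ i)) * T y ^ toℕ i

    kernel : L.Carrier → L.Carrier → Carrier
    kernel x y = ∑ λ (r : Fin Q) → w (toℕ r) x * T y ^ toℕ r

    kernel-split : ∀ x y → kernel x y ≈ w 0 x * 1# + ∑ λ (i : Fin N) → w (suc (toℕ i)) x * T y ^ suc (toℕ i)
    kernel-split x y = ∑-toℕ Q≡1+N (λ r → w r x * T y ^ r)

    kernel-zero : ∀ {x} y → x L.≈ L.0# → kernel x y ≈ η + - (η * T y ^ N)
    kernel-zero {x} y x≈0 = trans (kernel-split x y) (+-cong
      (trans (*-identityʳ _) (trans (*-congˡ (z-0 x≈0)) (*-identityʳ η)))
      (trans (∑-single _ top away) (begin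
        w (suc (toℕ top)) x * T y ^ suc (toℕ top)  ≡⟨ ≡.cong (λ j → w j x * T y ^ j) top≡ ⟩
        w N x * T y ^ N  ≈⟨ *-congʳ (w-last x) ⟩
        (T x ^ N + - (η * z x)) * T y ^ N  ≈⟨ *-congʳ (+-cong (T^-0 0<N x≈0) (-‿cong (trans (*-congˡ (z-0 x≈0)) (*-identityʳ η)))) ⟩
        (0# + - η) * T y ^ N  ≈⟨ *-congʳ (+-identityˡ (- η)) ⟩
        - η * T y ^ N  ≈⟨ -‿distribˡ-* η _ ⟨
        - (η * T y ^ N)  ∎)))
      where
      -- At x = 0 only the exponents 0 and `N` contribute, the latter through the term - η z(x) of
      -- `w N`.
      top : Fin N
      top = fromℕ< {ℕ.pred N} (ℕ.≤-reflexive (ℕ.suc-pred N))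
      top≡ : suc (toℕ top) ≡ N
      top≡ = ≡.trans (≡.cong suc (Fin.toℕ-fromℕ< _)) (ℕ.suc-pred N)
      away : ∀ i → i ≢ top → w (suc (toℕ i)) x * T y ^ suc (toℕ i) ≈ 0#
      away i i≢top = trans (*-congʳ (trans (w-middle x z<s i<N) (T^-0 (ℕ.m<n⇒0<n∸m i<N) x≈0))) (zeroˡ _)
        where
        i<N : suc (toℕ i) < N
        i<N = ℕ.≤∧≢⇒< (Fin.toℕ<n i) (λ eq → i≢top (Fin.toℕ-injective (ℕ.suc-injective (≡.trans eq (≡.sym top≡)))))

    kernel-nonzero : ∀ {x} y → ¬ x L.≈ L.0# → kernel x y ≈ T y * G x y
    kernel-nonzero {x} y x≉0 = begin
      kernel x y
        ≈⟨ kernel-split x y ⟩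
      w 0 x * 1# + ∑ (λ (i : Fin N) → w (suc (toℕ i)) x * T y ^ suc (toℕ i))
        ≈⟨ +-cong (trans (*-identityʳ _) (trans (*-congˡ (z-≉0 x≉0)) (zeroʳ η)))
                  (∑-cong λ i → trans (*-congʳ (w-T-suc i x≉0))
                    (solve 3 (λ a b c → a :* (b :* c) := b :* (a :* c)) refl (T x ^ (N ∸ suc (toℕ i))) (T y) (T y ^ toℕ i))) ⟩
      0# + ∑ (λ (i : Fin N) → T y * (T x ^ (N ∸ suc (toℕ i)) * T y ^ toℕ i))
        ≈⟨ trans (+-identityˡ _) (sym (*-distribˡ-∑ _ _)) ⟩
      T y * G x y ∎

    G≈ : ∀ x y → T y * G x y + T x ^ N ≈ T x * G x y + T y ^ N
    G≈ x y = geometric N (T x) (T y)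

  -- With `complete-≉` this is the completeness relation matching orthogonality, read off from a
  -- geometric sum instead of inverting a matrix. For x nonzero, each exponent from 1 to `N`
  -- contributes 1 and the exponent 0 contributes nothing.
  complete-≈ : ∀ {x y} → x L.≈ y → ∑ (λ (r : Fin Q) → w (toℕ r) x * T y ^ toℕ r) ≈ η
  complete-≈ {x} {y} x≈y with x L.≟ L.0#
  ... | yes x≈0 = trans (kernel-zero y x≈0) (trans
          (+-congˡ (trans (-‿cong (trans (*-congˡ (T^-0 0<N (L.trans (L.sym x≈y) x≈0))) (zeroʳ η))) -0#≈0#)) (+-identityʳ η))
  ... | no x≉0  = begin
    kernel x y  ≈⟨ kernel-nonzero y x≉0 ⟩
    T y * G x y  ≈⟨ *-distribˡ-∑ _ _ ⟩
    ∑ (λ (i : Fin N) → T y * (T x ^ (N ∸ suc (toℕ i)) * T y ^ toℕ i))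
      ≈⟨ ∑-cong one ⟩
    ∑ {N} (λ _ → 1#)  ≈⟨ ∑-replicate N 1# ⟩
    η  ∎
    where
    one : ∀ (i : Fin N) → T y * (T x ^ (N ∸ suc (toℕ i)) * T y ^ toℕ i) ≈ 1#
    one i = begin
      T y * (T x ^ (N ∸ suc (toℕ i)) * T y ^ toℕ i)  ≈⟨ solve 3 (λ a b c → a :* (b :* c) := b :* (a :* c)) refl (T y) (T x ^ (N ∸ suc (toℕ i))) (T y ^ toℕ i) ⟩
      T x ^ (N ∸ suc (toℕ i)) * T y ^ suc (toℕ i)  ≈⟨ *-congˡ (^-congˡ (suc (toℕ i)) (T-cong x≈y)) ⟨
      T x ^ (N ∸ suc (toℕ i)) * T x ^ suc (toℕ i)  ≈⟨ ^-homo-* (T x) (N ∸ suc (toℕ i)) (suc (toℕ i)) ⟨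
      T x ^ (N ∸ suc (toℕ i) ℕ.+ suc (toℕ i))  ≡⟨ ≡.cong (T x ^_) (ℕ.m∸n+n≡m (Fin.toℕ<n i)) ⟩
      T x ^ N  ≈⟨ T^N≈1 x x≉0 ⟩
      1#  ∎

  -- For nonzero x and y, the geometric sum times T(y) - T(x) is T(y)^N - T(x)^N = 0, and T(y)
  -- differs from T(x) because `T` is injective.
  complete-≉ : ∀ {x y} → ¬ x L.≈ y → ∑ (λ (r : Fin Q) → w (toℕ r) x * T y ^ toℕ r) ≈ 0#
  complete-≉ {x} {y} x≉y with x L.≟ L.0# | y L.≟ L.0#
  ... | yes x≈0 | yes y≈0 = contradiction (L.trans x≈0 (L.sym y≈0)) x≉y
  ... | yes x≈0 | no y≉0  = trans (kernel-zero y x≈0)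
          (trans (+-congˡ (-‿cong (trans (*-congˡ (T^N≈1 y y≉0)) (*-identityʳ η)))) (-‿inverseʳ η))
  ... | no x≉0  | yes y≈0 = trans (kernel-nonzero y x≉0) (trans (*-congʳ (T≈0 y≈0)) (zeroˡ _))
  ... | no x≉0  | no y≉0  = trans (kernel-nonzero y x≉0) (trans (*-congˡ G≈0) (zeroʳ _))
    where
    TyG≈TxG : T y * G x y ≈ T x * G x y
    TyG≈TxG = +-cancelʳ 1# _ _ (trans (+-congˡ (sym (T^N≈1 x x≉0))) (trans (G≈ x y) (+-congˡ (T^N≈1 y y≉0))))
    G≈0 : G x y ≈ 0#
    G≈0 = noZeroDivisors (T y - T x) (G x y)
      (λ eq → x≉y (L.sym (T-injective (+-cancelʳ (- T x) _ _ (trans eq (sym (-‿inverseʳ (T x))))))))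
      (trans ([y-z]x≈yx-zx _ _ _) (trans (+-congʳ TyG≈TxG) (-‿inverseʳ _)))

  -- `w r` is homogeneous of degree -r under nonzero scalars; the factor T(c)^r stands on the left
  -- to avoid inverses.
  w-scale : ∀ {r} c x → r ≤ N → ¬ c L.≈ L.0# → w r (c L.* x) * T c ^ r ≈ w r x
  w-scale {r} c x r≤N c≉0 with view r r≤N
  ... | first = trans (*-identityʳ _) (*-congˡ (z-scale))
    where
    z-scale : z (c L.* x) ≈ z x
    z-scale = if-cong ((c L.* x) L.≟ L.0#) (x L.≟ L.0#) (L.domain c≉0) (λ x≈0 → L.trans (L.*-congˡ x≈0) (L.zeroʳ c))
  ... | middle _ 0<r r<N = begin
    w r (c L.* x) * T c ^ r  ≈⟨ *-congʳ (w-middle _ 0<r r<N) ⟩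
    T (c L.* x) ^ (N ∸ r) * T c ^ r  ≈⟨ *-congʳ (trans (^-congˡ (N ∸ r) (T-* c x)) (^-distrib-* (T c) (T x) (N ∸ r))) ⟩
    T c ^ (N ∸ r) * T x ^ (N ∸ r) * T c ^ r  ≈⟨ solve 3 (λ a b c → a :* b :* c := a :* c :* b) refl (T c ^ (N ∸ r)) (T x ^ (N ∸ r)) (T c ^ r) ⟩
    T c ^ (N ∸ r) * T c ^ r * T x ^ (N ∸ r)  ≈⟨ *-congʳ (sym (^-homo-* (T c) (N ∸ r) r)) ⟩
    T c ^ (N ∸ r ℕ.+ r) * T x ^ (N ∸ r)  ≈⟨ *-congʳ (trans (^-congʳ (T c) (ℕ.m∸n+n≡m r≤N)) (T^N≈1 c c≉0)) ⟩
    1# * T x ^ (N ∸ r)  ≈⟨ *-identityˡ _ ⟩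
    T x ^ (N ∸ r)  ≈⟨ w-middle x 0<r r<N ⟨
    w r x  ∎
  ... | last = begin
    w N (c L.* x) * T c ^ N  ≈⟨ trans (*-congˡ (T^N≈1 c c≉0)) (*-identityʳ _) ⟩
    w N (c L.* x)  ≈⟨ w-last _ ⟩
    T (c L.* x) ^ N + - (η * z (c L.* x))  ≈⟨ +-cong T^N-scale (-‿cong (*-congˡ z-scale)) ⟩
    T x ^ N + - (η * z x)  ≈⟨ w-last x ⟨
    w N x  ∎
    where
    z-scale : z (c L.* x) ≈ z x
    z-scale = if-cong ((c L.* x) L.≟ L.0#) (x L.≟ L.0#) (L.domain c≉0) (λ x≈0 → L.trans (L.*-congˡ x≈0) (L.zeroʳ c))
    T^N-scale : T (c L.* x) ^ N ≈ T x ^ N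
    T^N-scale = trans (^-congˡ N (T-* c x)) (trans (^-distrib-* (T c) (T x) N) (trans (*-congʳ (T^N≈1 c c≉0)) (*-identityˡ _)))

  -- `N` is its own dual, not 0: dual exponents are then always positive, and r + `dual` r is always
  -- a positive multiple of `N`, over which the power sum is η.
  dual : ℕ → ℕ
  dual r with r ℕ.≟ N
  ... | yes _ = N
  ... | no _  = N ∸ r

  dual-last : dual N ≡ N
  dual-last with N ℕ.≟ N
  ... | yes _ = ≡.refl
  ... | no ≢  = contradiction ≡.refl ≢

  dual-< : ∀ {r} → r < N → dual r ≡ N ∸ r
  dual-< {r} r<N with r ℕ.≟ N
  ... | yes r≡N = contradiction r≡N (ℕ.<⇒≢ r<N)
  ... | no _    = ≡.refl

  0<dual : ∀ {r} → r ≤ N → 0 < dual r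
  0<dual {r} r≤N with r ℕ.≟ N
  ... | yes _  = 0<N
  ... | no r≢N = ℕ.m<n⇒0<n∸m (ℕ.≤∧≢⇒< r≤N r≢N)

  dual≤N : ∀ r → dual r ≤ N
  dual≤N r with r ℕ.≟ N
  ... | yes _ = ℕ.≤-refl
  ... | no _  = ℕ.m∸n≤m N r

  σ-dual : ∀ {r} → r ≤ N → σ (r ℕ.+ dual r) ≈ η
  σ-dual {r} r≤N with r ℕ.≟ N
  ... | yes ≡.refl = trans (σ-periodic N 0<N) σ-N
  ... | no _       = trans (reflexive (≡.cong σ (ℕ.m+[n∸m]≡n r≤N))) σ-N

  open DigitSums p-prime

  private
    S-compl : ∀ {a b} → a ℕ.+ b ≡ N → S a ℕ.+ S b ≡ (p ∸ 1) ℕ.* f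
    S-compl {a} {b} eq = S-complement f a b (≡.trans (≡.cong suc eq) (≡.trans (≡.sym Q≡1+N) Q≡p^f))

    S-N : S N ≡ (p ∸ 1) ℕ.* f
    S-N = ≡.trans (≡.cong (ℕ._+ S N) (≡.sym S-0)) (S-compl {0} ≡.refl)

    w-last-0 : w N L.0# ≈ - η
    w-last-0 = begin
      w N L.0#  ≈⟨ w-last L.0# ⟩
      T L.0# ^ N + - (η * z L.0#)  ≈⟨ +-cong (T^-0 0<N L.refl) (-‿cong (trans (*-congˡ (z-0 L.refl)) (*-identityʳ η))) ⟩
      0# + - η  ≈⟨ +-identityˡ _ ⟩
      - η  ∎

    unit--η : Unit (- η)
    unit--η eq = unit-η (L.trans (L.sym (ρ-cong (-‿involutive η))) (L.trans (ρ-neg (- η)) (L.trans (L.-‿cong eq) L.-0#≈0#)))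

  opaque
    -- Complementary digits give total digit sum (p - 1) f, except for the self-dual r = N, where it
    -- is twice that. The excess μ = f is matched by the left side: the sum of (w N)² is η + η² = Q
    -- η.
    pairing : ∀ {r} → r ≤ N → ∃[ μ ] ∃[ u ] Unit u × S r ℕ.+ S (dual r) ≡ (p ∸ 1) ℕ.* (f ℕ.+ μ) ×
      ∑ (λ a → w r (L.el a) * w (dual r) (L.el a)) ≈ P ^ μ * u
    pairing {r} r≤N with view r r≤N
    ... | first = 0 , η * - η , unit-* unit-η unit--η , ≡.trans (≡.cong (λ i → S 0 ℕ.+ S i) (dual-< 0<N)) (≡.trans (S-compl {0} ≡.refl) (≡.cong ((p ∸ 1) ℕ.*_) (≡.sym (ℕ.+-identityʳ f)))) , (begin
      ∑ (λ a → η * z (L.el a) * w (dual 0) (L.el a))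
        ≈⟨ ∑-cong (λ a → *-assoc _ _ _) ⟩
      ∑ (λ a → η * (z (L.el a) * w (dual 0) (L.el a)))
        ≈⟨ *-distribˡ-∑ _ _ ⟨
      η * ∑ (λ a → z (L.el a) * w (dual 0) (L.el a))
        ≈⟨ *-congˡ (∑-z (w (dual 0)) (w-cong (dual 0))) ⟩
      η * w (dual 0) L.0#
        ≡⟨ ≡.cong (λ i → η * w i L.0#) (dual-< 0<N) ⟩
      η * w N L.0#
        ≈⟨ *-congˡ w-last-0 ⟩
      η * - η
        ≈⟨ *-identityˡ _ ⟨
      1# * (η * - η)  ∎)
    ... | middle _ 0<r r<N = 0 , η , unit-η , ≡.trans (≡.cong (λ i → S r ℕ.+ S i) (dual-< r<N))
            (≡.trans (S-compl (ℕ.m+[n∸m]≡n r≤N)) (≡.cong ((p ∸ 1) ℕ.*_) (≡.sym (ℕ.+-identityʳ f)))) , (begin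
      ∑ (λ a → w r (L.el a) * w (dual r) (L.el a))  ≈⟨ ∑-cong (λ a → step (L.el a)) ⟩
      σ N  ≈⟨ σ-N ⟩
      η  ≈⟨ *-identityˡ η ⟨
      1# * η  ∎)
      where
      step : ∀ x → w r x * w (dual r) x ≈ T x ^ N
      step x = begin
        w r x * w (dual r) x  ≡⟨ ≡.cong (λ i → w r x * w i x) (dual-< r<N) ⟩
        w r x * w (N ∸ r) x  ≈⟨ *-cong (w-middle x 0<r r<N) (w-middle x (ℕ.m<n⇒0<n∸m r<N) (ℕ.∸-monoʳ-< 0<r r≤N)) ⟩
        T x ^ (N ∸ r) * T x ^ (N ∸ (N ∸ r))  ≈⟨ ^-homo-* (T x) (N ∸ r) _ ⟨
        T x ^ (N ∸ r ℕ.+ (N ∸ (N ∸ r)))  ≡⟨ ≡.cong (T x ^_) (ℕ.m+[n∸m]≡n (ℕ.m∸n≤m N r)) ⟩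
        T x ^ N  ∎
    ... | last = f , η , unit-η , degree , (begin
      ∑ (λ a → w N (L.el a) * w (dual N) (L.el a))  ≈⟨ ∑-cong (λ a → step (L.el a)) ⟩
      ∑ (λ a → w N (L.el a) * T (L.el a) ^ N + - η * (z (L.el a) * w N (L.el a)))
        ≈⟨ ∑-distrib-+ _ _ ⟩
      ∑ (λ a → w N (L.el a) * T (L.el a) ^ N) + ∑ (λ a → - η * (z (L.el a) * w N (L.el a)))
        ≈⟨ +-cong (orthogonal-≡ ℕ.≤-refl) (sym (*-distribˡ-∑ _ _)) ⟩
      η + - η * ∑ (λ a → z (L.el a) * w N (L.el a))  ≈⟨ +-congˡ (*-congˡ (trans (∑-z (w N) (w-cong N)) w-last-0)) ⟩
      η + - η * - η  ≈⟨ +-congˡ -η*-η ⟩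
      η + η * η  ≈⟨ +-congʳ (*-identityˡ η) ⟨
      1# * η + η * η  ≈⟨ distribʳ η 1# η ⟨
      (1# + η) * η  ≈⟨ *-congʳ (trans (sym 1+η) Q≈) ⟩
      P ^ f * η  ∎)
      where
      degree : S N ℕ.+ S (dual N) ≡ (p ∸ 1) ℕ.* (f ℕ.+ f)
      degree = ≡.trans (≡.cong₂ ℕ._+_ S-N (≡.trans (≡.cong S dual-last) S-N)) (≡.sym (ℕ.*-distribˡ-+ (p ∸ 1) f f))
      -η*-η : - η * - η ≈ η * η
      -η*-η = trans (sym (-‿distribˡ-* η (- η))) (trans (-‿cong (sym (-‿distribʳ-* η η))) (-‿involutive _))
      step : ∀ x → w N x * w (dual N) x ≈ w N x * T x ^ N + - η * (z x * w N x)
      step x = begin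
        w N x * w (dual N) x  ≡⟨ ≡.cong (λ i → w N x * w i x) dual-last ⟩
        w N x * w N x  ≈⟨ *-congˡ (w-last x) ⟩
        w N x * (T x ^ N + - (η * z x))  ≈⟨ *-congˡ (+-congˡ (-‿distribˡ-* η (z x))) ⟩
        w N x * (T x ^ N + - η * z x)  ≈⟨ solve 4 (λ w t n z → w :* (t :+ n :* z) := w :* t :+ n :* (z :* w)) refl (w N x) (T x ^ N) (- η) (z x) ⟩
        w N x * T x ^ N + - η * (z x * w N x)  ∎

-- Expansion of functions on L^k in monomials

differ : ∀ {k n} (u v : Vec (Fin n) k) → u ≢ v → ∃[ i ] lookup u i ≢ lookup v i
differ []      []      u≢v = contradiction ≡.refl u≢v
differ (a ∷ u) (b ∷ v) u≢v with a Fin.≟ b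
... | no a≢b = zero , a≢b
... | yes ≡.refl with i , neq ← differ u v (u≢v ∘ ≡.cong (a ∷_)) = suc i , neq

module Expansion {c₁ ℓ₁ c₂ ℓ₂ p f Q} (p-prime : Prime p) (Q≡p^f : Q ≡ p ℕ.^ f)
  (L : FiniteField c₁ ℓ₁ Q) (R : ℤₚ[ξ (Q ∸ 1) ] p c₂ ℓ₂)
  (ρ : ℤₚ[ξ_].Carrier R → FiniteField.Carrier L) (isReduction : IsReduction R L ρ)
  (T : FiniteField.Carrier L → ℤₚ[ξ_].Carrier R) (isTeichmüller : IsTeichmüller R L ρ T) (k : ℕ) where

  open Teichmüller {f = f} p-prime Q≡p^f L R ρ isReduction T isTeichmüller public
  open ℤₚ[ξ_] R hiding (zero; ∑; ∏)
  open Solver using (solve; con; _:+_; _:*_; _:=_)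
  open SetoidReasoning setoid

  Point : Set
  Point = Vec (Fin Q) k

  pt : Point → Fin k → L.Carrier
  pt x i = L.el (lookup x i)

  ex : Point → Fin k → ℕ
  ex r i = toℕ (lookup r i)

  ex≤N : ∀ r i → ex r i ≤ N
  ex≤N r i = toℕ≤N (lookup r i)

  mono W : (Fin k → ℕ) → (Fin k → L.Carrier) → Carrier
  mono s y = ∏ λ i → T (y i) ^ s i
  W    s y = ∏ λ i → w (s i) (y i)

  mono-cong : ∀ s {u v} → (∀ i → u i L.≈ v i) → mono s u ≈ mono s v
  mono-cong s u≈v = ∏-cong λ i → ^-congˡ (s i) (T-cong (u≈v i))

  W-cong : ∀ s {u v} → (∀ i → u i L.≈ v i) → W s u ≈ W s v
  W-cong s u≈v = ∏-cong λ i → w-cong (s i) (u≈v i)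

  mono-* : ∀ s u v → mono s (λ i → u i L.* v i) ≈ mono s u * mono s v
  mono-* s u v = trans (∏-cong λ i → trans (^-congˡ (s i) (T-* (u i) (v i))) (^-distrib-* _ _ (s i))) (∏-distrib-* _ _)

  mono-+ : ∀ r s u → mono r u * mono s u ≈ mono (λ i → r i ℕ.+ s i) u
  mono-+ r s u = trans (sym (∏-distrib-* _ _)) (∏-cong λ i → sym (^-homo-* (T (u i)) (r i) (s i)))

  ∑-points : (h : Fin k → L.Carrier → Carrier) → ∑ᵛ k (λ x → ∏ λ i → h i (pt x i)) ≈ ∏ λ i → ∑ λ a → h i (L.el a)
  ∑-points h = ∑ᵛ-∏ k λ i a → h i (L.el a)

  orthogonalᵛ-≡ : ∀ {r s} → (∀ i → r i ≤ N) → (∀ i → r i ≡ s i) → ∑ᵛ k (λ x → W r (pt x) * mono s (pt x)) ≈ η ^ k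
  orthogonalᵛ-≡ {r} {s} r≤N r≡s = begin
    ∑ᵛ k (λ x → W r (pt x) * mono s (pt x))  ≈⟨ ∑ᵛ-cong k (λ x → ∏-distrib-* _ _) ⟨
    ∑ᵛ k (λ x → ∏ λ i → w (r i) (pt x i) * T (pt x i) ^ s i)  ≈⟨ ∑-points (λ i y → w (r i) y * T y ^ s i) ⟩
    ∏ (λ i → ∑ λ a → w (r i) (L.el a) * T (L.el a) ^ s i)
      ≈⟨ ∏-cong (λ i → trans (∑-cong λ a → *-congˡ (^-congʳ _ (≡.sym (r≡s i)))) (orthogonal-≡ (r≤N i))) ⟩
    ∏ {k} (λ _ → η)  ≈⟨ ∏-replicate k η ⟩
    η ^ k  ∎

  orthogonalᵛ-≢ : ∀ {r s} → (∀ i → r i ≤ N) → (∀ i → s i ≤ N) → ∀ i → r i ≢ s i →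
                  ∑ᵛ k (λ x → W r (pt x) * mono s (pt x)) ≈ 0#
  orthogonalᵛ-≢ {r} {s} r≤N s≤N i r≢s = begin
    ∑ᵛ k (λ x → W r (pt x) * mono s (pt x))  ≈⟨ ∑ᵛ-cong k (λ x → ∏-distrib-* _ _) ⟨
    ∑ᵛ k (λ x → ∏ λ i → w (r i) (pt x i) * T (pt x i) ^ s i)  ≈⟨ ∑-points (λ i y → w (r i) y * T y ^ s i) ⟩
    ∏ (λ i → ∑ λ a → w (r i) (L.el a) * T (L.el a) ^ s i)  ≈⟨ ∏-0 i (orthogonal-≢ (r≤N i) (s≤N i) r≢s) ⟩
    0#  ∎

  completeᵛ : ∀ u v → ∑ᵛ k (λ r → W (ex r) u * mono (ex r) v) ≈
                      ∏ λ i → ∑ λ (r : Fin Q) → w (toℕ r) (u i) * T (v i) ^ toℕ r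
  completeᵛ u v = trans (∑ᵛ-cong k λ r → sym (∏-distrib-* _ _)) (∑ᵛ-∏ k λ i r → w (toℕ r) (u i) * T (v i) ^ toℕ r)

  -- η^k times the true coefficient of `mono (ex r)`, as `expansion` shows; this normalisation keeps
  -- all formulas free of division.
  coeff : (Point → Carrier) → Point → Carrier
  coeff h r = ∑ᵛ k λ x → h x * W (ex r) (pt x)

  coeff-cong : ∀ {h h′} r → (∀ x → h x ≈ h′ x) → coeff h r ≈ coeff h′ r
  coeff-cong r h≈h′ = ∑ᵛ-cong k λ x → *-congʳ (h≈h′ x)

  coeff-+ : ∀ h h′ r → coeff (λ x → h x + h′ x) r ≈ coeff h r + coeff h′ r
  coeff-+ h h′ r = trans (∑ᵛ-cong k λ x → distribʳ _ _ _) (∑ᵛ-distrib-+ k _ _)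

  coeff-* : ∀ c h r → coeff (λ x → c * h x) r ≈ c * coeff h r
  coeff-* c h r = trans (∑ᵛ-cong k λ x → *-assoc c _ _) (sym (*-distribˡ-∑ᵛ k c _))

  expansion : ∀ h x → η ^ k * h x ≈ ∑ᵛ k λ r → coeff h r * mono (ex r) (pt x)
  expansion h x = sym (begin
    ∑ᵛ k (λ r → (∑ᵛ k λ y → h y * W (ex r) (pt y)) * mono (ex r) (pt x))
      ≈⟨ ∑ᵛ-cong k (λ r → *-distribʳ-∑ᵛ k _ _) ⟩
    ∑ᵛ k (λ r → ∑ᵛ k λ y → h y * W (ex r) (pt y) * mono (ex r) (pt x))
      ≈⟨ ∑ᵛ-comm k k _ ⟩
    ∑ᵛ k (λ y → ∑ᵛ k λ r → h y * W (ex r) (pt y) * mono (ex r) (pt x))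
      ≈⟨ ∑ᵛ-cong k (λ y → trans (∑ᵛ-cong k λ r → *-assoc _ _ _) (sym (*-distribˡ-∑ᵛ k (h y) _))) ⟩
    ∑ᵛ k (λ y → h y * ∑ᵛ k λ r → W (ex r) (pt y) * mono (ex r) (pt x))
      ≈⟨ ∑ᵛ-single k _ x (λ y y≢x → trans (*-congˡ (away y y≢x)) (zeroʳ _)) ⟩
    h x * (∑ᵛ k λ r → W (ex r) (pt x) * mono (ex r) (pt x))
      ≈⟨ *-congˡ (trans (completeᵛ (pt x) (pt x)) (trans (∏-cong λ i → complete-≈ L.refl) (∏-replicate k η))) ⟩
    h x * η ^ k
      ≈⟨ *-comm _ _ ⟩
    η ^ k * h x ∎)
    where
    away : ∀ y → y ≢ x → ∑ᵛ k (λ r → W (ex r) (pt y) * mono (ex r) (pt x)) ≈ 0#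
    away y y≢x with i , neq ← differ y x y≢x = trans (completeᵛ (pt y) (pt x)) (∏-0 i (complete-≉ (neq ∘ L.el-injective)))

  coeff-mono-≡ : ∀ {s} r → (∀ i → ex r i ≡ s i) → coeff (λ x → mono s (pt x)) r ≈ η ^ k
  coeff-mono-≡ r r≡s = trans (∑ᵛ-cong k λ x → *-comm _ _) (orthogonalᵛ-≡ (ex≤N r) r≡s)

  coeff-mono-≢ : ∀ {s} r → (∀ i → s i ≤ N) → ∀ i → ex r i ≢ s i → coeff (λ x → mono s (pt x)) r ≈ 0#
  coeff-mono-≢ r s≤N i r≢s = trans (∑ᵛ-cong k λ x → *-comm _ _) (orthogonalᵛ-≢ (ex≤N r) s≤N i r≢s)

  unit-η^k : Unit (η ^ k)
  unit-η^k = unit-^ k unit-η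

  module _ (h : L.Carrier → Carrier) (h-cong : ∀ {x y} → x L.≈ y → h x ≈ h y) where

    form : Point → (Fin k → L.Carrier) → L.Carrier
    form x y = L.∑ λ i → pt x i L.* y i

    coeffΣ : Point → Carrier
    coeffΣ = coeff λ x → h (L.∑ (pt x))

    expansion-form : ∀ x y → η ^ k * h (form x y) ≈ ∑ᵛ k λ s → coeffΣ s * (mono (ex s) (pt x) * mono (ex s) y)
    expansion-form x y = begin
      η ^ k * h (form x y)  ≈⟨ *-congˡ (h-cong (L.∑-cong λ i → L.sym (pt-x*y i))) ⟩
      η ^ k * h (L.∑ (pt x*y))  ≈⟨ expansion _ x*y ⟩
      ∑ᵛ k (λ s → coeffΣ s * mono (ex s) (pt x*y))  ≈⟨ ∑ᵛ-cong k (λ s → *-congˡ (trans (mono-cong (ex s) pt-x*y) (mono-* (ex s) (pt x) y))) ⟩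
      ∑ᵛ k (λ s → coeffΣ s * (mono (ex s) (pt x) * mono (ex s) y))  ∎
      where
      x*y : Point
      x*y = tabulate λ i → L.ix (pt x i L.* y i)
      pt-x*y : ∀ i → pt x*y i L.≈ pt x i L.* y i
      pt-x*y i = L.trans (L.reflexive (≡.cong L.el (Vec.lookup∘tabulate _ i))) (L.el-ix _)

    -- The substitution x_i ↦ x_i y_i multiplies the monomial of exponent r by its value at y. Hence
    -- a column of the generator matrix enters a coefficient only as a factor.
    coeff-form : ∀ r y → coeff (λ x → h (form x y)) r ≈ coeffΣ r * mono (ex r) y
    coeff-form r y = *-cancelˡ (unit≉0 unit-η^k) (begin
      η ^ k * coeff (λ x → h (form x y)) r
        ≈⟨ coeff-* _ _ r ⟨
      coeff (λ x → η ^ k * h (form x y)) r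
        ≈⟨ coeff-cong r (λ x → expansion-form x y) ⟩
      ∑ᵛ k (λ x → (∑ᵛ k λ s → coeffΣ s * (mono (ex s) (pt x) * mono (ex s) y)) * W (ex r) (pt x))
        ≈⟨ ∑ᵛ-cong k (λ x → trans (*-distribʳ-∑ᵛ k _ _) (∑ᵛ-cong k λ s →
             solve 4 (λ c m n w → c :* (m :* n) :* w := c :* n :* (m :* w)) refl (coeffΣ s) (mono (ex s) (pt x)) (mono (ex s) y) (W (ex r) (pt x)))) ⟩
      ∑ᵛ k (λ x → ∑ᵛ k λ s → coeffΣ s * mono (ex s) y * (mono (ex s) (pt x) * W (ex r) (pt x)))
        ≈⟨ ∑ᵛ-comm k k _ ⟩
      ∑ᵛ k (λ s → ∑ᵛ k λ x → coeffΣ s * mono (ex s) y * (mono (ex s) (pt x) * W (ex r) (pt x)))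
        ≈⟨ ∑ᵛ-cong k (λ s → sym (*-distribˡ-∑ᵛ k _ _)) ⟩
      ∑ᵛ k (λ s → coeffΣ s * mono (ex s) y * coeff (λ x → mono (ex s) (pt x)) r)
        ≈⟨ ∑ᵛ-single k _ r (λ s s≢r → trans (*-congˡ (away s s≢r)) (zeroʳ _)) ⟩
      coeffΣ r * mono (ex r) y * coeff (λ x → mono (ex r) (pt x)) r
        ≈⟨ trans (*-congˡ (coeff-mono-≡ r λ i → ≡.refl)) (*-comm _ _) ⟩
      η ^ k * (coeffΣ r * mono (ex r) y) ∎)
      where
      away : ∀ s → s ≢ r → coeff (λ x → mono (ex s) (pt x)) r ≈ 0#
      away s s≢r with i , neq ← differ r s (s≢r ∘ ≡.sym) = coeff-mono-≢ r (ex≤N s) i (neq ∘ Fin.toℕ-injective)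

-- Counting and sums of natural numbers

injective⇒surjective : ∀ {n} (h : Fin n → Fin n) → (∀ {i j} → h i ≡ h j → i ≡ j) → ∀ y → ∃[ i ] h i ≡ y
injective⇒surjective {suc n} h h-inj y with Fin.any? (λ i → h i Fin.≟ y)
... | yes found = found
... | no missed = contradiction (Fin.injective⇒≤ {f = λ i → punchOut (λ eq → missed (i , ≡.sym eq))}
                    (λ eq → h-inj (Fin.punchOut-injective {i = y} (λ eq′ → missed (_ , ≡.sym eq′)) (λ eq′ → missed (_ , ≡.sym eq′)) eq))) ℕ.1+n≰n

pred∣pred-^ : ∀ q m .{{_ : NonZero q}} → ∃[ d ] q ℕ.^ m ∸ 1 ≡ d ℕ.* (q ∸ 1)
pred∣pred-^ q@(suc q-1) zero    = 0 , ≡.refl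
pred∣pred-^ q@(suc q-1) (suc m) with d , eq ← pred∣pred-^ q m = q ℕ.^ m ℕ.+ d , (begin
  q ℕ.^ m ℕ.+ q-1 ℕ.* q ℕ.^ m ∸ 1  ≡⟨ ≡.cong (_∸ 1) (ℕ.+-comm (q ℕ.^ m) _) ⟩
  q-1 ℕ.* q ℕ.^ m ℕ.+ q ℕ.^ m ∸ 1  ≡⟨ ℕ.+-∸-assoc (q-1 ℕ.* q ℕ.^ m) (ℕ.m^n>0 q m) ⟩
  q-1 ℕ.* q ℕ.^ m ℕ.+ (q ℕ.^ m ∸ 1)  ≡⟨ ≡.cong₂ ℕ._+_ (ℕ.*-comm q-1 (q ℕ.^ m)) eq ⟩
  q ℕ.^ m ℕ.* q-1 ℕ.+ d ℕ.* q-1  ≡⟨ ℕ.*-distribʳ-+ q-1 (q ℕ.^ m) d ⟨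
  (q ℕ.^ m ℕ.+ d) ℕ.* q-1  ∎)
  where open ≡.≡-Reasoning

∑ℕ-cong : ∀ {k} {f g : Fin k → ℕ} → (∀ i → f i ≡ g i) → ∑ℕ f ≡ ∑ℕ g
∑ℕ-cong {zero}  eq = ≡.refl
∑ℕ-cong {suc k} eq = ≡.cong₂ ℕ._+_ (eq zero) (∑ℕ-cong (eq ∘ suc))

∑ℕ-mono-≤ : ∀ {k} {f g : Fin k → ℕ} → (∀ i → f i ≤ g i) → ∑ℕ f ≤ ∑ℕ g
∑ℕ-mono-≤ {zero}  f≤g = z≤n
∑ℕ-mono-≤ {suc k} f≤g = ℕ.+-mono-≤ (f≤g zero) (∑ℕ-mono-≤ (f≤g ∘ suc))

∑ℕ-+ : ∀ {k} (f g : Fin k → ℕ) → ∑ℕ (λ i → f i ℕ.+ g i) ≡ ∑ℕ f ℕ.+ ∑ℕ g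
∑ℕ-+ {zero}  f g = ≡.refl
∑ℕ-+ {suc k} f g = ≡.trans (≡.cong (f zero ℕ.+ g zero ℕ.+_) (∑ℕ-+ (f ∘ suc) (g ∘ suc))) (lemma (f zero) (g zero) _ _)
  where
  lemma : ∀ a b c d → a ℕ.+ b ℕ.+ (c ℕ.+ d) ≡ a ℕ.+ c ℕ.+ (b ℕ.+ d)
  lemma = solve-∀

∑ℕ-* : ∀ {k} c (f : Fin k → ℕ) → ∑ℕ (λ i → c ℕ.* f i) ≡ c ℕ.* ∑ℕ f
∑ℕ-* {zero}  c f = ≡.sym (ℕ.*-zeroʳ c)
∑ℕ-* {suc k} c f = ≡.trans (≡.cong (c ℕ.* f zero ℕ.+_) (∑ℕ-* c (f ∘ suc))) (≡.sym (ℕ.*-distribˡ-+ c (f zero) _))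

∑ℕ-0 : ∀ {k} {f : Fin k → ℕ} → (∀ i → f i ≡ 0) → ∑ℕ f ≡ 0
∑ℕ-0 {zero}  f≡0 = ≡.refl
∑ℕ-0 {suc k} f≡0 = ≡.cong₂ ℕ._+_ (f≡0 zero) (∑ℕ-0 (f≡0 ∘ suc))

≤-∑ℕ : ∀ {k} (f : Fin k → ℕ) i → f i ≤ ∑ℕ f
≤-∑ℕ f zero    = ℕ.m≤m+n (f zero) _
≤-∑ℕ f (suc i) = ℕ.≤-trans (≤-∑ℕ (f ∘ suc) i) (ℕ.m≤n+m _ (f zero))

∑ℕ-positive : ∀ {k} (f : Fin k → ℕ) → 0 < ∑ℕ f → ∃[ i ] f i ≢ 0
∑ℕ-positive f 0<∑ with Fin.any? (λ i → ¬? (f i ℕ.≟ 0))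
... | yes found = found
... | no none   = contradiction (∑ℕ-0 λ i → decidable-stable (f i ℕ.≟ 0) λ neq → none (i , neq)) (ℕ.>⇒≢ 0<∑)

unit : ∀ {k} → Fin k → Fin k → ℕ
unit zero    zero    = 1
unit zero    (suc _) = 0
unit (suc _) zero    = 0
unit (suc i) (suc j) = unit i j

∑ℕ-unit : ∀ {k} (h : ℕ → ℕ) → h 0 ≡ 0 → (i : Fin k) → ∑ℕ (λ j → h (unit i j)) ≡ h 1
∑ℕ-unit {suc k} h h0 zero = ≡.trans (≡.cong (h 1 ℕ.+_) (∑ℕ-0 {k} λ _ → h0)) (ℕ.+-identityʳ _)
∑ℕ-unit h h0 (suc i) = ≡.cong₂ ℕ._+_ h0 (∑ℕ-unit h h0 i)

n<p^n : ∀ {p} → 1 < p → ∀ n → n < p ℕ.^ n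
n<p^n 1<p zero    = z<s
n<p^n {p} 1<p (suc n) = ℕ.<-≤-trans (ℕ.+-mono-≤-< (ℕ.m^n>0 p {{ℕ.>-nonZero (ℕ.<-trans z<s 1<p)}} n) (n<p^n 1<p n))
  (ℕ.≤-trans (ℕ.≤-reflexive (≡.cong (p ℕ.^ n ℕ.+_) (≡.sym (ℕ.+-identityʳ _)))) (ℕ.*-monoˡ-≤ (p ℕ.^ n) 1<p))

-- The trace and the subfield of q elements

module Trace {c₁ ℓ₁ c₂ ℓ₂ c₃ ℓ₃ p e m} (p-prime : Prime p) .{{_ : NonZero e}} .{{_ : NonZero m}}
  (K : FiniteField c₁ ℓ₁ (p ℕ.^ e)) (L : FiniteField c₂ ℓ₂ ((p ℕ.^ e) ℕ.^ m))
  (ι : FiniteField.Carrier K → FiniteField.Carrier L)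
  (isEmbedding : IsEmbedding (FiniteField.commutativeRing K) (FiniteField.commutativeRing L) ι)
  (R : ℤₚ[ξ ((p ℕ.^ e) ℕ.^ m ∸ 1) ] p c₃ ℓ₃)
  (ρ : ℤₚ[ξ_].Carrier R → FiniteField.Carrier L) (isReduction : IsReduction R L ρ)
  (T : FiniteField.Carrier L → ℤₚ[ξ_].Carrier R) (isTeichmüller : IsTeichmüller R L ρ T) (k : ℕ) where

  open Expansion {f = e ℕ.* m} p-prime (ℕ.^-*-assoc p e m) L R ρ isReduction T isTeichmüller k public
  module K where
    open FiniteField K hiding (∑; ∏; zero) public
    open Sums (FiniteField.commutativeRing K) public
    open FieldProperties K public
  open ℤₚ[ξ_] R hiding (zero; ∑; ∏; isEmbedding)
  open Solver using (solve; con; _:+_; _:*_; _:=_)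
  open SetoidReasoning setoid
  open Frobenius L.commutativeRing p-prime using (∑-freshman; freshman-^)
  module ι = RingMorphisms.IsRingMonomorphism isEmbedding

  q Q : ℕ
  q = p ℕ.^ e
  Q = q ℕ.^ m

  instance
    q≢0 : NonZero q
    q≢0 = ℕ.>-nonZero (ℕ.<-trans z<s K.1<Q)

  q^≡ : ∀ i → q ℕ.^ i ≡ p ℕ.^ (e ℕ.* i)
  q^≡ = ℕ.^-*-assoc p e

  q^-freshman : ∀ i x y → (x L.+ y) L.^ (q ℕ.^ i) L.≈ x L.^ (q ℕ.^ i) L.+ y L.^ (q ℕ.^ i)
  q^-freshman i x y = ≡.subst (λ n → (x L.+ y) L.^ n L.≈ x L.^ n L.+ y L.^ n) (≡.sym (q^≡ i)) (freshman-^ L-char (e ℕ.* i) x y)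

  tr : L.Carrier → L.Carrier
  tr x = L.∑ λ (i : Fin m) → x L.^ (q ℕ.^ toℕ i)

  tr-cong : ∀ {x y} → x L.≈ y → tr x L.≈ tr y
  tr-cong x≈y = L.∑-cong λ i → L.^-congˡ (q ℕ.^ toℕ i) x≈y

  tr-+ : ∀ x y → tr (x L.+ y) L.≈ tr x L.+ tr y
  tr-+ x y = L.trans (L.∑-cong λ i → q^-freshman (toℕ i) x y) (L.∑-distrib-+ _ _)

  tr-fixed : ∀ x → tr x L.^ q L.≈ tr x
  tr-fixed x = L.begin
    tr x L.^ q  L.≡⟨ ≡.refl ⟩
    L.∑ (λ i → a (toℕ i)) L.^ (p ℕ.^ e)  L.≈⟨ ∑-freshman L-char e _ ⟩
    L.∑ (λ i → a (toℕ i) L.^ q)  L.≈⟨ L.∑-cong (λ i → next (toℕ i)) ⟩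
    L.∑ (λ (i : Fin m) → a (suc (toℕ i)))  L.≈⟨ rotate m ≡.refl ⟩
    tr x  L.∎
    where
    a : ℕ → L.Carrier
    a i = x L.^ (q ℕ.^ i)
    next : ∀ i → a i L.^ q L.≈ a (suc i)
    next i = L.trans (L.^-assocʳ x (q ℕ.^ i) q) (L.reflexive (≡.cong (x L.^_) (ℕ.*-comm (q ℕ.^ i) q)))
    rotate : ∀ n → n ≡ m → L.∑ (λ (i : Fin n) → a (suc (toℕ i))) L.≈ L.∑ (λ (i : Fin n) → a (toℕ i))
    rotate zero    _   = L.trans L.∑-zero (L.sym L.∑-zero)
    rotate (suc n) eq = L.begin
      L.∑ (λ (i : Fin (suc n)) → a (suc (toℕ i)))  L.≈⟨ L.∑-init-last _ ⟩
      L.∑ (λ (i : Fin n) → a (suc (toℕ (inject₁ i)))) L.+ a (suc (toℕ (fromℕ n)))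
        L.≈⟨ L.+-cong (L.∑-cong λ i → L.reflexive (≡.cong (λ j → a (suc j)) (Fin.toℕ-inject₁ i)))
                      (L.reflexive (≡.cong (λ j → a (suc j)) (Fin.toℕ-fromℕ n))) ⟩
      L.∑ (λ (i : Fin n) → a (suc (toℕ i))) L.+ a (suc n)  L.≈⟨ L.+-congˡ (L.trans (L.reflexive (≡.cong a eq)) (L.trans (L.x^Q≈x x) (L.sym (L.*-identityʳ x)))) ⟩
      L.∑ (λ (i : Fin n) → a (suc (toℕ i))) L.+ a 0  L.≈⟨ L.+-comm _ _ ⟩
      a 0 L.+ L.∑ (λ (i : Fin n) → a (suc (toℕ i)))  L.≈⟨ L.∑-suc _ ⟨
      L.∑ (λ (i : Fin (suc n)) → a (toℕ i))  L.∎

  fixed-^ : ∀ {c} i → c L.^ q L.≈ c → c L.^ (q ℕ.^ i) L.≈ c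
  fixed-^ zero    _  = L.*-identityʳ _
  fixed-^ {c} (suc i) eq = L.trans (L.sym (L.^-assocʳ c q (q ℕ.^ i))) (L.trans (L.^-congˡ (q ℕ.^ i) eq) (fixed-^ i eq))

  tr-scale : ∀ {c} x → c L.^ q L.≈ c → tr (c L.* x) L.≈ c L.* tr x
  tr-scale {c} x eq = L.trans
    (L.∑-cong λ i → L.trans (L.^-distrib-* c x (q ℕ.^ toℕ i)) (L.*-congʳ (fixed-^ (toℕ i) eq)))
    (L.sym (L.*-distribˡ-∑ _ _))

  tr-0 : ∀ {x} → x L.≈ L.0# → tr x L.≈ L.0#
  tr-0 x≈0 = L.∑-0 λ i → L.trans (L.^-congˡ (q ℕ.^ toℕ i) x≈0) (L.0^ (ℕ.m^n>0 q (toℕ i)))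

  ρσ : ∀ i → ρ (σ i) L.≈ L.∑ (λ a → L.el a L.^ i)
  ρσ i = L.trans (ρ-∑ _) (L.∑-cong λ a → L.trans (ρ-^ _ i) (L.^-congˡ i (ρT _)))

  -- If the trace vanished identically, then so would
  -- ∑ₓ x^(Q−2) tr x = ∑ᵢ ∑ₓ x^(Q−1 + qⁱ−1), in which only i = 0 contributes, giving −1.
  tr-nondegenerate : ∃[ x ] ¬ tr x L.≈ L.0#
  tr-nondegenerate with Fin.any? (λ a → ¬? (tr (L.el a) L.≟ L.0#))
  ... | yes (a , tr≉0) = L.el a , tr≉0
  ... | no none = contradiction (L.begin
    ρ η  L.≈⟨ ρ-cong σ-N ⟨
    ρ (σ N)  L.≡⟨ ≡.cong (λ i → ρ (σ i)) (≡.trans (≡.sym (ℕ.suc-pred N)) (ℕ.+-comm 1 (ℕ.pred N))) ⟩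
    ρ (σ (exponent 0))  L.≈⟨ first-term m ≡.refl ⟨
    L.∑ (λ (i : Fin m) → ρ (σ (exponent (toℕ i))))  L.≈⟨ L.∑-cong (λ i → ρσ (exponent (toℕ i))) ⟩
    L.∑ (λ (i : Fin m) → L.∑ λ a → L.el a L.^ exponent (toℕ i))  L.≈⟨ L.∑-comm _ ⟩
    L.∑ (λ a → L.∑ λ (i : Fin m) → L.el a L.^ exponent (toℕ i))  L.≈⟨ L.∑-cong (λ a → L.trans (L.∑-cong λ i → L.^-homo-* (L.el a) (ℕ.pred N) (q ℕ.^ toℕ i)) (L.sym (L.*-distribˡ-∑ _ _))) ⟩
    L.∑ (λ a → L.el a L.^ ℕ.pred N L.* tr (L.el a))  L.≈⟨ L.∑-0 (λ a → L.trans (L.*-congˡ (all-0 a)) (L.zeroʳ _)) ⟩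
    L.0#  L.∎) unit-η
    where
    exponent : ℕ → ℕ
    exponent i = ℕ.pred N ℕ.+ q ℕ.^ i
    all-0 : ∀ a → tr (L.el a) L.≈ L.0#
    all-0 a with tr (L.el a) L.≟ L.0#
    ... | yes ≈0 = ≈0
    ... | no ≉0  = contradiction (a , ≉0) none
    vanish : ∀ i → suc i < m → ρ (σ (exponent (suc i))) L.≈ L.0#
    vanish i i<m = L.trans (ρ-cong (trans (reflexive (≡.cong σ exponent≡)) (trans (σ-periodic j 0<j) (σ-mid j 0<j j<N)))) ρ-0
      where
      j = q ℕ.^ suc i ∸ 1
      1<q^ : 1 < q ℕ.^ suc i
      1<q^ = ℕ.<-≤-trans K.1<Q (ℕ.m≤m*n q (q ℕ.^ i) {{ℕ.m^n≢0 q i}})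
      0<j : 0 < j
      0<j = ℕ.m<n⇒0<n∸m 1<q^
      j<N : j < N
      j<N = ℕ.∸-monoˡ-< (ℕ.^-monoʳ-< q K.1<Q i<m) (ℕ.<⇒≤ 1<q^)
      exponent≡ : exponent (suc i) ≡ j ℕ.+ N
      exponent≡ = ≡.trans (≡.cong (ℕ.pred N ℕ.+_) (≡.sym (ℕ.m+[n∸m]≡n (ℕ.<⇒≤ 1<q^))))
        (≡.trans (ℕ.+-suc (ℕ.pred N) j) (≡.trans (≡.cong (ℕ._+ j) (ℕ.suc-pred N)) (ℕ.+-comm N j)))
    first-term : ∀ n → n ≡ m → L.∑ (λ (i : Fin n) → ρ (σ (exponent (toℕ i)))) L.≈ ρ (σ (exponent 0))
    first-term zero    eq = contradiction (≡.sym eq) (ℕ.≢-nonZero⁻¹ m)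
    first-term (suc n) eq = L.trans (L.∑-suc _) (L.trans (L.+-congˡ (L.∑-0 λ i → vanish (toℕ i) (≡.subst (suc (toℕ i) <_) eq (s≤s (Fin.toℕ<n i))))) (L.+-identityʳ _))

  g≉0 : ¬ g L.≈ L.0#
  g≉0 g≈0 = L.1≉0 (L.trans (L.sym g^N≈1) (L.trans (L.*-congʳ g≈0) (L.zeroˡ _)))

  ξ^≉0 : ∀ i → ¬ ξ ^ i ≈ 0#
  ξ^≉0 i = unit≉0 λ eq → L.nonzero-^ i g≉0 (L.trans (L.sym (ρ-^ ξ i)) eq)

  -- Lifted to ξ, a repetition would make multiplication by ξ^(j - i) fix the nonzero element ξ^i.
  g^-distinct : ∀ {i j} → i < j → j < N → ¬ g L.^ i L.≈ g L.^ j
  g^-distinct {i} {j} i<j j<N eq = ξ^≉0 i (ξ-fixed⇒0 (j ∸ i) (ξ ^ i) (ℕ.m<n⇒0<n∸m i<j) (ℕ.≤-<-trans (ℕ.m∸n≤m j i) j<N) (begin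
    ξ ^ (j ∸ i) * ξ ^ i  ≈⟨ ^-homo-* ξ (j ∸ i) i ⟨
    ξ ^ (j ∸ i ℕ.+ i)  ≡⟨ ≡.cong (ξ ^_) (ℕ.m∸n+n≡m (ℕ.<⇒≤ i<j)) ⟩
    ξ ^ j  ≈⟨ ρξ^ j ⟨
    T (g L.^ j)  ≈⟨ T-cong eq ⟨
    T (g L.^ i)  ≈⟨ ρξ^ i ⟩
    ξ ^ i  ∎))

  g^-injective : ∀ {i j} → i < N → j < N → g L.^ i L.≈ g L.^ j → i ≡ j
  g^-injective {i} {j} i<N j<N eq with ℕ.<-cmp i j
  ... | tri≈ _ i≡j _ = i≡j
  ... | tri< i<j _ _ = contradiction eq (g^-distinct i<j j<N)
  ... | tri> _ _ j<i = contradiction (L.sym eq) (g^-distinct j<i i<N)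

  -- Zero and the powers g^a with a < N are Q distinct elements, so they exhaust `L`.
  generator : ∀ x → ¬ x L.≈ L.0# → ∃[ a ] a < N × x L.≈ g L.^ a
  generator x x≉0 =
    let i , eq = injective⇒surjective (λ i → L.ix (value (toℕ i))) injective (L.ix x)
    in conclude (toℕ i) (≡.subst (toℕ i <_) Q≡1+N (Fin.toℕ<n i)) (L.ix-injective eq)
    where
    value : ℕ → L.Carrier
    value zero    = L.0#
    value (suc a) = g L.^ a
    value-injective : ∀ a b → a < suc N → b < suc N → value a L.≈ value b → a ≡ b
    value-injective zero    zero    _ _ _  = ≡.refl
    value-injective zero    (suc b) _ _ eq = contradiction (L.sym eq) (L.nonzero-^ b g≉0)
    value-injective (suc a) zero    _ _ eq = contradiction eq (L.nonzero-^ a g≉0)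
    value-injective (suc a) (suc b) a< b< eq = ≡.cong suc (g^-injective (ℕ.s<s⁻¹ a<) (ℕ.s<s⁻¹ b<) eq)
    injective : ∀ {i j} → L.ix (value (toℕ i)) ≡ L.ix (value (toℕ j)) → i ≡ j
    injective {i} {j} eq = Fin.toℕ-injective (value-injective (toℕ i) (toℕ j)
      (≡.subst (toℕ i <_) Q≡1+N (Fin.toℕ<n i)) (≡.subst (toℕ j <_) Q≡1+N (Fin.toℕ<n j)) (L.ix-injective eq))
    conclude : ∀ a → a < suc N → value a L.≈ x → ∃[ a ] a < N × x L.≈ g L.^ a
    conclude zero    _  0≈x = contradiction (L.sym 0≈x) x≉0
    conclude (suc a) a< eq  = a , ℕ.s<s⁻¹ a< , L.sym eq

  ξ^≈1⇒N∣ : ∀ n → ξ ^ n ≈ 1# → N ℕ∣.∣ n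
  ξ^≈1⇒N∣ n eq with n ℕ.% N ℕ.≟ 0
  ... | yes n%N≡0 = ℕ∣.m%n≡0⇒n∣m n N n%N≡0
  ... | no n%N≢0  = contradiction (begin
    ξ ^ (n ℕ.% N)  ≈⟨ trans (*-congˡ (trans (^-congˡ (n ℕ./ N) ξ^N≈1) (1^ (n ℕ./ N)))) (*-identityʳ _) ⟨
    ξ ^ (n ℕ.% N) * (ξ ^ N) ^ (n ℕ./ N)  ≈⟨ *-congˡ (trans (^-assocʳ ξ N (n ℕ./ N)) (^-congʳ ξ (ℕ.*-comm N (n ℕ./ N)))) ⟩
    ξ ^ (n ℕ.% N) * ξ ^ (n ℕ./ N ℕ.* N)  ≈⟨ ^-homo-* ξ (n ℕ.% N) (n ℕ./ N ℕ.* N) ⟨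
    ξ ^ (n ℕ.% N ℕ.+ n ℕ./ N ℕ.* N)  ≡⟨ ≡.cong (ξ ^_) (ℕ.m≡m%n+[m/n]*n n N) ⟨
    ξ ^ n  ≈⟨ eq ⟩
    1#  ∎)
    (ξ-primitive (n ℕ.% N) (ℕ.n≢0⇒n>0 n%N≢0) (ℕ.m%n<n n N))

  d : ℕ
  d = proj₁ (pred∣pred-^ q m)

  N≡d*[q-1] : N ≡ d ℕ.* (q ∸ 1)
  N≡d*[q-1] = proj₂ (pred∣pred-^ q m)

  instance
    q-1≢0 : NonZero (q ∸ 1)
    q-1≢0 = ℕ.>-nonZero (ℕ.m<n⇒0<n∸m K.1<Q)

  q≡1+[q-1] : q ≡ suc (q ∸ 1)
  q≡1+[q-1] = ≡.sym (ℕ.suc-pred q)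

  g^≈1⇒ξ^≈1 : ∀ n → g L.^ n L.≈ L.1# → ξ ^ n ≈ 1#
  g^≈1⇒ξ^≈1 n eq = trans (sym (ρξ^ n)) (trans (T-cong eq) T-1)

  -- For indices below q this lists the roots of x^q = x: zero and the powers of g^d, where d = (Q -
  -- 1)/(q - 1).
  fixed-value : ℕ → L.Carrier
  fixed-value zero    = L.0#
  fixed-value (suc j) = g L.^ (j ℕ.* d)

  fixed-unit : ∀ {x} → ¬ x L.≈ L.0# → x L.^ q L.≈ x → x L.^ (q ∸ 1) L.≈ L.1#
  fixed-unit {x} x≉0 fixed = L.+-cancelʳ (L.- L.1#) _ _ (L.trans (L.domain x≉0 (L.begin
    x L.* (x L.^ (q ∸ 1) L.- L.1#)  L.≈⟨ L.x[y-z]≈xy-xz _ _ _ ⟩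
    x L.^ suc (q ∸ 1) L.- x L.* L.1#  L.≈⟨ L.+-cong (L.trans (L.reflexive (≡.cong (x L.^_) (≡.sym q≡1+[q-1]))) fixed) (L.-‿cong (L.*-identityʳ x)) ⟩
    x L.- x  L.≈⟨ L.-‿inverseʳ x ⟩
    L.0#  L.∎)) (L.sym (L.-‿inverseʳ L.1#)))

  0<q : 0 < q
  0<q = ℕ.<-trans z<s K.1<Q

  fixed-index : ∀ x → x L.^ q L.≈ x → ∃[ i ] x L.≈ fixed-value (toℕ {q} i)
  fixed-index x fixed with x L.≟ L.0#
  ... | yes x≈0 = fromℕ< 0<q , L.trans x≈0 (L.reflexive (≡.cong fixed-value (≡.sym (Fin.toℕ-fromℕ< 0<q))))
  ... | no x≉0 with a , a<N , x≈g^a ← generator x x≉0 = fromℕ< j<q , L.trans x≈g^a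
      (L.reflexive (≡.trans (≡.cong (g L.^_) a≡j*d) (≡.cong fixed-value (≡.sym (Fin.toℕ-fromℕ< j<q)))))
    where
    x^[q-1]≈1 = fixed-unit x≉0 fixed
    d∣a : d ℕ∣.∣ a
    d∣a = ℕ∣.*-cancelʳ-∣ (q ∸ 1) (≡.subst (ℕ∣._∣ a ℕ.* (q ∸ 1)) N≡d*[q-1]
      (ξ^≈1⇒N∣ (a ℕ.* (q ∸ 1)) (g^≈1⇒ξ^≈1 (a ℕ.* (q ∸ 1)) (L.trans (L.sym (L.^-assocʳ g a (q ∸ 1))) (L.trans (L.^-congˡ (q ∸ 1) (L.sym x≈g^a)) x^[q-1]≈1)))))
    j = ℕ∣.quotient d∣a
    a≡j*d : a ≡ j ℕ.* d
    a≡j*d = ℕ∣._∣_.equality d∣a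
    j<q : suc j < q
    j<q = ≡.subst (suc j <_) (≡.sym q≡1+[q-1]) (s≤s (ℕ.*-cancelʳ-< d j (q ∸ 1)
            (≡.subst₂ _<_ a≡j*d (≡.trans N≡d*[q-1] (ℕ.*-comm d (q ∸ 1))) a<N)))

  ι-^ : ∀ c n → ι c L.^ n L.≈ ι (c K.^ n)
  ι-^ c zero    = L.sym ι.1#-homo
  ι-^ c (suc n) = L.trans (L.*-congˡ (ι-^ c n)) (L.sym (ι.*-homo c (c K.^ n)))

  ι-fixed : ∀ c → ι c L.^ q L.≈ ι c
  ι-fixed c = L.trans (ι-^ c q) (ι.⟦⟧-cong (K.x^Q≈x c))

  -- Pigeonhole: the injective image of `ι` already supplies q roots of x^q = x, and by
  -- `fixed-index` there is room for no more.
  fixed⇒image : ∀ x → x L.^ q L.≈ x → ∃[ c ] ι c L.≈ x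
  fixed⇒image x fixed =
    let i , x≈ = fixed-index x fixed
        c , eq = injective⇒surjective index injective i
    in K.el c , L.trans (proj₂ (fixed-index _ (ι-fixed (K.el c)))) (L.trans (L.reflexive (≡.cong (λ j → fixed-value (toℕ j)) eq)) (L.sym x≈))
    where
    index : Fin q → Fin q
    index c = proj₁ (fixed-index _ (ι-fixed (K.el c)))
    injective : ∀ {c c′} → index c ≡ index c′ → c ≡ c′
    injective {c} {c′} eq = K.el-injective (ι.injective (L.trans (proj₂ (fixed-index _ (ι-fixed (K.el c))))
      (L.trans (L.reflexive (≡.cong (λ j → fixed-value (toℕ j)) eq)) (L.sym (proj₂ (fixed-index _ (ι-fixed (K.el c′))))))))

  κ : Carrier
  κ = (q ∸ 1) · 1#

  q≈1+κ : q · 1# ≈ 1# + κ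
  q≈1+κ = ×-congˡ q≡1+[q-1]

  q≈P^e : q · 1# ≈ P ^ e
  q≈P^e = ×1-homo-^ p e

  unit-κ : Unit κ
  unit-κ = unit-pred (trans (+-comm κ 1#) (trans (sym q≈1+κ) q≈P^e)) (ℕ.n≢0⇒n>0 (ℕ.≢-nonZero⁻¹ e))

  -- Z t = ∑ ψ(c t) over all c ∈ 𝔽_q and E t the same sum over c ≠ 0, for a
  -- nontrivial additive character ψ of 𝔽_q composed with the trace.
  Z E : L.Carrier → Carrier
  Z t = P ^ e * if (tr t L.≟ L.0#)
  E t = Z t + - 1#

  Z-cong : ∀ {s t} → tr s L.≈ tr t → Z s ≈ Z t
  Z-cong {s} {t} eq = *-congˡ (if-cong (tr s L.≟ L.0#) (tr t L.≟ L.0#) (L.trans (L.sym eq)) (L.trans eq))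

  E-cong : ∀ {s t} → tr s L.≈ tr t → E s ≈ E t
  E-cong eq = +-congʳ (Z-cong eq)

  Z-0 : ∀ {t} → tr t L.≈ L.0# → Z t ≈ P ^ e
  Z-0 {t} eq = trans (*-congˡ (if-yes (tr t L.≟ L.0#) eq)) (*-identityʳ _)

  Z-≉0 : ∀ {t} → ¬ tr t L.≈ L.0# → Z t ≈ 0#
  Z-≉0 {t} neq = trans (*-congˡ (if-no (tr t L.≟ L.0#) neq)) (zeroʳ _)

  E-0 : ∀ {t} → tr t L.≈ L.0# → E t ≈ κ
  E-0 eq = begin
    Z _ + - 1#  ≈⟨ +-congʳ (trans (Z-0 eq) (trans (sym q≈P^e) (trans q≈1+κ (+-comm 1# κ)))) ⟩
    κ + 1# + - 1#  ≈⟨ +-assoc κ 1# (- 1#) ⟩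
    κ + (1# + - 1#)  ≈⟨ trans (+-congˡ (-‿inverseʳ 1#)) (+-identityʳ κ) ⟩
    κ  ∎

  tr-neg : ∀ x → tr (L.- x) L.≈ L.- tr x
  tr-neg x = L.+-cancelʳ (tr x) _ _ (L.trans (L.sym (tr-+ _ _)) (L.trans (tr-0 (L.-‿inverseˡ x)) (L.sym (L.-‿inverseˡ (tr x)))))

  tr-- : ∀ x y → tr (x L.- y) L.≈ tr x L.- tr y
  tr-- x y = L.trans (tr-+ x (L.- y)) (L.+-congˡ (tr-neg y))

  shift : L.Carrier → L.Carrier → Fin q → L.Carrier
  shift s t c = s L.- ι (K.el c) L.* t

  tr-shift : ∀ s t c → tr (shift s t c) L.≈ tr s L.- ι (K.el c) L.* tr t
  tr-shift s t c = L.trans (tr-- s _) (L.+-congˡ (L.-‿cong (tr-scale t (ι-fixed (K.el c)))))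

  -- Takes the place of character orthogonality. If tr t = 0, the summand does not depend on c.
  -- Otherwise the trace of s - c t vanishes for exactly one c, and the sum is q - q = 0.
  ∑-E-shift : ∀ s t → ∑ (λ c → E (shift s t c)) ≈ Z t * E s
  ∑-E-shift s t with tr t L.≟ L.0#
  ... | yes tr≈0 = begin
    ∑ (λ c → E (shift s t c))  ≈⟨ ∑-cong (λ c → E-cong (invariant c)) ⟩
    ∑ {q} (λ _ → E s)  ≈⟨ ∑-const q (E s) ⟩
    (q · 1#) * E s  ≈⟨ *-congʳ (trans q≈P^e (sym (*-identityʳ _))) ⟩
    P ^ e * 1# * E s  ∎
    where
    invariant : ∀ c → tr (shift s t c) L.≈ tr s
    invariant c = L.trans (tr-shift s t c) (L.trans (L.+-congˡ (L.trans (L.-‿cong (L.trans (L.*-congˡ tr≈0) (L.zeroʳ _))) L.-0#≈0#)) (L.+-identityʳ _))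
  ... | no tr≉0 = begin
    ∑ (λ c → E (shift s t c))  ≈⟨ ∑-distrib-+ _ _ ⟩
    ∑ (λ c → Z (shift s t c)) + ∑ {q} (λ _ → - 1#)  ≈⟨ +-cong single (trans (∑-const q (- 1#)) (trans (*-comm _ _) (trans (-1*x≈-x _) (-‿cong q≈P^e)))) ⟩
    P ^ e + - P ^ e  ≈⟨ -‿inverseʳ _ ⟩
    0#  ≈⟨ trans (*-congʳ (zeroʳ (P ^ e))) (zeroˡ _) ⟨
    P ^ e * 0# * E s  ∎
    where
    v = proj₁ (L.invertible (tr t) tr≉0)
    tr*v : tr t L.* v L.≈ L.1#
    tr*v = proj₂ (L.invertible (tr t) tr≉0)
    v-fixed : v L.^ q L.≈ v
    v-fixed = L.begin
      v L.^ q  L.≈⟨ L.*-identityˡ _ ⟨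
      L.1# L.* v L.^ q  L.≈⟨ L.*-congʳ tr*v ⟨
      tr t L.* v L.* v L.^ q  L.≈⟨ L.*-congʳ (L.*-comm _ _) ⟩
      v L.* tr t L.* v L.^ q  L.≈⟨ L.*-assoc _ _ _ ⟩
      v L.* (tr t L.* v L.^ q)  L.≈⟨ L.*-congˡ (L.*-congʳ (tr-fixed t)) ⟨
      v L.* (tr t L.^ q L.* v L.^ q)  L.≈⟨ L.*-congˡ (L.^-distrib-* (tr t) v q) ⟨
      v L.* (tr t L.* v) L.^ q  L.≈⟨ L.*-congˡ (L.trans (L.^-congˡ q tr*v) (L.1^ q)) ⟩
      v L.* L.1#  L.≈⟨ L.*-identityʳ v ⟩
      v  L.∎
    -- The one zero of the trace is at c = tr s / tr t, which lies in the subfield because both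
    -- traces are fixed by the q-th power.
    ratio : ∃[ c ] ι c L.≈ tr s L.* v
    ratio = fixed⇒image (tr s L.* v) (L.trans (L.^-distrib-* (tr s) v q) (L.*-cong (tr-fixed s) v-fixed))
    c₀ = proj₁ ratio
    cancel : ∀ x → x L.* v L.* tr t L.≈ x
    cancel x = L.trans (L.*-assoc _ _ _) (L.trans (L.*-congˡ (L.trans (L.*-comm _ _) tr*v)) (L.*-identityʳ x))
    at : tr (shift s t (K.ix c₀)) L.≈ L.0#
    at = L.begin
      tr (shift s t (K.ix c₀))  L.≈⟨ tr-shift s t _ ⟩
      tr s L.- ι (K.el (K.ix c₀)) L.* tr t  L.≈⟨ L.+-congˡ (L.-‿cong (L.*-congʳ (L.trans (ι.⟦⟧-cong (K.el-ix c₀)) (proj₂ ratio)))) ⟩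
      tr s L.- tr s L.* v L.* tr t  L.≈⟨ L.+-congˡ (L.-‿cong (cancel (tr s))) ⟩
      tr s L.- tr s  L.≈⟨ L.-‿inverseʳ _ ⟩
      L.0#  L.∎
    away : ∀ c → c ≢ K.ix c₀ → Z (shift s t c) ≈ 0#
    away c c≢ = Z-≉0 λ eq → c≢ (K.el-injective (K.trans (ι.injective (L.begin
      ι (K.el c)  L.≈⟨ L.trans (L.*-assoc _ _ _) (L.trans (L.*-congˡ tr*v) (L.*-identityʳ _)) ⟨
      ι (K.el c) L.* tr t L.* v  L.≈⟨ L.*-congʳ (L.+-cancelʳ (L.- (ι (K.el c) L.* tr t)) _ _ (L.trans (L.-‿inverseʳ _) (L.sym (L.trans (L.sym (tr-shift s t c)) eq)))) ⟩
      tr s L.* v  L.≈⟨ proj₂ ratio ⟨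
      ι c₀  L.∎)) (K.sym (K.el-ix c₀))))
    single : ∑ (λ c → Z (shift s t c)) ≈ P ^ e
    single = trans (∑-single _ (K.ix c₀) away) (Z-0 at)

  dot : (Fin k → L.Carrier) → (Fin k → L.Carrier) → L.Carrier
  dot x y = L.∑ λ i → x i L.* y i

  dot-congˡ : ∀ {x x′} y → (∀ i → x i L.≈ x′ i) → dot x y L.≈ dot x′ y
  dot-congˡ y eq = L.∑-cong λ i → L.*-congʳ (eq i)

  E-resp : ∀ {s t} → s L.≈ t → E s ≈ E t
  E-resp s≈t = E-cong (tr-cong s≈t)

  Z-resp : ∀ {s t} → s L.≈ t → Z s ≈ Z t
  Z-resp s≈t = Z-cong (tr-cong s≈t)

  ∑-E-zero : ∀ {y} → (∀ i → y i L.≈ L.0#) → ∑ᵛ k (λ x → E (dot (pt x) y)) ≈ (Q · 1#) ^ k * κ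
  ∑-E-zero {y} y≈0 = trans (∑ᵛ-cong k λ x → E-0 (tr-0 (L.∑-0 λ i → L.trans (L.*-congˡ (y≈0 i)) (L.zeroʳ _)))) (∑ᵛ-const k κ)

  dot-shift : ∀ x v y c → dot (λ i → x i L.- c L.* v i) y L.≈ dot x y L.- c L.* dot v y
  dot-shift x v y c = L.begin
    L.∑ (λ i → (x i L.- c L.* v i) L.* y i)  L.≈⟨ L.∑-cong (λ i → expand (x i) (v i) (y i)) ⟩
    L.∑ (λ i → x i L.* y i L.+ L.- c L.* (v i L.* y i))  L.≈⟨ L.∑-distrib-+ _ _ ⟩
    dot x y L.+ L.∑ (λ i → L.- c L.* (v i L.* y i))  L.≈⟨ L.+-congˡ (L.*-distribˡ-∑ _ _) ⟨
    dot x y L.+ L.- c L.* dot v y  L.≈⟨ L.+-congˡ (L.-‿distribˡ-* c _) ⟨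
    dot x y L.- c L.* dot v y  L.∎
    where
    expand : ∀ a b y → (a L.- c L.* b) L.* y L.≈ a L.* y L.+ L.- c L.* (b L.* y)
    expand a b y = L.trans (L.distribʳ _ _ _) (L.+-congˡ (L.trans (L.*-congʳ (L.-‿distribˡ-* c b)) (L.*-assoc _ _ _)))

  separate : ∀ {y : Fin k → L.Carrier} i → ¬ y i L.≈ L.0# → ∃[ v ] ¬ tr (dot v y) L.≈ L.0#
  separate {y} i yi≉0 = v , λ eq → proj₂ tr-nondegenerate (L.trans (tr-cong (L.sym dot≈)) eq)
    where
    x₀ = proj₁ tr-nondegenerate
    u = proj₁ (L.invertible (y i) yi≉0)
    v : Fin k → L.Carrier
    v j with j Fin.≟ i
    ... | yes _ = x₀ L.* u
    ... | no _  = L.0#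
    v-i : v i L.≈ x₀ L.* u
    v-i with i Fin.≟ i
    ... | yes _ = L.refl
    ... | no i≢i = contradiction ≡.refl i≢i
    v-away : ∀ j → j ≢ i → v j L.≈ L.0#
    v-away j j≢i with j Fin.≟ i
    ... | yes j≡i = contradiction j≡i j≢i
    ... | no _ = L.refl
    dot≈ : dot v y L.≈ x₀
    dot≈ = L.trans (L.∑-single _ i λ j j≢i → L.trans (L.*-congʳ (v-away j j≢i)) (L.zeroˡ _))
      (L.trans (L.*-congʳ v-i) (L.trans (L.*-assoc _ _ _) (L.trans (L.*-congˡ (L.trans (L.*-comm _ _) (proj₂ (L.invertible (y i) yi≉0)))) (L.*-identityʳ x₀))))

  -- Translating x by c v does not change the sum. Adding up the translates over all c gives q times
  -- the sum, and each inner sum over c vanishes by `∑-E-shift` because v · y has nonzero trace.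
  ∑-E-nonzero : ∀ {y} i → ¬ y i L.≈ L.0# → ∑ᵛ k (λ x → E (dot (pt x) y)) ≈ 0#
  ∑-E-nonzero {y} i yi≉0 = noZeroDivisors (q · 1#) X (λ eq → P^≉0 e (trans (sym q≈P^e) eq)) (begin
    (q · 1#) * X  ≈⟨ ∑-const q X ⟨
    ∑ {q} (λ _ → X)  ≈⟨ ∑-cong shifted ⟩
    ∑ (λ c → ∑ᵛ k λ x → E (shift (dot (pt x) y) (dot v y) c))  ≈⟨ ∑-∑ᵛ-comm k _ ⟩
    ∑ᵛ k (λ x → ∑ λ c → E (shift (dot (pt x) y) (dot v y) c))  ≈⟨ ∑ᵛ-0 k (λ x → trans (∑-E-shift _ _) (trans (*-congʳ (Z-≉0 tr≉0)) (zeroˡ _))) ⟩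
    0#  ∎)
    where
    X = ∑ᵛ k λ x → E (dot (pt x) y)
    v = proj₁ (separate {y} i yi≉0)
    tr≉0 = proj₂ (separate {y} i yi≉0)
    shifted : ∀ c → X ≈ ∑ᵛ k λ x → E (shift (dot (pt x) y) (dot v y) c)
    shifted c = trans (∑ᵛ-permute k _ (λ j → L.translate (ι (K.el c) L.* v j))) (∑ᵛ-cong k λ x → E-resp (L.trans
      (dot-congˡ y λ j → L.trans (L.reflexive (≡.cong L.el (Vec.lookup∘tabulate _ j))) (L.el-ix _)) (dot-shift (pt x) v y (ι (K.el c)))))

  coeffE coeffZ : Point → Carrier
  coeffE = coeffΣ E E-resp
  coeffZ = coeffΣ Z Z-resp

  coeff-1 : ∀ r i → ex r i ≢ 0 → coeff (λ _ → 1#) r ≈ 0#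
  coeff-1 r i r≢0 = trans (coeff-cong r λ x → sym (∏-1 λ _ → refl)) (coeff-mono-≢ {λ _ → 0} r (λ _ → z≤n) i r≢0)

  -- The two functions differ by a constant, which only the exponent 0 sees. `E` suits correlations,
  -- while `Z` shows its factor p^e.
  coeffE≈Z : ∀ r i → ex r i ≢ 0 → coeffE r ≈ coeffZ r
  coeffE≈Z r i r≢0 = begin
    coeffE r  ≈⟨ coeff-+ _ _ r ⟩
    coeffZ r + coeff (λ _ → - 1#) r  ≈⟨ +-congˡ (trans (coeff-cong r λ _ → sym (*-identityʳ _)) (coeff-* (- 1#) (λ _ → 1#) r)) ⟩
    coeffZ r + - 1# * coeff (λ _ → 1#) r  ≈⟨ +-congˡ (trans (*-congˡ (coeff-1 r i r≢0)) (zeroʳ _)) ⟩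
    coeffZ r + 0#  ≈⟨ +-identityʳ _ ⟩
    coeffZ r  ∎

  T-fixed : ∀ c → ¬ c K.≈ K.0# → T (ι c) ^ (q ∸ 1) ≈ 1#
  T-fixed c c≉0 = trans (sym (T-^ (ι c) (q ∸ 1))) (trans (T-cong (L.trans (ι-^ c (q ∸ 1)) (L.trans (ι.⟦⟧-cong (K.fermat c c≉0)) ι.1#-homo))) T-1)

  ι-nonzero : ∀ {c} → ¬ c K.≈ K.0# → ¬ ι c L.≈ L.0#
  ι-nonzero c≉0 eq = c≉0 (ι.injective (L.trans eq (L.sym ι.0#-homo)))

  T-fixed-∏ : ∀ c (r : Fin k → ℕ) → ¬ c K.≈ K.0# → (q ∸ 1) ℕ∣.∣ ∑ℕ r → ∏ (λ i → T (ι c) ^ r i) ≈ 1#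
  T-fixed-∏ c r c≉0 (ℕ∣.divides b eq) = begin
    ∏ (λ i → T (ι c) ^ r i)  ≈⟨ ∏-^ (T (ι c)) r ⟩
    T (ι c) ^ ∑ℕ r  ≡⟨ ≡.cong (T (ι c) ^_) (≡.trans eq (ℕ.*-comm b (q ∸ 1))) ⟩
    T (ι c) ^ ((q ∸ 1) ℕ.* b)  ≈⟨ ^-assocʳ (T (ι c)) (q ∸ 1) b ⟨
    (T (ι c) ^ (q ∸ 1)) ^ b  ≈⟨ trans (^-congˡ b (T-fixed c c≉0)) (1^ b) ⟩
    1#  ∎

  -- Scaling by c multiplies `W r` by T(c)^(-|r|), and T(c) is a (q - 1)-st root of unity; this is
  -- how the divisibility of |r| enters the product formula.
  W-scale : ∀ c {r} y → (∀ i → r i ≤ N) → ¬ c K.≈ K.0# → (q ∸ 1) ℕ∣.∣ ∑ℕ r → W r (λ i → ι c L.* y i) ≈ W r y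
  W-scale c {r} y r≤N c≉0 div = begin
    W r (λ i → ι c L.* y i)  ≈⟨ trans (*-congˡ (T-fixed-∏ c r c≉0 div)) (*-identityʳ _) ⟨
    W r (λ i → ι c L.* y i) * ∏ (λ i → T (ι c) ^ r i)  ≈⟨ ∏-distrib-* _ _ ⟨
    ∏ (λ i → w (r i) (ι c L.* y i) * T (ι c) ^ r i)  ≈⟨ ∏-cong (λ i → w-scale (ι c) (y i) (r≤N i) (ι-nonzero c≉0)) ⟩
    W r y  ∎

  -- Product formula for coefficients at dual exponents

  module _ (r s : Point) (s-dual : ∀ i → ex s i ≡ dual (ex r i)) (q-1∣r : (q ∸ 1) ℕ∣.∣ ∑ℕ (ex r)) (i₀ : Fin k) where

    private
      s≢0 : ex s i₀ ≢ 0
      s≢0 eq = ℕ.>⇒≢ (0<dual (ex≤N r i₀)) (≡.trans (≡.sym (s-dual i₀)) eq)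

      C Y X : Carrier
      C = (Q · 1#) ^ k * κ
      Y = ∑ᵛ k λ z → W (ex r) (pt z) * W (ex s) (pt z)
      -- Evaluated twice: `spectral` expands both factors in monomials, `direct` collapses the sum
      -- through correlations. One factor carries `Z` because `∑-E-shift` concerns a product of `Z`
      -- and `E`; at s, which is not 0, both have the same coefficient.
      X = ∑ᵛ k λ x → coeff (λ y → E (dot (pt y) (pt x))) r * coeff (λ z → Z (dot (pt z) (pt x))) s

      spectral : X ≈ coeffE r * coeffZ s * η ^ k
      spectral = begin
        X
          ≈⟨ ∑ᵛ-cong k (λ x → *-cong (coeff-form E E-resp r (pt x)) (coeff-form Z Z-resp s (pt x))) ⟩
        ∑ᵛ k (λ x → coeffE r * mono (ex r) (pt x) * (coeffZ s * mono (ex s) (pt x)))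
          ≈⟨ ∑ᵛ-cong k (λ x → trans (solve 4 (λ a m b n → a :* m :* (b :* n) := a :* b :* (m :* n)) refl (coeffE r) (mono (ex r) (pt x)) (coeffZ s) (mono (ex s) (pt x)))
                                    (*-congˡ (mono-+ (ex r) (ex s) (pt x)))) ⟩
        ∑ᵛ k (λ x → coeffE r * coeffZ s * mono (λ i → ex r i ℕ.+ ex s i) (pt x))
          ≈⟨ *-distribˡ-∑ᵛ k _ _ ⟨
        coeffE r * coeffZ s * ∑ᵛ k (λ x → mono (λ i → ex r i ℕ.+ ex s i) (pt x))
          ≈⟨ *-congˡ (∑-points λ i y → T y ^ (ex r i ℕ.+ ex s i)) ⟩
        coeffE r * coeffZ s * ∏ (λ i → σ (ex r i ℕ.+ ex s i))
          ≈⟨ *-congˡ (trans (∏-cong λ i → trans (reflexive (≡.cong (λ j → σ (ex r i ℕ.+ j)) (s-dual i))) (σ-dual (ex≤N r i))) (∏-replicate k η)) ⟩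
        coeffE r * coeffZ s * η ^ k ∎

      scaled : K.Carrier → Point → Fin k → L.Carrier
      scaled c z i = ι c L.* pt z i

      -- `∑-E-shift` read from right to left; by bilinearity the shifted argument is the single
      -- product of x with y - c z.
      correlation : ∀ y z → ∑ᵛ k (λ x → E (dot (pt y) (pt x)) * Z (dot (pt z) (pt x))) ≈
                    ∑ λ c → ∑ᵛ k λ x → E (dot (pt x) (λ i → pt y i L.- scaled (K.el c) z i))
      correlation y z = begin
        ∑ᵛ k (λ x → E (dot (pt y) (pt x)) * Z (dot (pt z) (pt x)))
          ≈⟨ ∑ᵛ-cong k (λ x → trans (*-comm _ _) (sym (∑-E-shift _ _))) ⟩
        ∑ᵛ k (λ x → ∑ λ c → E (shift (dot (pt y) (pt x)) (dot (pt z) (pt x)) c))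
          ≈⟨ ∑-∑ᵛ-comm k _ ⟨
        ∑ (λ c → ∑ᵛ k λ x → E (shift (dot (pt y) (pt x)) (dot (pt z) (pt x)) c))
          ≈⟨ ∑-cong (λ c → ∑ᵛ-cong k λ x → E-resp (L.trans (L.sym (dot-shift (pt y) (pt z) (pt x) (ι (K.el c)))) (L.∑-cong λ i → L.*-comm _ _))) ⟩
        ∑ (λ c → ∑ᵛ k λ x → E (dot (pt x) (λ i → pt y i L.- scaled (K.el c) z i))) ∎

      -- By `∑-E-zero` and `∑-E-nonzero` the inner sum is `C` at y = c z and zero elsewhere.
      select : ∀ c z → ∑ᵛ k (λ y → W (ex r) (pt y) * ∑ᵛ k λ x → E (dot (pt x) (λ i → pt y i L.- scaled c z i))) ≈ W (ex r) (scaled c z) * C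
      select c z = trans (∑ᵛ-single k _ cz away) (*-cong (W-cong (ex r) pt-cz)
          (∑-E-zero λ i → L.trans (L.+-congʳ (pt-cz i)) (L.-‿inverseʳ _)))
        where
        cz : Point
        cz = tabulate λ i → L.ix (scaled c z i)
        pt-cz : ∀ i → pt cz i L.≈ scaled c z i
        pt-cz i = L.trans (L.reflexive (≡.cong L.el (Vec.lookup∘tabulate _ i))) (L.el-ix _)
        away : ∀ y → y ≢ cz → W (ex r) (pt y) * (∑ᵛ k λ x → E (dot (pt x) (λ i → pt y i L.- scaled c z i))) ≈ 0#
        away y y≢cz with i , neq ← differ y cz y≢cz = trans (*-congˡ (∑-E-nonzero i λ eq →
          neq (L.el-injective (L.trans (L.+-cancelʳ (L.- scaled c z i) _ _ (L.trans eq (L.sym (L.-‿inverseʳ _)))) (L.sym (pt-cz i)))))) (zeroʳ _)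

      Y-scaled : Fin q → Carrier
      Y-scaled c = ∑ᵛ k λ z → W (ex r) (scaled (K.el c) z) * W (ex s) (pt z)

      Y-scaled-0 : Y-scaled (K.ix K.0#) ≈ 0#
      Y-scaled-0 = begin
        ∑ᵛ k (λ z → W (ex r) (scaled (K.el (K.ix K.0#)) z) * W (ex s) (pt z))
          ≈⟨ ∑ᵛ-cong k (λ z → *-congʳ (W-cong (ex r) λ i → L.trans (L.*-congʳ (L.trans (ι.⟦⟧-cong (K.el-ix K.0#)) ι.0#-homo)) (L.zeroˡ _))) ⟩
        ∑ᵛ k (λ z → W (ex r) (λ _ → L.0#) * W (ex s) (pt z))
          ≈⟨ *-distribˡ-∑ᵛ k _ _ ⟨
        W (ex r) (λ _ → L.0#) * ∑ᵛ k (λ z → W (ex s) (pt z))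
          ≈⟨ *-congˡ (trans (∑ᵛ-cong k λ z → sym (*-identityˡ _)) (coeff-1 s i₀ s≢0)) ⟩
        W (ex r) (λ _ → L.0#) * 0#
          ≈⟨ zeroʳ _ ⟩
        0# ∎

      Y-scaled-≉0 : ∀ c → c ≢ K.ix K.0# → Y-scaled c ≈ Y
      Y-scaled-≉0 c c≢0 = ∑ᵛ-cong k λ z → *-congʳ (W-scale (K.el c) (pt z) (ex≤N r)
        (λ eq → c≢0 (≡.trans (≡.sym (K.ix-el c)) (K.ix-cong eq))) q-1∣r)

      -- The term c = 0 vanishes because s is not 0, and the q - 1 others equal `Y`. Adding one more
      -- `Y` at c = 0 makes the sum constant.
      ∑-Y-scaled : ∑ Y-scaled ≈ κ * Y
      ∑-Y-scaled = +-cancelʳ Y _ _ (begin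
        ∑ Y-scaled + Y
          ≈⟨ +-congˡ (trans (sym (*-identityˡ Y)) (*-congʳ (sym (if-yes (K.ix K.0# Fin.≟ K.ix K.0#) ≡.refl)))) ⟩
        ∑ Y-scaled + if (K.ix K.0# Fin.≟ K.ix K.0#) * Y
          ≈⟨ +-congˡ (∑-single (λ c → if (c Fin.≟ K.ix K.0#) * Y) (K.ix K.0#) (λ c c≢0 → trans (*-congʳ (if-no (c Fin.≟ K.ix K.0#) c≢0)) (zeroˡ Y))) ⟨
        ∑ Y-scaled + ∑ (λ c → if (c Fin.≟ K.ix K.0#) * Y)
          ≈⟨ ∑-distrib-+ _ _ ⟨
        ∑ (λ c → Y-scaled c + if (c Fin.≟ K.ix K.0#) * Y)
          ≈⟨ ∑-cong constant ⟩
        ∑ {q} (λ _ → Y)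
          ≈⟨ ∑-const q Y ⟩
        (q · 1#) * Y
          ≈⟨ *-congʳ q≈1+κ ⟩
        (1# + κ) * Y
          ≈⟨ solve 2 (λ κ Y → (con 1 :+ κ) :* Y := κ :* Y :+ Y) refl κ Y ⟩
        κ * Y + Y ∎)
        where
        constant : ∀ c → Y-scaled c + if (c Fin.≟ K.ix K.0#) * Y ≈ Y
        constant c with c Fin.≟ K.ix K.0#
        ... | yes ≡.refl = trans (+-cong Y-scaled-0 (*-identityˡ Y)) (+-identityˡ Y)
        ... | no c≢0     = trans (+-cong (Y-scaled-≉0 c c≢0) (zeroˡ Y)) (+-identityʳ Y)

      direct : X ≈ C * (κ * Y)
      direct = begin
        X
          ≈⟨ ∑ᵛ-cong k (λ x → trans (*-distribʳ-∑ᵛ k _ _) (∑ᵛ-cong k λ y → *-distribˡ-∑ᵛ k _ _)) ⟩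
        ∑ᵛ k (λ x → ∑ᵛ k λ y → ∑ᵛ k λ z → E (dot (pt y) (pt x)) * W (ex r) (pt y) * (Z (dot (pt z) (pt x)) * W (ex s) (pt z)))
          ≈⟨ trans (∑ᵛ-comm k k _) (∑ᵛ-cong k λ y → ∑ᵛ-comm k k _) ⟩
        ∑ᵛ k (λ y → ∑ᵛ k λ z → ∑ᵛ k λ x → E (dot (pt y) (pt x)) * W (ex r) (pt y) * (Z (dot (pt z) (pt x)) * W (ex s) (pt z)))
          ≈⟨ ∑ᵛ-comm k k _ ⟩
        ∑ᵛ k (λ z → ∑ᵛ k λ y → ∑ᵛ k λ x → E (dot (pt y) (pt x)) * W (ex r) (pt y) * (Z (dot (pt z) (pt x)) * W (ex s) (pt z)))
          ≈⟨ ∑ᵛ-cong k (λ z → ∑ᵛ-cong k λ y → trans (∑ᵛ-cong k λ x →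
               solve 4 (λ a b c d → a :* b :* (c :* d) := d :* (b :* (a :* c))) refl (E (dot (pt y) (pt x))) (W (ex r) (pt y)) (Z (dot (pt z) (pt x))) (W (ex s) (pt z)))
               (sym (trans (*-congˡ (*-distribˡ-∑ᵛ k _ _)) (*-distribˡ-∑ᵛ k _ _)))) ⟩
        ∑ᵛ k (λ z → ∑ᵛ k λ y → W (ex s) (pt z) * (W (ex r) (pt y) * ∑ᵛ k λ x → E (dot (pt y) (pt x)) * Z (dot (pt z) (pt x))))
          ≈⟨ ∑ᵛ-cong k (λ z → trans (sym (*-distribˡ-∑ᵛ k _ _)) (*-congˡ (inner z))) ⟩
        ∑ᵛ k (λ z → W (ex s) (pt z) * ∑ λ c → W (ex r) (scaled (K.el c) z) * C)
          ≈⟨ ∑ᵛ-cong k (λ z → trans (*-distribˡ-∑ _ _) (∑-cong λ c →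
               solve 3 (λ s r c → s :* (r :* c) := c :* (r :* s)) refl (W (ex s) (pt z)) (W (ex r) (scaled (K.el c) z)) C)) ⟩
        ∑ᵛ k (λ z → ∑ λ c → C * (W (ex r) (scaled (K.el c) z) * W (ex s) (pt z)))
          ≈⟨ ∑-∑ᵛ-comm k _ ⟨
        ∑ (λ c → ∑ᵛ k λ z → C * (W (ex r) (scaled (K.el c) z) * W (ex s) (pt z)))
          ≈⟨ ∑-cong (λ c → *-distribˡ-∑ᵛ k C _) ⟨
        ∑ (λ c → C * Y-scaled c)
          ≈⟨ *-distribˡ-∑ C _ ⟨
        C * ∑ Y-scaled
          ≈⟨ *-congˡ ∑-Y-scaled ⟩
        C * (κ * Y) ∎
        where
        inner : ∀ z → ∑ᵛ k (λ y → W (ex r) (pt y) * ∑ᵛ k λ x → E (dot (pt y) (pt x)) * Z (dot (pt z) (pt x))) ≈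
                      ∑ λ c → W (ex r) (scaled (K.el c) z) * C
        inner z = begin
          ∑ᵛ k (λ y → W (ex r) (pt y) * ∑ᵛ k λ x → E (dot (pt y) (pt x)) * Z (dot (pt z) (pt x)))
            ≈⟨ ∑ᵛ-cong k (λ y → trans (*-congˡ (correlation y z)) (*-distribˡ-∑ _ _)) ⟩
          ∑ᵛ k (λ y → ∑ λ c → W (ex r) (pt y) * ∑ᵛ k λ x → E (dot (pt x) (λ i → pt y i L.- scaled (K.el c) z i)))
            ≈⟨ ∑-∑ᵛ-comm k _ ⟨
          ∑ (λ c → ∑ᵛ k λ y → W (ex r) (pt y) * ∑ᵛ k λ x → E (dot (pt x) (λ i → pt y i L.- scaled (K.el c) z i)))
            ≈⟨ ∑-cong (λ c → select (K.el c) z) ⟩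
          ∑ (λ c → W (ex r) (scaled (K.el c) z) * C) ∎

    -- Everything on the right has known valuation: Q^k is a power of p, κ is a unit, and `pairing`
    -- treats each factor of the product.
    duality : coeffE r * coeffZ s * η ^ k ≈
              (Q · 1#) ^ k * κ * (κ * ∏ λ i → ∑ λ a → w (ex r i) (L.el a) * w (dual (ex r i)) (L.el a))
    duality = trans (sym spectral) (trans direct (*-congˡ (*-congˡ (begin
      Y
        ≈⟨ ∑ᵛ-cong k (λ z → ∏-distrib-* _ _) ⟨
      ∑ᵛ k (λ z → ∏ λ i → w (ex r i) (pt z i) * w (ex s i) (pt z i))
        ≈⟨ ∑-points (λ i y → w (ex r i) y * w (ex s i) y) ⟩
      ∏ (λ i → ∑ λ a → w (ex r i) (L.el a) * w (ex s i) (L.el a))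
        ≈⟨ ∏-cong (λ i → ∑-cong λ a → *-congˡ (reflexive (≡.cong (λ j → w j (L.el a)) (s-dual i)))) ⟩
      ∏ (λ i → ∑ λ a → w (ex r i) (L.el a) * w (dual (ex r i)) (L.el a)) ∎))))

  -- Lower bound for the coefficients

  open DigitSums p-prime
  open Frobenius commutativeRing p-prime using (binomial; term-0; term-p; p∣term; lift-1) renaming (term to binomialTerm)

  S∑ : (Fin k → ℕ) → ℕ
  S∑ s = ∑ℕ λ i → S (s i)

  -- Functions on the points that are combinations of monomials T^s with
  -- coefficients of p-adic valuation a ≥ (∑ S(sᵢ) − v) / (p − 1).
  data 𝓜 (v : ℕ) (h : Point → Carrier) : Set (c₃ ⊔ ℓ₃) where
    term : ∀ c a s → S∑ s ≤ v ℕ.+ (p ∸ 1) ℕ.* a → (∀ x → h x ≈ c * (P ^ a * mono s (pt x))) → 𝓜 v h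
    plus : ∀ {h₁ h₂} → 𝓜 v h₁ → 𝓜 v h₂ → (∀ x → h x ≈ h₁ x + h₂ x) → 𝓜 v h

  𝓜-cong : ∀ {v h h′} → (∀ x → h′ x ≈ h x) → 𝓜 v h → 𝓜 v h′
  𝓜-cong eq (term c a s S≤ h≈)  = term c a s S≤ λ x → trans (eq x) (h≈ x)
  𝓜-cong eq (plus h₁ h₂ h≈) = plus h₁ h₂ λ x → trans (eq x) (h≈ x)

  𝓜-≤ : ∀ {v v′ h} → v ≤ v′ → 𝓜 v h → 𝓜 v′ h
  𝓜-≤ v≤v′ (term c a s S≤ h≈)  = term c a s (ℕ.≤-trans S≤ (ℕ.+-monoˡ-≤ _ v≤v′)) h≈
  𝓜-≤ v≤v′ (plus h₁ h₂ h≈) = plus (𝓜-≤ v≤v′ h₁) (𝓜-≤ v≤v′ h₂) h≈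

  𝓜-scale : ∀ {v h} d → 𝓜 v h → 𝓜 v (λ x → d * h x)
  𝓜-scale d (term c a s S≤ h≈)  = term (d * c) a s S≤ λ x → trans (*-congˡ (h≈ x)) (sym (*-assoc d c _))
  𝓜-scale d (plus h₁ h₂ h≈) = plus (𝓜-scale d h₁) (𝓜-scale d h₂) λ x → trans (*-congˡ (h≈ x)) (distribˡ d _ _)

  S∑-0 : S∑ (λ _ → 0) ≡ 0
  S∑-0 = ∑ℕ-0 {k} λ _ → S-0

  𝓜-1 : 𝓜 0 (λ _ → 1#)
  𝓜-1 = term 1# 0 (λ _ → 0) (ℕ.≤-reflexive (≡.trans S∑-0 (≡.sym (ℕ.*-zeroʳ (p ∸ 1)))))
    λ x → sym (trans (*-identityˡ _) (trans (*-identityˡ _) (∏-1 λ _ → refl)))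

  𝓜-0 : ∀ {v h} → (∀ x → h x ≈ 0#) → 𝓜 v h
  𝓜-0 {v} h≈0 = 𝓜-≤ z≤n (𝓜-cong (λ x → trans (h≈0 x) (sym (zeroˡ 1#))) (𝓜-scale 0# 𝓜-1))

  𝓜-∑ : ∀ {v n} (h : Fin n → Point → Carrier) → (∀ i → 𝓜 v (h i)) → 𝓜 v (λ x → ∑ λ i → h i x)
  𝓜-∑ {n = zero}  h hᵢ = 𝓜-0 λ x → ∑-zero
  𝓜-∑ {n = suc n} h hᵢ = plus (hᵢ zero) (𝓜-∑ (h ∘ suc) (hᵢ ∘ suc)) λ x → ∑-suc _

  𝓜-* : ∀ {v v′ h h′} → 𝓜 v h → 𝓜 v′ h′ → 𝓜 (v ℕ.+ v′) (λ x → h x * h′ x)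
  𝓜-* {v} {v′} {h} {h′} (term c a s S≤ h≈) (term c′ a′ s′ S≤′ h≈′) = term (c * c′) (a ℕ.+ a′) (λ i → s i ℕ.+ s′ i)
    (ℕ.≤-trans (∑ℕ-mono-≤ λ i → S-subadditive (s i) (s′ i)) (ℕ.≤-trans (ℕ.≤-reflexive (∑ℕ-+ (S ∘ s) (S ∘ s′)))
      (ℕ.≤-trans (ℕ.+-mono-≤ S≤ S≤′) (ℕ.≤-reflexive (lemma v (p ∸ 1) a v′ a′)))))
    λ x → begin
      h x * h′ x
        ≈⟨ *-cong (h≈ x) (h≈′ x) ⟩
      c * (P ^ a * mono s (pt x)) * (c′ * (P ^ a′ * mono s′ (pt x)))
        ≈⟨ solve 6 (λ c A m c′ A′ m′ → c :* (A :* m) :* (c′ :* (A′ :* m′)) := c :* c′ :* (A :* A′ :* (m :* m′))) refl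
             c (P ^ a) (mono s (pt x)) c′ (P ^ a′) (mono s′ (pt x)) ⟩
      c * c′ * (P ^ a * P ^ a′ * (mono s (pt x) * mono s′ (pt x)))
        ≈⟨ *-congˡ (*-cong (sym (^-homo-* P a a′)) (mono-+ s s′ (pt x))) ⟩
      c * c′ * (P ^ (a ℕ.+ a′) * mono (λ i → s i ℕ.+ s′ i) (pt x)) ∎
    where
    lemma : ∀ v p a v′ a′ → v ℕ.+ p ℕ.* a ℕ.+ (v′ ℕ.+ p ℕ.* a′) ≡ v ℕ.+ v′ ℕ.+ p ℕ.* (a ℕ.+ a′)
    lemma = solve-∀
  𝓜-* h′@(term _ _ _ _ _) (plus h₁ h₂ h≈) = plus (𝓜-* h′ h₁) (𝓜-* h′ h₂) λ x → trans (*-congˡ (h≈ x)) (distribˡ _ _ _)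
  𝓜-* (plus h₁ h₂ h≈) h′ = plus (𝓜-* h₁ h′) (𝓜-* h₂ h′) λ x → trans (*-congʳ (h≈ x)) (distribʳ _ _ _)

  𝓜-^ : ∀ {v h} n → 𝓜 v h → 𝓜 (n ℕ.* v) (λ x → h x ^ n)
  𝓜-^ zero    _  = 𝓜-1
  𝓜-^ (suc n) h′ = 𝓜-* h′ (𝓜-^ n h′)

  𝓜-P : ∀ {v h} → 𝓜 (v ℕ.+ (p ∸ 1)) h → 𝓜 v (λ x → P * h x)
  𝓜-P {v} (term c a s S≤ h≈)  = term c (suc a) s
    (ℕ.≤-trans S≤ (ℕ.≤-reflexive (≡.trans (ℕ.+-assoc v (p ∸ 1) _) (≡.cong (v ℕ.+_) (≡.sym (ℕ.*-suc (p ∸ 1) a))))))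
    λ x → trans (*-congˡ (h≈ x)) (solve 4 (λ P c A m → P :* (c :* (A :* m)) := c :* (P :* A :* m)) refl P c (P ^ a) (mono s (pt x)))
  𝓜-P (plus h₁ h₂ h≈) = plus (𝓜-P h₁) (𝓜-P h₂) λ x → trans (*-congˡ (h≈ x)) (distribˡ P _ _)

  mono-^ : ∀ s y n → mono s y ^ n ≈ mono (λ i → s i ℕ.* n) y
  mono-^ s y zero    = sym (∏-1 λ i → ^-congʳ (T (y i)) (ℕ.*-zeroʳ (s i)))
  mono-^ s y (suc n) = trans (*-congˡ (mono-^ s y n)) (trans (mono-+ s _ y) (∏-cong λ i → ^-congʳ (T (y i)) (≡.sym (ℕ.*-suc (s i) n))))

  -- In (f + g)^p the mixed terms lie in 𝓜 p but carry a factor p, which is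
  -- worth p − 1.
  𝓜-frobenius : ∀ {h} → 𝓜 1 h → 𝓜 1 (λ x → h x ^ p)
  𝓜-frobenius {h} (term c a s S≤ h≈) = term (c ^ p * (P ^ a) ^ (p ∸ 1)) a (λ i → s i ℕ.* p)
    (≡.subst (_≤ 1 ℕ.+ (p ∸ 1) ℕ.* a) (≡.sym (∑ℕ-cong λ i → S-shift (s i))) S≤)
    λ x → begin
      h x ^ p  ≈⟨ ^-congˡ p (h≈ x) ⟩
      (c * (P ^ a * mono s (pt x))) ^ p  ≈⟨ trans (^-distrib-* c _ p) (*-congˡ (^-distrib-* (P ^ a) _ p)) ⟩
      c ^ p * ((P ^ a) ^ p * mono s (pt x) ^ p)  ≈⟨ *-congˡ (*-cong (^-congʳ (P ^ a) (≡.sym (ℕ.suc-pred p))) (mono-^ s (pt x) p)) ⟩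
      c ^ p * (P ^ a * (P ^ a) ^ (p ∸ 1) * mono (λ i → s i ℕ.* p) (pt x))
        ≈⟨ solve 4 (λ c A B m → c :* (A :* B :* m) := c :* B :* (A :* m)) refl (c ^ p) (P ^ a) ((P ^ a) ^ (p ∸ 1)) (mono (λ i → s i ℕ.* p) (pt x)) ⟩
      c ^ p * (P ^ a) ^ (p ∸ 1) * (P ^ a * mono (λ i → s i ℕ.* p) (pt x)) ∎
  𝓜-frobenius {h} (plus {h₁} {h₂} 𝓜₁ 𝓜₂ h≈) =
    𝓜-cong (λ x → trans (^-congˡ p (h≈ x)) (binomial (h₁ x) (h₂ x))) (𝓜-∑ _ each)
    where
    each : ∀ (i : Fin (suc p)) → 𝓜 1 (λ x → binomialTerm (h₁ x) (h₂ x) (toℕ i))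
    each i with toℕ i ℕ.≟ 0 | toℕ i ℕ.≟ p
    ... | yes i≡0 | _       = 𝓜-cong (λ x → trans (reflexive (≡.cong (binomialTerm (h₁ x) (h₂ x)) i≡0)) (term-0 (h₁ x) (h₂ x))) (𝓜-frobenius 𝓜₂)
    ... | no _    | yes i≡p = 𝓜-cong (λ x → trans (reflexive (≡.cong (binomialTerm (h₁ x) (h₂ x)) i≡p)) (term-p (h₁ x) (h₂ x))) (𝓜-frobenius 𝓜₁)
    ... | no i≢0  | no i≢p  = 𝓜-cong (λ x → proj₂ (p∣term (h₁ x) (h₂ x) j 0<j j<p))
          (𝓜-P (𝓜-scale _ (𝓜-≤ (ℕ.≤-reflexive degree) (𝓜-* (𝓜-^ j 𝓜₁) (𝓜-^ (p ∸ j) 𝓜₂)))))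
      where
      j = toℕ i
      0<j = ℕ.n≢0⇒n>0 i≢0
      j<p = ℕ.≤∧≢⇒< (ℕ.s≤s⁻¹ (Fin.toℕ<n i)) i≢p
      degree : j ℕ.* 1 ℕ.+ (p ∸ j) ℕ.* 1 ≡ 1 ℕ.+ (p ∸ 1)
      degree = ≡.trans (≡.cong₂ ℕ._+_ (ℕ.*-identityʳ j) (ℕ.*-identityʳ (p ∸ j))) (≡.trans (ℕ.m+[n∸m]≡n (ℕ.<⇒≤ j<p)) (≡.sym (ℕ.suc-pred p)))

  𝓜-frobenius-^ : ∀ {h} u → 𝓜 1 h → 𝓜 1 (λ x → h x ^ (p ℕ.^ u))
  𝓜-frobenius-^ zero    𝓜h = 𝓜-cong (λ x → *-identityʳ _) 𝓜h
  𝓜-frobenius-^ (suc u) 𝓜h = 𝓜-cong (λ x → sym (^-assocʳ _ p (p ℕ.^ u))) (𝓜-frobenius-^ u (𝓜-frobenius 𝓜h))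

  -- p^n - 1 = (p - 1)(1 + p + ... + p^(n-1)), so the power is a product of (p - 1) n factors
  -- h^(p^j), each still in `𝓜 1` by `𝓜-frobenius-^`. The bound does not depend on u.
  𝓜-repunit : ∀ {h} u n → 𝓜 1 h → 𝓜 ((p ∸ 1) ℕ.* n) (λ x → h x ^ ((p ℕ.^ n ∸ 1) ℕ.* p ℕ.^ u))
  𝓜-repunit u zero    𝓜h = 𝓜-≤ z≤n 𝓜-1
  𝓜-repunit {h} u (suc n) 𝓜h = 𝓜-cong (λ x → begin
    h x ^ ((p ℕ.^ suc n ∸ 1) ℕ.* p ℕ.^ u)  ≡⟨ ≡.cong (h x ^_) exponent ⟩
    h x ^ (p ℕ.^ (n ℕ.+ u) ℕ.* (p ∸ 1) ℕ.+ (p ℕ.^ n ∸ 1) ℕ.* p ℕ.^ u)  ≈⟨ ^-homo-* (h x) (p ℕ.^ (n ℕ.+ u) ℕ.* (p ∸ 1)) _ ⟩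
    h x ^ (p ℕ.^ (n ℕ.+ u) ℕ.* (p ∸ 1)) * h x ^ ((p ℕ.^ n ∸ 1) ℕ.* p ℕ.^ u)  ≈⟨ *-congʳ (^-assocʳ (h x) (p ℕ.^ (n ℕ.+ u)) (p ∸ 1)) ⟨
    (h x ^ (p ℕ.^ (n ℕ.+ u))) ^ (p ∸ 1) * h x ^ ((p ℕ.^ n ∸ 1) ℕ.* p ℕ.^ u)  ∎)
    (𝓜-≤ (ℕ.≤-reflexive (≡.trans (≡.cong (ℕ._+ (p ∸ 1) ℕ.* n) (ℕ.*-identityʳ (p ∸ 1))) (≡.sym (ℕ.*-suc (p ∸ 1) n))))
      (𝓜-* (𝓜-^ (p ∸ 1) (𝓜-frobenius-^ (n ℕ.+ u) 𝓜h)) (𝓜-repunit u n 𝓜h)))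
    where
    exponent : (p ℕ.^ suc n ∸ 1) ℕ.* p ℕ.^ u ≡ p ℕ.^ (n ℕ.+ u) ℕ.* (p ∸ 1) ℕ.+ (p ℕ.^ n ∸ 1) ℕ.* p ℕ.^ u
    exponent = ≡.trans (≡.cong (ℕ._* p ℕ.^ u) p^suc) (≡.trans (lemma (p ∸ 1) (p ℕ.^ n) (p ℕ.^ n ∸ 1) (p ℕ.^ u))
      (≡.cong (λ i → i ℕ.* (p ∸ 1) ℕ.+ (p ℕ.^ n ∸ 1) ℕ.* p ℕ.^ u) (≡.sym (ℕ.^-distribˡ-+-* p n u))))
      where
      lemma : ∀ p a b c → (p ℕ.* a ℕ.+ b) ℕ.* c ≡ a ℕ.* c ℕ.* p ℕ.+ b ℕ.* c
      lemma = solve-∀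
      p^suc : p ℕ.^ suc n ∸ 1 ≡ (p ∸ 1) ℕ.* p ℕ.^ n ℕ.+ (p ℕ.^ n ∸ 1)
      p^suc = ≡.trans (≡.cong (λ i → i ℕ.* p ℕ.^ n ∸ 1) (≡.sym (ℕ.suc-pred p)))
        (≡.trans (≡.cong (_∸ 1) (ℕ.+-comm (p ℕ.^ n) _)) (ℕ.+-∸-assoc ((p ∸ 1) ℕ.* p ℕ.^ n) (ℕ.m^n>0 p n)))

  𝓜-T : ∀ i → 𝓜 1 (λ x → T (pt x i))
  𝓜-T i = term 1# 0 (unit i) (ℕ.≤-trans (ℕ.≤-reflexive (≡.trans (∑ℕ-unit S S-0 i) S-1)) (ℕ.m≤m+n 1 _))
    λ x → sym (trans (*-identityˡ _) (trans (*-identityˡ _) (∏-unit i (λ j → T (pt x j)))))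
    where
    ∏-unit : ∀ {l} (i : Fin l) (y : Fin l → Carrier) → ∏ (λ j → y j ^ unit i j) ≈ y i
    ∏-unit zero    y = trans (∏-suc _) (trans (*-cong (*-identityʳ _) (∏-1 λ _ → refl)) (*-identityʳ _))
    ∏-unit (suc i) y = trans (∏-suc _) (trans (*-identityˡ _) (∏-unit i (y ∘ suc)))

  lifted-trace : Point → Carrier
  lifted-trace x = ∑ λ i → ∑ λ (j : Fin m) → T (pt x i) ^ (q ℕ.^ toℕ j)

  𝓜-lifted-trace : 𝓜 1 lifted-trace
  𝓜-lifted-trace = 𝓜-∑ _ λ i → 𝓜-∑ _ λ j →
    𝓜-cong (λ x → reflexive (≡.cong (T (pt x i) ^_) (q^≡ (toℕ j)))) (𝓜-frobenius-^ (e ℕ.* toℕ j) (𝓜-T i))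

  f : ℕ
  f = e ℕ.* m

  Q≡p^f : Q ≡ p ℕ.^ f
  Q≡p^f = ℕ.^-*-assoc p e m

  opaque
    reduce-exponent : ∀ n → ∃[ r ] r ≤ N × S r ≤ S n × ∀ x → T x ^ n ≈ T x ^ r
    -- Exponent 0 stays apart: as T(0)^0 = 1, it is not interchangeable with `N`.
    reduce-exponent zero    = 0 , z≤n , ℕ.≤-refl , λ x → refl
    reduce-exponent n@(suc _) with r , c , 0<r , r<Q , n≡ , S≤ ← S-reduce f (≡.subst (1 <_) Q≡p^f L.1<Q) n z<s
      = r , ℕ.s≤s⁻¹ (≡.subst (r <_) (≡.trans (≡.sym Q≡p^f) Q≡1+N) r<Q) , S≤ , λ x →
          trans (reflexive (≡.cong (T x ^_) (≡.trans n≡ (≡.cong (λ i → r ℕ.+ c ℕ.* (i ∸ 1)) (≡.sym Q≡p^f))))) (T-periodic-* x r c 0<r)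

  coeff-∣ : ∀ {n h} r → (∀ x → p^ n ∣ h x) → p^ n ∣ coeff h r
  coeff-∣ r d = ∣-∑ᵛ k λ x → ∣-*ʳ _ (d x)

  -- A term c p^a T^s contributes only if its reduced exponent is r. Reduction does not increase
  -- digit sums, so then (p - 1) A ≤ (p - 1)(b + a), and the factors P^b and P^a together supply
  -- P^A.
  𝓜-coeff : ∀ {b h A} r → 𝓜 ((p ∸ 1) ℕ.* b) h → S∑ (ex r) ≡ (p ∸ 1) ℕ.* A → p^ A ∣ P ^ b * coeff h r
  𝓜-coeff {b} {h} {A} r (plus {h₁} {h₂} 𝓜₁ 𝓜₂ h≈) S≡ =
    ∣-cong (trans (sym (distribˡ _ _ _)) (*-congˡ (trans (sym (coeff-+ h₁ h₂ r)) (coeff-cong r λ x → sym (h≈ x)))))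
      (∣-+ (𝓜-coeff r 𝓜₁ S≡) (𝓜-coeff r 𝓜₂ S≡))
  𝓜-coeff {b} {h} {A} r (term c a s S≤ h≈) S≡ = ∣-cong rearrange (∣-*ˡ c divisible)
    where
    s′ : Fin k → ℕ
    s′ i = proj₁ (reduce-exponent (s i))
    s′≤N : ∀ i → s′ i ≤ N
    s′≤N i = proj₁ (proj₂ (reduce-exponent (s i)))
    Ss′≤ : S∑ s′ ≤ S∑ s
    Ss′≤ = ∑ℕ-mono-≤ λ i → proj₁ (proj₂ (proj₂ (reduce-exponent (s i))))
    mono≈ : ∀ y → mono s y ≈ mono s′ y
    mono≈ y = ∏-cong λ i → proj₂ (proj₂ (proj₂ (reduce-exponent (s i)))) (y i)
    coef = coeff (λ x → mono s′ (pt x)) r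
    rearrange : c * (P ^ (b ℕ.+ a) * coef) ≈ P ^ b * coeff h r
    rearrange = begin
      c * (P ^ (b ℕ.+ a) * coef)  ≈⟨ *-congˡ (*-congʳ (^-homo-* P b a)) ⟩
      c * (P ^ b * P ^ a * coef)  ≈⟨ solve 4 (λ c B A x → c :* (B :* A :* x) := B :* (c :* (A :* x))) refl c (P ^ b) (P ^ a) coef ⟩
      P ^ b * (c * (P ^ a * coef))  ≈⟨ *-congˡ (trans (coeff-* c _ r) (*-congˡ (coeff-* (P ^ a) _ r))) ⟨
      P ^ b * coeff (λ x → c * (P ^ a * mono s′ (pt x))) r
        ≈⟨ *-congˡ (coeff-cong r λ x → trans (h≈ x) (*-congˡ (*-congˡ (mono≈ (pt x))))) ⟨
      P ^ b * coeff h r  ∎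
    divisible : p^ A ∣ P ^ (b ℕ.+ a) * coef
    divisible with Fin.any? (λ i → ¬? (ex r i ℕ.≟ s′ i))
    ... | yes (i , neq) = ∣-0 (trans (*-congˡ (coeff-mono-≢ r s′≤N i neq)) (zeroʳ _))
    ... | no none = ∣-≤ A≤ (∣-P^ (b ℕ.+ a) coef)
      where
      r≡s′ : ∀ i → ex r i ≡ s′ i
      r≡s′ i = decidable-stable (ex r i ℕ.≟ s′ i) λ neq → none (i , neq)
      A≤ : A ≤ b ℕ.+ a
      A≤ = ℕ.*-cancelˡ-≤ (p ∸ 1) {{ℕ.>-nonZero (ℕ.m<n⇒0<n∸m 1<p)}} (ℕ.≤-trans (ℕ.≤-reflexive (≡.trans (≡.sym S≡) (∑ℕ-cong λ i → ≡.cong S (r≡s′ i))))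
        (ℕ.≤-trans Ss′≤ (ℕ.≤-trans S≤ (ℕ.≤-reflexive (≡.sym (ℕ.*-distribˡ-+ (p ∸ 1) b a))))))

  tr-∑ : ∀ {n} (y : Fin n → L.Carrier) → tr (L.∑ y) L.≈ L.∑ (λ i → tr (y i))
  tr-∑ {zero}  y = L.trans (tr-0 L.∑-zero) (L.sym L.∑-zero)
  tr-∑ {suc n} y = L.trans (tr-cong (L.∑-suc y)) (L.trans (tr-+ _ _) (L.trans (L.+-congˡ (tr-∑ (y ∘ suc))) (L.sym (L.∑-suc _))))

  ρ-lifted-trace : ∀ x → ρ (lifted-trace x) L.≈ tr (L.∑ (pt x))
  ρ-lifted-trace x = L.trans (ρ-∑ _) (L.trans (L.∑-cong λ i → L.trans (ρ-∑ _) (L.∑-cong λ j →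
    L.trans (ρ-^ _ (q ℕ.^ toℕ j)) (L.^-congˡ (q ℕ.^ toℕ j) (ρT _)))) (L.sym (tr-∑ (pt x))))

  exponent : ℕ → ℕ
  exponent u = (q ∸ 1) ℕ.* p ℕ.^ u

  vanishing : L.Carrier → Carrier
  vanishing t = if (tr t L.≟ L.0#)

  -- The reduction of `lifted-trace` is the trace. If that is 0, the power contains at least u + 1
  -- factors p. If not, its (q - 1)-st power is 1 modulo p, and `lift-1` improves this to p^(u+1).
  1-vanishing≈power : ∀ u x → p^ suc u ∣ vanishing (L.∑ (pt x)) + (lifted-trace x ^ exponent u + - 1#)
  1-vanishing≈power u x with tr (L.∑ (pt x)) L.≟ L.0#
  ... | yes tr≈0 = ∣-cong (begin
      H ^ exponent u  ≈⟨ +-identityʳ _ ⟨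
      H ^ exponent u + 0#  ≈⟨ +-congˡ (-‿inverseˡ 1#) ⟨
      H ^ exponent u + (- 1# + 1#)  ≈⟨ +-assoc _ _ _ ⟨
      H ^ exponent u + - 1# + 1#  ≈⟨ +-comm _ _ ⟩
      1# + (H ^ exponent u + - 1#)  ∎) (∣-≤ large power)
    where
    H = lifted-trace x
    large : suc u ≤ exponent u
    large = ℕ.≤-trans (n<p^n 1<p u) (ℕ.m≤n*m (p ℕ.^ u) (q ∸ 1))
    power : p^ exponent u ∣ H ^ exponent u
    power with y , H≈ ← ρ≈0⇒p∣ H (L.trans (ρ-lifted-trace x) tr≈0) =
      y ^ exponent u , trans (^-congˡ (exponent u) H≈) (^-distrib-* P y (exponent u))
  ... | no tr≉0 = ∣-cong (sym (+-identityˡ _)) (conclude (ρ≈0⇒p∣ (H ^ (q ∸ 1) + - 1#) ρ≈0))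
    where
    H = lifted-trace x
    ρ≈0 : ρ (H ^ (q ∸ 1) + - 1#) L.≈ L.0#
    ρ≈0 = L.trans (ρ-+ _ _) (L.trans (L.+-cong
      (L.trans (ρ-^ H (q ∸ 1)) (L.trans (L.^-congˡ (q ∸ 1) (ρ-lifted-trace x)) (fixed-unit tr≉0 (tr-fixed _))))
      (L.trans (ρ-neg 1#) (L.-‿cong ρ-1))) (L.-‿inverseʳ L.1#))
    conclude : ∃[ y ] H ^ (q ∸ 1) + - 1# ≈ P * y → p^ suc u ∣ H ^ exponent u + - 1#
    conclude (y , eq) with z , eq′ ← lift-1 u y = z , (begin
      H ^ exponent u + - 1#  ≈⟨ +-congʳ (^-assocʳ H (q ∸ 1) (p ℕ.^ u)) ⟨
      (H ^ (q ∸ 1)) ^ (p ℕ.^ u) + - 1#  ≈⟨ +-congʳ (^-congˡ (p ℕ.^ u) H^≈) ⟩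
      (1# + P * y) ^ (p ℕ.^ u) + - 1#  ≈⟨ +-congʳ eq′ ⟩
      1# + P ^ suc u * z + - 1#  ≈⟨ trans (+-congʳ (+-comm _ _)) (+-assoc _ _ _) ⟩
      P ^ suc u * z + (1# + - 1#)  ≈⟨ trans (+-congˡ (-‿inverseʳ 1#)) (+-identityʳ _) ⟩
      P ^ suc u * z  ∎)
      where
      H^≈ : H ^ (q ∸ 1) ≈ 1# + P * y
      H^≈ = begin
        H ^ (q ∸ 1)  ≈⟨ trans (+-congˡ (-‿inverseˡ 1#)) (+-identityʳ _) ⟨
        H ^ (q ∸ 1) + (- 1# + 1#)  ≈⟨ +-assoc _ _ _ ⟨
        H ^ (q ∸ 1) + - 1# + 1#  ≈⟨ trans (+-congʳ eq) (+-comm _ _) ⟩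
        1# + P * y  ∎

  -- Taking u = A makes the approximation error of `1-vanishing≈power` harmless. The remaining power
  -- of `lifted-trace` has degree (p - 1) e by `𝓜-repunit`, and this loss of e is exactly made good
  -- by the factor P^e of `Z`.
  coeffZ-∣ : ∀ {A} r i → ex r i ≢ 0 → S∑ (ex r) ≡ (p ∸ 1) ℕ.* A → p^ A ∣ coeffZ r
  coeffZ-∣ {A} r i r≢0 S≡ = ∣-cong (sym (trans (coeff-* (P ^ e) (λ x → vanishing (L.∑ (pt x))) r)
      (trans (*-congˡ (trans (coeff-cong r split) (coeff-+ D _ r))) (distribˡ _ _ _))))
    (∣-+ (∣-*ˡ (P ^ e) (coeff-∣ r λ x → ∣-≤ (ℕ.n≤1+n A) (1-vanishing≈power A x)))
      (∣-cong (*-congˡ (sym remaining)) (∣-cong (-‿distribʳ-* _ _) (∣-neg (𝓜-coeff r (𝓜-repunit A e 𝓜-lifted-trace) S≡)))))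
    where
    H^ D : Point → Carrier
    H^ x = lifted-trace x ^ exponent A
    D x = vanishing (L.∑ (pt x)) + (H^ x + - 1#)
    split : ∀ x → vanishing (L.∑ (pt x)) ≈ D x + (1# + - 1# * H^ x)
    split x = sym (begin
      v + (h + - 1#) + (1# + - 1# * h)  ≈⟨ solve 4 (λ v h n y → v :+ (h :+ n) :+ (con 1 :+ y) := v :+ ((h :+ y) :+ (n :+ con 1))) refl v h (- 1#) (- 1# * h) ⟩
      v + (h + - 1# * h + (- 1# + 1#))  ≈⟨ +-congˡ (+-cong (trans (+-congˡ (-1*x≈-x h)) (-‿inverseʳ h)) (-‿inverseˡ 1#)) ⟩
      v + (0# + 0#)  ≈⟨ trans (+-congˡ (+-identityʳ 0#)) (+-identityʳ v) ⟩
      v  ∎)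
      where
      v = vanishing (L.∑ (pt x))
      h = H^ x
    remaining : coeff (λ x → 1# + - 1# * H^ x) r ≈ - coeff H^ r
    remaining = trans (coeff-+ _ _ r) (trans (+-cong (coeff-1 r i r≢0) (trans (coeff-* _ _ r) (-1*x≈-x _))) (+-identityˡ _))

  -- Exact valuation of the coefficients

  -- Digit sums keep the residue modulo p - 1, and p - 1 divides q - 1.
  admissible-degree : ∀ r → (q ∸ 1) ℕ∣.∣ ∑ℕ (ex r) → ∃[ A ] S∑ (ex r) ≡ (p ∸ 1) ℕ.* A
  admissible-degree r q-1∣r = ℕ∣.quotient div , ≡.trans (ℕ∣._∣_.equality div) (ℕ.*-comm _ (p ∸ 1))
    where
    c : Fin k → ℕ
    c i = proj₁ (S-congruence (ex r i))
    total : ∑ℕ (ex r) ≡ S∑ (ex r) ℕ.+ (p ∸ 1) ℕ.* ∑ℕ c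
    total = ≡.trans (∑ℕ-cong λ i → proj₂ (S-congruence (ex r i))) (≡.trans (∑ℕ-+ (S ∘ ex r) (λ i → c i ℕ.* (p ∸ 1)))
      (≡.cong (S∑ (ex r) ℕ.+_) (≡.trans (∑ℕ-cong λ i → ℕ.*-comm (c i) (p ∸ 1)) (∑ℕ-* (p ∸ 1) c))))
    p-1∣q-1 : (p ∸ 1) ℕ∣.∣ (q ∸ 1)
    p-1∣q-1 with d , eq ← pred∣pred-^ p e = ℕ∣.divides d eq
    div : (p ∸ 1) ℕ∣.∣ S∑ (ex r)
    div = ℕ∣.∣m+n∣m⇒∣n (≡.subst ((p ∸ 1) ℕ∣.∣_) (≡.trans total (ℕ.+-comm (S∑ (ex r)) _)) (ℕ∣.∣-trans p-1∣q-1 q-1∣r)) (ℕ∣.m∣m*n (∑ℕ c))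

  -- The squeeze: P^A divides the coefficient at r, P^B the one at the dual exponent, and by
  -- `duality` their product is P^(A+B) up to units. The cofactors therefore multiply to a unit, so
  -- each is one.
  coeffE-valuation : ∀ {A} r → (q ∸ 1) ℕ∣.∣ ∑ℕ (ex r) → 0 < ∑ℕ (ex r) → S∑ (ex r) ≡ (p ∸ 1) ℕ.* A →
                           ∃[ u ] Unit u × coeffE r ≈ P ^ A * u
  coeffE-valuation {A} r q-1∣r 0<r S≡ with i₀ , r≢0 ← ∑ℕ-positive (ex r) 0<r =
    conclude i₀ r≢0 (∣-cong (sym (coeffE≈Z r i₀ r≢0)) (coeffZ-∣ r i₀ r≢0 S≡))
    where
    s : Point
    s = tabulate λ i → fromℕ< {dual (ex r i)} (≡.subst (dual (ex r i) <_) (≡.sym Q≡1+N) (s≤s (dual≤N (ex r i))))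
    s-dual : ∀ i → ex s i ≡ dual (ex r i)
    s-dual i = ≡.trans (≡.cong toℕ (Vec.lookup∘tabulate _ i)) (Fin.toℕ-fromℕ< _)
    μ : Fin k → ℕ
    μ i = proj₁ (pairing (ex≤N r i))
    v : Fin k → Carrier
    v i = proj₁ (proj₂ (pairing (ex≤N r i)))
    v-unit : ∀ i → Unit (v i)
    v-unit i = proj₁ (proj₂ (proj₂ (pairing (ex≤N r i))))
    -- The summand `f` accounts for the factor Q^k of `duality`, and μ for the product of pairings.
    M : ℕ
    M = ∑ℕ λ i → f ℕ.+ μ i
    degree : S∑ (ex r) ℕ.+ S∑ (ex s) ≡ (p ∸ 1) ℕ.* M
    degree = ≡.trans (≡.sym (∑ℕ-+ (S ∘ ex r) (S ∘ ex s))) (≡.trans (∑ℕ-cong λ i → ≡.trans (≡.cong (λ j → S (ex r i) ℕ.+ S j) (s-dual i))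
      (proj₁ (proj₂ (proj₂ (proj₂ (pairing (ex≤N r i))))))) (∑ℕ-* (p ∸ 1) (λ i → f ℕ.+ μ i)))
    B : ℕ
    B = M ∸ A
    A≤M : A ≤ M
    A≤M = ℕ.*-cancelˡ-≤ (p ∸ 1) {{ℕ.>-nonZero (ℕ.m<n⇒0<n∸m 1<p)}}
      (ℕ.≤-trans (ℕ.≤-reflexive (≡.sym S≡)) (ℕ.≤-trans (ℕ.m≤m+n _ (S∑ (ex s))) (ℕ.≤-reflexive degree)))
    S≡-dual : S∑ (ex s) ≡ (p ∸ 1) ℕ.* B
    S≡-dual = ℕ.+-cancelˡ-≡ (S∑ (ex r)) _ _ (≡.trans degree (≡.trans (≡.cong ((p ∸ 1) ℕ.*_) (≡.sym (ℕ.m+[n∸m]≡n A≤M)))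
      (≡.trans (ℕ.*-distribˡ-+ (p ∸ 1) A B) (≡.cong (ℕ._+ (p ∸ 1) ℕ.* B) (≡.sym S≡)))))
    rhs : (Q · 1#) ^ k * κ * (κ * ∏ λ i → ∑ λ a → w (ex r i) (L.el a) * w (dual (ex r i)) (L.el a)) ≈ P ^ M * (κ * κ * ∏ v)
    rhs = begin
      (Q · 1#) ^ k * κ * (κ * Πw)
        ≈⟨ solve 3 (λ q κ w → q :* κ :* (κ :* w) := κ :* κ :* (q :* w)) refl ((Q · 1#) ^ k) κ Πw ⟩
      κ * κ * ((Q · 1#) ^ k * Πw)
        ≈⟨ *-congˡ (*-congʳ (trans (sym (∏-replicate k (Q · 1#))) (∏-cong λ i → Q≈))) ⟩
      κ * κ * (∏ {k} (λ _ → P ^ f) * Πw)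
        ≈⟨ *-congˡ (trans (sym (∏-distrib-* _ _)) (∏-cong λ i → each i)) ⟩
      κ * κ * ∏ (λ i → P ^ (f ℕ.+ μ i) * v i)
        ≈⟨ *-congˡ (trans (∏-distrib-* _ _) (*-congʳ (∏-^ P (λ i → f ℕ.+ μ i)))) ⟩
      κ * κ * (P ^ M * ∏ v)
        ≈⟨ solve 3 (λ κ p v → κ :* (p :* v) := p :* (κ :* v)) refl (κ * κ) (P ^ M) (∏ v) ⟩
      P ^ M * (κ * κ * ∏ v) ∎
      where
      Πw = ∏ λ i → ∑ λ a → w (ex r i) (L.el a) * w (dual (ex r i)) (L.el a)
      each : ∀ i → P ^ f * ∑ (λ a → w (ex r i) (L.el a) * w (dual (ex r i)) (L.el a)) ≈ P ^ (f ℕ.+ μ i) * v i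
      each i = trans (*-congˡ (proj₂ (proj₂ (proj₂ (proj₂ (pairing (ex≤N r i))))))) (trans (sym (*-assoc _ _ _)) (*-congʳ (sym (^-homo-* P f (μ i)))))
    s-divisible : ∀ i → p^ B ∣ coeffZ s
    s-divisible i = coeffZ-∣ {B} s i (λ eq → ℕ.>⇒≢ (0<dual (ex≤N r i)) (≡.trans (≡.sym (s-dual i)) eq)) S≡-dual
    U : Carrier
    U = κ * κ * ∏ v
    unit-U : Unit U
    unit-U = unit-* (unit-* unit-κ unit-κ) (unit-∏ v v-unit)
    product : ∀ i₀ u b → coeffE r ≈ P ^ A * u → coeffZ s ≈ P ^ B * b → u * (b * η ^ k) ≈ U
    product i₀ u b E≈ Z≈ = *-cancelˡ {P ^ M} {u * (b * η ^ k)} {U} (P^≉0 M) (begin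
      P ^ M * (u * (b * η ^ k))  ≈⟨ *-congʳ (trans (^-congʳ P (≡.sym (ℕ.m+[n∸m]≡n A≤M))) (^-homo-* P A B)) ⟩
      P ^ A * P ^ B * (u * (b * η ^ k))  ≈⟨ solve 5 (λ A B u b n → A :* B :* (u :* (b :* n)) := A :* u :* (B :* b) :* n) refl (P ^ A) (P ^ B) u b (η ^ k) ⟩
      P ^ A * u * (P ^ B * b) * η ^ k  ≈⟨ *-congʳ (*-cong E≈ Z≈) ⟨
      coeffE r * coeffZ s * η ^ k  ≈⟨ trans (duality r s s-dual q-1∣r i₀) rhs ⟩
      P ^ M * U  ∎)
    conclude : ∀ i₀ → ex r i₀ ≢ 0 → p^ A ∣ coeffE r → ∃[ u ] Unit u × coeffE r ≈ P ^ A * u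
    conclude i₀ r≢0 (u , E≈) = with-dual (s-divisible i₀)
      where
      with-dual : p^ B ∣ coeffZ s → ∃[ u ] Unit u × coeffE r ≈ P ^ A * u
      with-dual (b , Z≈) = u , unit-factorˡ {u} {b * η ^ k} (unit-cong (sym (product i₀ u b E≈ Z≈)) unit-U) , E≈

-- Rational values and finite searches

open import Data.Integer.Base using (+_)

ℕ⇒ℚ-+ : ∀ a b → ℕ⇒ℚ (a ℕ.+ b) ≡ ℕ⇒ℚ a ℚ.+ ℕ⇒ℚ b
ℕ⇒ℚ-+ a b = ℚ.toℚᵘ-injective (begin
  ℚ.toℚᵘ (ℕ⇒ℚ (a ℕ.+ b))  ≈⟨ ℚ.toℚᵘ-fromℚᵘ (ℚᵘ.mkℚᵘ (+ (a ℕ.+ b)) 0) ⟩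
  ℚᵘ.mkℚᵘ (+ (a ℕ.+ b)) 0  ≈⟨ ℚᵘ.*≡* (≡.cong (ℤ._* + 1) (≡.cong₂ ℤ._+_ (≡.sym (ℤ.*-identityʳ (+ a))) (≡.sym (ℤ.*-identityʳ (+ b))))) ⟩
  ℚᵘ.mkℚᵘ (+ a) 0 ℚᵘ.+ ℚᵘ.mkℚᵘ (+ b) 0  ≈⟨ ℚᵘ.+-cong (ℚ.toℚᵘ-fromℚᵘ (ℚᵘ.mkℚᵘ (+ a) 0)) (ℚ.toℚᵘ-fromℚᵘ (ℚᵘ.mkℚᵘ (+ b) 0)) ⟨
  ℚ.toℚᵘ (ℕ⇒ℚ a) ℚᵘ.+ ℚ.toℚᵘ (ℕ⇒ℚ b)  ≈⟨ ℚ.toℚᵘ-homo-+ (ℕ⇒ℚ a) (ℕ⇒ℚ b) ⟨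
  ℚ.toℚᵘ (ℕ⇒ℚ a ℚ.+ ℕ⇒ℚ b)  ∎)
  where open SetoidReasoning ℚᵘ.≃-setoid

ℕ⇒ℚ-mono-≤ : ∀ {a b} → a ≤ b → ℕ⇒ℚ a ℚ.≤ ℕ⇒ℚ b
ℕ⇒ℚ-mono-≤ {a} {b} a≤b = ℚ.toℚᵘ-cancel-≤
  (ℚᵘ.≤-respˡ-≃ (ℚᵘ.≃-sym (ℚ.toℚᵘ-fromℚᵘ (ℚᵘ.mkℚᵘ (+ a) 0)))
  (ℚᵘ.≤-respʳ-≃ (ℚᵘ.≃-sym (ℚ.toℚᵘ-fromℚᵘ (ℚᵘ.mkℚᵘ (+ b) 0)))
  (ℚᵘ.*≤* (ℤ.*-monoʳ-≤-nonNeg (+ 1) (ℤ.+≤+ a≤b)))))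

cancel-/ : ∀ n .{{_ : NonZero n}} A → (+ (n ℕ.* A)) ℚ./ n ≡ ℕ⇒ℚ A
cancel-/ (suc n) A = ℚ.fromℚᵘ-cong {ℚᵘ.mkℚᵘ (+ (suc n ℕ.* A)) n} {ℚᵘ.mkℚᵘ (+ A) 0}
  (ℚᵘ.*≡* (≡.trans (ℤ.*-identityʳ _) (≡.trans (≡.cong +_ (ℕ.*-comm (suc n) A)) (ℤ.pos-* A (suc n)))))

-- The only passage from rational values to natural numbers: the quotient by p - 1 is exact, and the
-- subtraction of e becomes the balance A + t = B + e.
value-≡ : ∀ {p} (pr : Prime p) {S A t e B} → S ≡ (p ∸ 1) ℕ.* A → A ℕ.+ t ≡ B ℕ.+ e →
          S /[ pr -1] ℚ.+ ℕ⇒ℚ t ℚ.- ℕ⇒ℚ e ≡ ℕ⇒ℚ B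
value-≡ {p} pr {S} {A} {t} {e} {B} ≡.refl eq = begin
  S /[ pr -1] ℚ.+ ℕ⇒ℚ t ℚ.- ℕ⇒ℚ e  ≡⟨ ≡.cong (λ i → i ℚ.+ ℕ⇒ℚ t ℚ.- ℕ⇒ℚ e) (cancel-/ (p ∸ 1) {{p-1≢0}} A) ⟩
  ℕ⇒ℚ A ℚ.+ ℕ⇒ℚ t ℚ.- ℕ⇒ℚ e  ≡⟨ ≡.cong (ℚ._- ℕ⇒ℚ e) (≡.trans (≡.sym (ℕ⇒ℚ-+ A t)) (≡.trans (≡.cong ℕ⇒ℚ eq) (ℕ⇒ℚ-+ B e))) ⟩
  ℕ⇒ℚ B ℚ.+ ℕ⇒ℚ e ℚ.- ℕ⇒ℚ e  ≡⟨ ℚ.+-assoc (ℕ⇒ℚ B) (ℕ⇒ℚ e) _ ⟩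
  ℕ⇒ℚ B ℚ.+ (ℕ⇒ℚ e ℚ.- ℕ⇒ℚ e)  ≡⟨ ≡.cong (ℕ⇒ℚ B ℚ.+_) (ℚ.+-inverseʳ (ℕ⇒ℚ e)) ⟩
  ℕ⇒ℚ B ℚ.+ ℚ.0ℚ  ≡⟨ ℚ.+-identityʳ _ ⟩
  ℕ⇒ℚ B  ∎
  where
  open ≡.≡-Reasoning
  p-1≢0 : NonZero (p ∸ 1)
  p-1≢0 = ℕ.>-nonZero (ℕ.m<n⇒0<n∸m (ℕ.nonTrivial⇒n>1 p {{prime⇒nonTrivial pr}}))

any-vec? : ∀ {ℓ k n} {P : Vec (Fin n) k → Set ℓ} → (∀ v → Dec (P v)) → Dec (∃[ v ] P v)
any-vec? {k = zero}  P? = map′ ([] ,_) (λ { ([] , Pv) → Pv }) (P? [])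
any-vec? {k = suc k} P? = map′ (λ (a , v , Pav) → a ∷ v , Pav) (λ { (a ∷ v , Pav) → a , v , Pav })
  (Fin.any? λ a → any-vec? λ v → P? (a ∷ v))

all-vec? : ∀ {ℓ k n} {P : Vec (Fin n) k → Set ℓ} → (∀ v → Dec (P v)) → Dec (∀ v → P v)
all-vec? {P = P} P? with any-vec? (λ v → ¬? (P? v))
... | yes (v , ¬Pv) = no λ all → ¬Pv (all v)
... | no none       = yes λ v → decidable-stable (P? v) λ ¬Pv → none (v , ¬Pv)

last-true : ∀ {ℓ} {D : ℕ → Set ℓ} → (∀ t → Dec (D t)) → D 0 → ∀ b → ¬ D b → ∃[ t ] D t × ¬ D (suc t)
last-true D? D0 zero    ¬Db = contradiction D0 ¬Db
last-true D? D0 (suc b) ¬Db with D? b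
... | yes Db = b , Db , ¬Db
... | no ¬Db′ = last-true D? D0 b ¬Db′

-- Weights of the trace code

module TraceCodes {c₁ ℓ₁ c₂ ℓ₂ c₃ ℓ₃ p e m} (p-prime : Prime p) .{{_ : NonZero e}} .{{_ : NonZero m}}
  (K : FiniteField c₁ ℓ₁ (p ℕ.^ e)) (L : FiniteField c₂ ℓ₂ ((p ℕ.^ e) ℕ.^ m))
  (ι : FiniteField.Carrier K → FiniteField.Carrier L)
  (isEmbedding : IsEmbedding (FiniteField.commutativeRing K) (FiniteField.commutativeRing L) ι)
  (R : ℤₚ[ξ ((p ℕ.^ e) ℕ.^ m ∸ 1) ] p c₃ ℓ₃)
  (ρ : ℤₚ[ξ_].Carrier R → FiniteField.Carrier L) (isReduction : IsReduction R L ρ)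
  (T : FiniteField.Carrier L → ℤₚ[ξ_].Carrier R) (isTeichmüller : IsTeichmüller R L ρ T)
  {n k a} (C : LinearCode L n a) (G : Fin k → Fin n → FiniteField.Carrier L) (isGeneratorMatrix : IsGeneratorMatrix L C G) where

  open Trace {e = e} {m = m} p-prime K L ι isEmbedding R ρ isReduction T isTeichmüller k
  open ℤₚ[ξ_] R hiding (zero; ∑; ∏; isEmbedding)
  open Solver using (solve; con; _:+_; _:*_; _:=_)
  open SetoidReasoning setoid
  open DigitSums p-prime

  col : Fin n → Fin k → L.Carrier
  col j i = G i j

  entry : Point → Fin n → L.Carrier
  entry s j = dot (pt s) (col j)

  private
    module Code = LinearCode C
    module Gen = IsGeneratorMatrix isGeneratorMatrix

  combination : ∀ l (c : Fin l → L.Carrier) (rows : Fin l → Fin n → L.Carrier) → (∀ i → Code.Codeword (rows i)) →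
                Code.Codeword (λ j → L.∑ λ i → c i L.* rows i j)
  combination zero    c rows r = Code.resp (λ j → L.sym L.∑-zero) Code.0-closed
  combination (suc l) c rows r = Code.resp (λ j → L.sym (L.∑-suc _))
    (Code.+-closed (Code.*-closed (c zero) (r zero)) (combination l (c ∘ suc) (rows ∘ suc) (r ∘ suc)))

  -- A relation, because a word is determined by its coordinates only up to the equality of `K`;
  -- `traces` picks one representative.
  IsTraceOf : Point → (Fin n → K.Carrier) → Set _
  IsTraceOf s y = ∀ j → ι (y j) L.≈ tr (entry s j)

  opaque
    traces : Point → Fin n → K.Carrier
    traces s j = proj₁ (fixed⇒image (tr (entry s j)) (tr-fixed _))

    traces-correct : ∀ s → IsTraceOf s (traces s)
    traces-correct s j = proj₂ (fixed⇒image (tr (entry s j)) (tr-fixed _))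

  D : Pred (Vector K.Carrier n) _
  D = TraceCode {m = m} K L ι C

  traces-∈ : ∀ s → D (traces s)
  traces-∈ s = entry s , combination k (pt s) G Gen.rows , λ j → L.trans (traces-correct s j) (L.sym (L.∑≈ _))

  ∈-traces : ∀ {y} → D y → ∃[ s ] IsTraceOf s y
  ∈-traces {y} (x , x∈C , x↦y) = s , λ j → L.trans (x↦y j) (L.trans (L.∑≈ _) (tr-cong (entry≈ j)))
    where
    c : Fin k → L.Carrier
    c = proj₁ (Gen.spanning x∈C)
    x≈ = proj₂ (Gen.spanning x∈C)
    s : Point
    s = tabulate (L.ix ∘ c)
    entry≈ : ∀ j → x j L.≈ entry s j
    entry≈ j = L.trans (x≈ j) (L.trans (L.∑≈ _) (L.∑-cong λ i →
      L.*-congʳ (L.sym (L.trans (L.reflexive (≡.cong L.el (Vec.lookup∘tabulate _ i))) (L.el-ix _)))))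

  ι-zero : ∀ s {y} → IsTraceOf s y → ∀ j → (y j K.≈ K.0# → tr (entry s j) L.≈ L.0#) × (tr (entry s j) L.≈ L.0# → y j K.≈ K.0#)
  ι-zero s is j = (λ y≈0 → L.trans (L.sym (is j)) (L.trans (ι.⟦⟧-cong y≈0) ι.0#-homo)) ,
                (λ tr≈0 → ι.injective (L.trans (is j) (L.trans tr≈0 (L.sym ι.0#-homo))))

  wt : Point → ℕ
  wt s = weight K (traces s)

  weight≡wt : ∀ s {y} → IsTraceOf s y → weight K y ≡ wt s
  weight≡wt s {y} is = ≡.cong length (filter-≐ (λ j → ¬? (y j K.≟ K.0#)) (λ j → ¬? (traces s j K.≟ K.0#))
    ((λ {j} y≉0 t≈0 → y≉0 (proj₂ (ι-zero s is j) (proj₁ (ι-zero s (traces-correct s) j) t≈0))) ,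
     (λ {j} t≉0 y≈0 → t≉0 (proj₂ (ι-zero s (traces-correct s) j) (proj₁ (ι-zero s is j) y≈0)))) (allFin n))

  divisible⇒ : ∀ {Δ} → Divisible K D Δ → ∀ s → Δ ℕ∣.∣ wt s
  divisible⇒ div s = div (traces s) (traces-∈ s)

  divisible⇐ : ∀ {Δ} → (∀ s → Δ ℕ∣.∣ wt s) → Divisible K D Δ
  divisible⇐ {Δ} div y y∈D = let s , is = ∈-traces y∈D in ≡.subst (Δ ℕ∣.∣_) (≡.sym (weight≡wt s is)) (div s)

  -- Counted inside the ring, where the zero positions become a sum of indicators, the form in which
  -- `Z` records them.
  count : ∀ {ℓ l} {X : Fin l → Set ℓ} (X? : ∀ j → Dec (X j)) {l′} (g : Fin l′ → Fin l) →
          length (filter (λ j → ¬? (X? j)) (List.tabulate g)) · 1# + ∑ (λ j → if (X? (g j))) ≈ l′ · 1#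
  count X? {zero}   g = trans (+-congˡ ∑-zero) (+-identityˡ 0#)
  count X? {suc l′} g with X? (g zero) in eq
  ... | yes _ = trans (+-congˡ (trans (∑-suc _) (+-congʳ (reflexive (≡.cong if eq)))))
          (trans (solve 2 (λ a b → a :+ (con 1 :+ b) := con 1 :+ (a :+ b)) refl _ _) (+-congˡ (count X? (g ∘ suc))))
  ... | no _  = trans (+-congˡ (trans (∑-suc _) (trans (+-congʳ (reflexive (≡.cong if eq))) (+-identityˡ _))))
          (trans (+-assoc _ _ _) (+-congˡ (count X? (g ∘ suc))))

  -- q times the number of zero entries, and q times the weight. Their sum is constant, so at
  -- nonzero exponents their coefficients are opposite.
  V h : Point → Carrier
  V s = ∑ λ j → Z (entry s j)
  h s = P ^ e * (wt s · 1#)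

  h+V : ∀ s → h s + V s ≈ P ^ e * (n · 1#)
  h+V s = begin
    h s + ∑ (λ j → P ^ e * vanishing (entry s j))  ≈⟨ +-congˡ (*-distribˡ-∑ _ _) ⟨
    h s + P ^ e * ∑ (λ j → vanishing (entry s j))  ≈⟨ distribˡ _ _ _ ⟨
    P ^ e * (wt s · 1# + ∑ (λ j → vanishing (entry s j)))  ≈⟨ *-congˡ (+-congˡ (∑-cong λ j →
        if-cong (traces s j K.≟ K.0#) (tr (entry s j) L.≟ L.0#) (proj₁ (ι-zero s (traces-correct s) j)) (proj₂ (ι-zero s (traces-correct s) j)))) ⟨
    P ^ e * (wt s · 1# + ∑ (λ j → if (traces s j K.≟ K.0#)))  ≈⟨ *-congˡ (count (λ j → traces s j K.≟ K.0#) (λ j → j)) ⟩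
    P ^ e * (n · 1#)  ∎

  powers : Point → Carrier
  powers r = ∑ λ j → mono (ex r) (col j)

  -- `coeff-form` applied to each column; this is where the power sums of matrix entries appear.
  coeff-V : ∀ r → coeff V r ≈ coeffZ r * powers r
  coeff-V r = begin
    ∑ᵛ k (λ s → ∑ (λ j → Z (entry s j)) * W (ex r) (pt s))  ≈⟨ ∑ᵛ-cong k (λ s → *-distribʳ-∑ _ _) ⟩
    ∑ᵛ k (λ s → ∑ λ j → Z (entry s j) * W (ex r) (pt s))  ≈⟨ ∑-∑ᵛ-comm k _ ⟨
    ∑ (λ j → coeff (λ s → Z (entry s j)) r)  ≈⟨ ∑-cong (λ j → coeff-form Z Z-resp r (col j)) ⟩
    ∑ (λ j → coeffZ r * mono (ex r) (col j))  ≈⟨ *-distribˡ-∑ _ _ ⟨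
    coeffZ r * powers r  ∎

  coeff-h : ∀ r i → ex r i ≢ 0 → coeff h r + coeffZ r * powers r ≈ 0#
  coeff-h r i r≢0 = begin
    coeff h r + coeffZ r * powers r  ≈⟨ +-congˡ (coeff-V r) ⟨
    coeff h r + coeff V r  ≈⟨ coeff-+ h V r ⟨
    coeff (λ s → h s + V s) r  ≈⟨ coeff-cong r (λ s → trans (h+V s) (sym (*-identityʳ _))) ⟩
    coeff (λ _ → P ^ e * (n · 1#) * 1#) r  ≈⟨ coeff-* _ _ r ⟩
    P ^ e * (n · 1#) * coeff (λ _ → 1#) r  ≈⟨ trans (*-congˡ (coeff-1 r i r≢0)) (zeroʳ _) ⟩
    0#  ∎

  -- Coefficients are combinations of the values of `h` with factors `W` in the ring, so
  -- divisibility passes to them.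
  weights⇒coeffs : ∀ {B} → (∀ s → p^ B ∣ h s) → ∀ r → 0 < ∑ℕ (ex r) → p^ B ∣ coeffZ r * powers r
  weights⇒coeffs {B} div r 0<r = let i , r≢0 = ∑ℕ-positive (ex r) 0<r in
    ∣-cong (+-cancelʳ (coeff h r) _ _ (trans (-‿inverseˡ _) (sym (trans (+-comm _ _) (coeff-h r i r≢0)))))
      (∣-neg (coeff-∣ r div))

  -- Let β = g^d, a generator of the nonzero elements of the subfield. Replacing x by β x preserves
  -- the zeros of the trace but multiplies the coefficient by ξ^(d |r|), which is 1 only if q - 1
  -- divides |r|.
  coeffZ-inadmissible : ∀ r → ¬ (q ∸ 1) ℕ∣.∣ ∑ℕ (ex r) → coeffZ r ≈ 0#
  coeffZ-inadmissible r q-1∤r = ξ-fixed⇒0 i (coeffZ r) 0<i (ℕ.m%n<n _ N) (begin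
    ξ ^ i * coeffZ r  ≈⟨ *-congʳ ξ^i≈ ⟩
    mono (ex r) b * coeffZ r  ≈⟨ *-comm _ _ ⟩
    coeffZ r * mono (ex r) b  ≈⟨ coeff-form Z Z-resp r b ⟨
    coeff (λ x → Z (dot (pt x) b)) r  ≈⟨ coeff-cong r (λ x → invariant x) ⟩
    coeffZ r  ∎)
    where
    β : L.Carrier
    β = g L.^ d
    b : Fin k → L.Carrier
    b _ = β
    M = d ℕ.* ∑ℕ (ex r)
    i = M ℕ.% N
    d≢0 : NonZero d
    d≢0 = ℕ.≢-nonZero λ d≡0 → ℕ.≢-nonZero⁻¹ N (≡.trans N≡d*[q-1] (≡.cong (ℕ._* (q ∸ 1)) d≡0))
    0<i : 0 < i
    0<i = ℕ.n≢0⇒n>0 λ i≡0 → q-1∤r (ℕ∣.*-cancelˡ-∣ d {{d≢0}} (≡.subst (ℕ∣._∣ M) N≡d*[q-1] (ℕ∣.m%n≡0⇒n∣m M N i≡0)))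
    β^[q-1]≈1 : β L.^ (q ∸ 1) L.≈ L.1#
    β^[q-1]≈1 = L.trans (L.^-assocʳ g d (q ∸ 1)) (L.trans (L.reflexive (≡.cong (g L.^_) (≡.sym N≡d*[q-1]))) (L.fermat g g≉0))
    β-fixed : β L.^ q L.≈ β
    β-fixed = L.trans (L.reflexive (≡.cong (β L.^_) q≡1+[q-1])) (L.trans (L.*-congˡ β^[q-1]≈1) (L.*-identityʳ β))
    ξ^i≈ : ξ ^ i ≈ mono (ex r) b
    ξ^i≈ = sym (begin
      mono (ex r) b  ≈⟨ ∏-^ (T β) (ex r) ⟩
      T β ^ ∑ℕ (ex r)  ≈⟨ ^-congˡ (∑ℕ (ex r)) (ρξ^ d) ⟩
      (ξ ^ d) ^ ∑ℕ (ex r)  ≈⟨ ^-assocʳ ξ d _ ⟩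
      ξ ^ M  ≡⟨ ≡.cong (ξ ^_) (ℕ.m≡m%n+[m/n]*n M N) ⟩
      ξ ^ (i ℕ.+ M ℕ./ N ℕ.* N)  ≈⟨ ^-homo-* ξ i (M ℕ./ N ℕ.* N) ⟩
      ξ ^ i * ξ ^ (M ℕ./ N ℕ.* N)  ≈⟨ *-congˡ (trans (^-congʳ ξ (ℕ.*-comm (M ℕ./ N) N)) (trans (sym (^-assocʳ ξ N (M ℕ./ N))) (trans (^-congˡ (M ℕ./ N) ξ^N≈1) (1^ (M ℕ./ N))))) ⟩
      ξ ^ i * 1#  ≈⟨ *-identityʳ _ ⟩
      ξ ^ i  ∎)
    tr-β : ∀ x → tr (dot (pt x) b) L.≈ β L.* tr (L.∑ (pt x))
    tr-β x = L.trans (tr-cong (L.trans (L.∑-cong λ j → L.*-comm _ _) (L.sym (L.*-distribˡ-∑ β (pt x))))) (tr-scale _ β-fixed)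
    invariant : ∀ x → Z (dot (pt x) b) ≈ Z (L.∑ (pt x))
    invariant x = *-congˡ (if-cong (tr (dot (pt x) b) L.≟ L.0#) (tr (L.∑ (pt x)) L.≟ L.0#)
      (λ eq → L.domain (L.nonzero-^ d g≉0) (L.trans (L.sym (tr-β x)) eq))
      (λ eq → L.trans (tr-β x) (L.trans (L.*-congˡ eq) (L.zeroʳ β))))

  Admissibleᵛ : Point → Set
  Admissibleᵛ r = (q ∸ 1) ℕ∣.∣ ∑ℕ (ex r) × 0 < ∑ℕ (ex r)

  admissible? : ∀ r → Dec (Admissibleᵛ r)
  admissible? r = (q ∸ 1) ℕ∣.∣? ∑ℕ (ex r) ×-dec (0 ℕ.<? ∑ℕ (ex r))

  origin : Point
  origin = tabulate λ _ → L.ix L.0#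

  origin≈0 : ∀ i → pt origin i L.≈ L.0#
  origin≈0 i = L.trans (L.reflexive (≡.cong L.el (Vec.lookup∘tabulate _ i))) (L.el-ix _)

  wt-origin : wt origin ≡ 0
  wt-origin = ≡.cong length (filter-none (λ j → ¬? (traces origin j K.≟ K.0#)) (All.universal (λ j nz → nz (zero-entry j)) (allFin n)))
    where
    zero-entry : ∀ j → traces origin j K.≈ K.0#
    zero-entry j = proj₂ (ι-zero origin (traces-correct origin) j) (tr-0 (L.∑-0 λ i → L.trans (L.*-congʳ (origin≈0 i)) (L.zeroˡ _)))

  -- W₀ is supported at the origin, so the constant coefficient is a multiple of h 0.
  coeff-h-0 : ∀ r → (∀ i → ex r i ≡ 0) → coeff h r ≈ 0#
  coeff-h-0 r r≡0 = ∑ᵛ-0 k vanish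
    where
    vanish : ∀ x → h x * W (ex r) (pt x) ≈ 0#
    vanish x = case (Fin.any? λ i → ¬? (pt x i L.≟ L.0#))
      where
      case : Dec (∃[ i ] ¬ pt x i L.≈ L.0#) → h x * W (ex r) (pt x) ≈ 0#
      case (yes (i , x≉0)) = trans (*-congˡ (∏-0 i (trans (reflexive (≡.cong (λ l → w l (pt x i)) (r≡0 i))) (trans (*-congˡ (z-≉0 x≉0)) (zeroʳ η))))) (zeroʳ _)
      case (no none) = trans (*-congʳ (trans (*-congˡ (reflexive (≡.cong (_· 1#) wt≡0))) (zeroʳ _))) (zeroˡ _)
        where
        x≡origin : ∀ i → pt x i L.≈ pt origin i
        x≡origin i = L.trans (decidable-stable (pt x i L.≟ L.0#) λ neq → none (i , neq)) (L.sym (origin≈0 i))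
        wt≡0 : wt x ≡ 0
        wt≡0 = ≡.trans (weight≡wt origin {traces x} λ j → L.trans (traces-correct x j) (tr-cong (dot-congˡ (col j) x≡origin))) wt-origin

  -- The converse of `weights⇒coeffs`, by `expansion` and because η^k is a unit. All coefficients at
  -- exponents that are not admissible are zero, including the constant one.
  coeffs⇒weights : ∀ {B} → (∀ r → Admissibleᵛ r → p^ B ∣ coeffZ r * powers r) → ∀ s → p^ B ∣ h s
  coeffs⇒weights {B} div s = ∣-unit B unit-η^k (∣-cong (sym (expansion h s)) (∣-∑ᵛ k λ r → ∣-*ʳ _ (each r)))
    where
    negate : ∀ r → 0 < ∑ℕ (ex r) → p^ B ∣ coeffZ r * powers r → p^ B ∣ coeff h r
    negate r 0<r d = let i , r≢0 = ∑ℕ-positive (ex r) 0<r in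
      ∣-cong (+-cancelʳ (coeffZ r * powers r) _ _ (trans (-‿inverseˡ _) (sym (coeff-h r i r≢0)))) (∣-neg d)
    each : ∀ r → p^ B ∣ coeff h r
    each r with 0 ℕ.<? ∑ℕ (ex r) | (q ∸ 1) ℕ∣.∣? ∑ℕ (ex r)
    ... | no r≯0 | _       = ∣-0 (coeff-h-0 r λ i → decidable-stable (ex r i ℕ.≟ 0) λ neq → r≯0 (positive i neq))
      where
      positive : ∀ i → ex r i ≢ 0 → 0 < ∑ℕ (ex r)
      positive i neq = ℕ.<-≤-trans (ℕ.n≢0⇒n>0 neq) (≤-∑ℕ (ex r) i)
    ... | yes 0<r | yes q-1∣r = negate r 0<r (div r (q-1∣r , 0<r))
    ... | yes 0<r | no q-1∤r  = negate r 0<r (∣-0 (trans (*-congʳ (coeffZ-inadmissible r q-1∤r)) (zeroˡ _)))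

  weights∣⇒h : ∀ {t} → (∀ s → p ℕ.^ t ℕ∣.∣ wt s) → ∀ s → p^ e ℕ.+ t ∣ h s
  weights∣⇒h {t} div s = ∣-* (∣-cong (*-identityʳ _) (∣-P^ e 1#))
    (c · 1# , trans (×-congˡ (≡.trans (ℕ∣._∣_.equality (div s)) (ℕ.*-comm c _))) (trans (×1-homo-* (p ℕ.^ t) c) (*-congʳ (×1-homo-^ p t))))
    where c = ℕ∣.quotient (div s)

  h⇒weights∣ : ∀ {t} → (∀ s → p^ e ℕ.+ t ∣ h s) → ∀ s → p ℕ.^ t ℕ∣.∣ wt s
  h⇒weights∣ {t} div s = p^∣·1⇒p^∣ t (wt s) (∣-cancel e (div s))

  -- Comparison with the values of the theorem

  ν-value : Carrier → ℕ ⁺ → Set _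
  ν-value = ℤₚ[ξ_].ν R

  ∣⇒p^∣ : ∀ {t x} → (P ^ t) ∣ x → p^ t ∣ x
  ∣⇒p^∣ {t} record { quotient = y ; equality = eq } = y , trans (sym eq) (*-comm y (P ^ t))

  p^∣⇒∣ : ∀ {t x} → p^ t ∣ x → (P ^ t) ∣ x
  p^∣⇒∣ {t} (y , eq) = record { quotient = y ; equality = trans (*-comm y (P ^ t)) (sym eq) }

  powerSumᵛ : (Fin k → Fin Q) → Carrier
  powerSumᵛ = powerSum {p = p} {e = e} {m = m} p-prime L R T G

  powerSum≈ : ∀ r → powerSumᵛ (lookup r) ≈ powers r
  powerSum≈ r = trans (∑≈ _) (∑-cong λ j → ∏≈ _)

  powerSum-cong : ∀ {r r′ : Fin k → Fin Q} → (∀ i → r i ≡ r′ i) → powerSumᵛ r ≈ powerSumᵛ r′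
  powerSum-cong {r} {r′} eq = trans (∑≈ _) (trans (∑-cong λ j → trans (∏≈ _)
    (trans (∏-cong λ i → reflexive (≡.cong (λ l → T (G i j) ^ toℕ l) (eq i))) (sym (∏≈ _)))) (sym (∑≈ _)))

  coeff-powers : ∀ r → Admissibleᵛ r → ∃[ A ] ∃[ u ]
    S∑ (ex r) ≡ (p ∸ 1) ℕ.* A × Unit u × coeffZ r * powers r ≈ P ^ A * (u * powers r)
  coeff-powers r (q-1∣r , 0<r) =
    let A , S≡ = admissible-degree r q-1∣r
        i , r≢0 = ∑ℕ-positive (ex r) 0<r
        u , unit-u , E≈ = coeffE-valuation {A} r q-1∣r 0<r S≡
    in A , u , S≡ , unit-u , trans (*-congʳ (trans (sym (coeffE≈Z r i r≢0)) E≈)) (*-assoc _ _ _)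

  digitSum≡ : ∀ r → ∑ℕ (λ i → digitSum p-prime (toℕ (lookup r i))) ≡ S∑ (ex r)
  digitSum≡ r = ∑ℕ-cong λ i → ≡.sym (S≡digitSum (ex r i))

  Valueᵛ : ℚ ⁺ → Set _
  Valueᵛ = Value {e = e} {m = m} p-prime L R T G

  weights-divisible : ℕ → Set
  weights-divisible t = ∀ s → p ℕ.^ t ℕ∣.∣ wt s

  weights-divisible? : ∀ t → Dec (weights-divisible t)
  weights-divisible? t = all-vec? λ s → p ℕ.^ t ℕ∣.∣? wt s

  -- P^(e+t) divides the coefficient, which is P^A times a unit times the power sum. If A + t′ were
  -- smaller than e + t, the power sum would be divisible by P^(t′+1), against the maximality of t′.
  bound : ∀ {t r t′} → weights-divisible t → Admissibleᵛ r → ν-value (powers r) [ t′ ] → ((A , _) : ∃[ A ] S∑ (ex r) ≡ (p ∸ 1) ℕ.* A) →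
          e ℕ.+ t ≤ A ℕ.+ t′
  bound {t} {r} {t′} div adm (_ , t′-max) (A , S≡) = ℕ.≮⇒≥ λ A+t′<e+t →
    t′-max (p^∣⇒∣ (∣-unit (suc t′) unit-u (∣-cancel A′ (∣-cong eq (∣-≤ (≤′ A+t′<e+t) (weights⇒coeffs (weights∣⇒h div) r (proj₂ adm)))))))
    where
    A′ = proj₁ (coeff-powers r adm)
    unit-u = proj₁ (proj₂ (proj₂ (proj₂ (coeff-powers r adm))))
    eq = proj₂ (proj₂ (proj₂ (proj₂ (coeff-powers r adm))))
    A′≡A : A′ ≡ A
    A′≡A = ℕ.*-cancelˡ-≡ A′ A (p ∸ 1) {{ℕ.>-nonZero (ℕ.m<n⇒0<n∸m 1<p)}} (≡.trans (≡.sym (proj₁ (proj₂ (proj₂ (coeff-powers r adm))))) S≡)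
    ≤′ : suc (A ℕ.+ t′) ≤ e ℕ.+ t → A′ ℕ.+ suc t′ ≤ e ℕ.+ t
    ≤′ lt = ℕ.≤-trans (ℕ.≤-reflexive (≡.trans (≡.cong (ℕ._+ suc t′) A′≡A) (ℕ.+-suc A t′))) lt

  value-bound : ∀ r t′ → Admissible q r → ν-value (powerSumᵛ r) [ t′ ] → ∃[ A ]
    ∑ℕ (λ i → digitSum p-prime (toℕ (r i))) ≡ (p ∸ 1) ℕ.* A × (∀ t → weights-divisible t → e ℕ.+ t ≤ A ℕ.+ t′)
  value-bound r t′ (q-1∣r , 0<r) (p^t′∣ , t′-max) = proj₁ degree ,
    ≡.trans (∑ℕ-cong λ i → ≡.cong (digitSum p-prime ∘ toℕ) (≡.sym (rᵛ≡r i))) (≡.trans (digitSum≡ rᵛ) (proj₂ degree)) ,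
    λ t div → bound {t} {rᵛ} {t′} div adm
      (p^∣⇒∣ {t′} (∣-cong powers≈ (∣⇒p^∣ {t′} p^t′∣)) , λ d → t′-max (p^∣⇒∣ {suc t′} (∣-cong (sym powers≈) (∣⇒p^∣ {suc t′} d)))) degree
    where
    rᵛ : Point
    rᵛ = tabulate r
    rᵛ≡r : ∀ i → lookup rᵛ i ≡ r i
    rᵛ≡r = Vec.lookup∘tabulate r
    ∑r≡ : ∑ℕ (toℕ ∘ r) ≡ ∑ℕ (ex rᵛ)
    ∑r≡ = ∑ℕ-cong λ i → ≡.cong toℕ (≡.sym (rᵛ≡r i))
    adm : Admissibleᵛ rᵛ
    adm = ≡.subst ((q ∸ 1) ℕ∣.∣_) ∑r≡ q-1∣r , ≡.subst (0 <_) ∑r≡ 0<r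
    powers≈ : powerSumᵛ r ≈ powers rᵛ
    powers≈ = trans (powerSum-cong λ i → ≡.sym (rᵛ≡r i)) (powerSum≈ rᵛ)
    degree : ∃[ A ] S∑ (ex rᵛ) ≡ (p ∸ 1) ℕ.* A
    degree = admissible-degree rᵛ (proj₁ adm)

  lower-bound : ∀ {t} → weights-divisible t → ∀ r t′ → Admissible q r → ν-value (powerSumᵛ r) [ t′ ] →
    ℕ⇒ℚ t ℚ.≤ ∑ℕ (λ i → digitSum p-prime (toℕ (r i))) /[ p-prime -1] ℚ.+ ℕ⇒ℚ t′ ℚ.- ℕ⇒ℚ e
  lower-bound {t} div r t′ adm ν =
    let A , S≡ , bounded = value-bound r t′ adm ν
        c = A ℕ.+ t′ ∸ (e ℕ.+ t)
    in ≡.subst (ℕ⇒ℚ t ℚ.≤_) (≡.sym (value-≡ p-prime {A = A} {t = t′} {e = e} {B = t ℕ.+ c} S≡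
         (≡.trans (≡.sym (ℕ.m+[n∸m]≡n (bounded t div))) (≡.trans (ℕ.+-assoc e t c) (ℕ.+-comm e (t ℕ.+ c))))))
         (ℕ⇒ℚ-mono-≤ (ℕ.m≤m+n t c))

  -- If p^(t+1) does not divide all weights, `coeffs⇒weights` and a finite search yield an
  -- admissible r whose coefficient is not divisible by P^(e+t+1). It is divisible by P^(e+t), so
  -- the valuation of its power sum is pinned down.
  attained : ∀ {t} → weights-divisible t → ¬ weights-divisible (suc t) → Valueᵛ [ ℕ⇒ℚ t ]
  attained {t} div max = case (any-vec? λ r → admissible? r ×-dec ¬? (p^ e ℕ.+ suc t ∣? (coeffZ r * powers r)))
    where
    case : Dec (∃[ r ] Admissibleᵛ r × ¬ p^ e ℕ.+ suc t ∣ coeffZ r * powers r) → Valueᵛ [ ℕ⇒ℚ t ]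
    case (no none) = contradiction (h⇒weights∣ (coeffs⇒weights λ r adm →
      decidable-stable (p^ e ℕ.+ suc t ∣? (coeffZ r * powers r)) λ ∤ → none (r , adm , ∤))) max
    case (yes (r , adm , ∤)) = lookup r , [ t′ ] , adm ,
      (p^∣⇒∣ (∣-cong (sym (powerSum≈ r)) t′-divides) , λ d → t′-maximal (∣-cong (powerSum≈ r) (∣⇒p^∣ d))) ,
      ≡.cong [_] (≡.sym (value-≡ p-prime {A = A} {t = t′} {e = e} {B = t} (≡.trans (digitSum≡ r) S≡) (≡.trans A+t′ (ℕ.+-comm e t))))
      where
      A = proj₁ (coeff-powers r adm)
      u = proj₁ (proj₂ (coeff-powers r adm))
      S≡ = proj₁ (proj₂ (proj₂ (coeff-powers r adm)))
      unit-u = proj₁ (proj₂ (proj₂ (proj₂ (coeff-powers r adm))))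
      eq = proj₂ (proj₂ (proj₂ (proj₂ (coeff-powers r adm))))
      -- Otherwise the factor P^A alone would give the excluded divisibility; the truncated
      -- subtraction in `t′` is therefore exact.
      A≤ : A ≤ e ℕ.+ t
      A≤ = ℕ.≮⇒≥ λ lt → ∤ (∣-cong (sym eq) (∣-≤ (ℕ.≤-trans (ℕ.≤-reflexive (ℕ.+-suc e t)) lt) (∣-P^ A _)))
      t′ = e ℕ.+ t ∸ A
      A+t′ : A ℕ.+ t′ ≡ e ℕ.+ t
      A+t′ = ℕ.m+[n∸m]≡n A≤
      t′-divides : p^ t′ ∣ powers r
      t′-divides = ∣-unit t′ unit-u (∣-cancel A (∣-≤ (ℕ.≤-reflexive A+t′) (∣-cong eq (weights⇒coeffs (weights∣⇒h div) r (proj₂ adm)))))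
      t′-maximal : ¬ p^ suc t′ ∣ powers r
      t′-maximal d = ∤ (∣-cong (sym eq) (∣-≤ (ℕ.≤-reflexive (≡.trans (ℕ.+-suc e t) (≡.trans (≡.cong suc (≡.sym A+t′)) (≡.sym (ℕ.+-suc A t′)))))
        (∣-* (∣-cong (*-identityʳ _) (∣-P^ A 1#)) (∣-*ˡ u d))))

  -- A finite value would bound every t by A + t′, which t = A + t′ + 1 violates.
  no-value : (∀ t → weights-divisible t) → ∀ r t′ → Admissible q r → ¬ ν-value (powerSumᵛ r) [ t′ ]
  no-value div r t′ adm ν =
    let A , _ , bounded = value-bound r t′ adm ν
    in ℕ.<⇒≱ (ℕ.m≤n+m (suc (A ℕ.+ t′)) e) (bounded (suc (A ℕ.+ t′)) (div (suc (A ℕ.+ t′))))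

  open Supremum ℚ._≤_ using (_≤⁺_; _≤⊤⁺; [_])

  -- Coordinate vectors are finitely many, so the zero code is recognised by enumeration; for it no
  -- admissible exponent has a finite value and the minimum is ∞.
  valuation : ∃[ v ] (CodeValuation K D p v × IsMinimum Valueᵛ (map ℕ⇒ℚ v))
  valuation = case (any-vec? λ s → ¬? (wt s ℕ.≟ 0))
    where
    minimum-⊤ : (∀ t → weights-divisible t) → ∀ v → Valueᵛ v → ⊤⁺ ≤⁺ v
    minimum-⊤ div v (r , ⊤⁺     , adm , ν , ≡.refl) = ⊤⁺ ≤⊤⁺
    minimum-⊤ div v (r , [ t′ ] , adm , ν , _)      = contradiction ν (no-value div r t′ adm)
    minimum : ∀ {t} → weights-divisible t → ∀ v → Valueᵛ v → [ ℕ⇒ℚ t ] ≤⁺ v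
    minimum {t} div v (r , ⊤⁺     , adm , ν , ≡.refl) = _ ≤⊤⁺
    minimum {t} div v (r , [ t′ ] , adm , ν , ≡.refl) = [ lower-bound {t} div r t′ adm ν ]
    power-∣ : ∀ {a b} → a ≤ b → p ℕ.^ a ℕ∣.∣ p ℕ.^ b
    power-∣ {a} {b} a≤b = ≡.subst (p ℕ.^ a ℕ∣.∣_) (≡.trans (≡.sym (ℕ.^-distribˡ-+-* p a (b ∸ a))) (≡.cong (p ℕ.^_) (ℕ.m+[n∸m]≡n a≤b)))
      (ℕ∣.m∣m*n (p ℕ.^ (b ∸ a)))
    finite : ∀ s → wt s ≢ 0 → ∃[ t ] weights-divisible t × ¬ weights-divisible (suc t) →
             ∃[ v ] (CodeValuation K D p v × IsMinimum Valueᵛ (map ℕ⇒ℚ v))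
    finite s wt≢0 (t , div , max) = [ t ] ,
      (divisible⇐ {p ℕ.^ t} div , λ t′ div′ → ℕ.≮⇒≥ λ t<t′ → max λ s → ℕ∣.∣-trans (power-∣ t<t′) (divisible⇒ {p ℕ.^ t′} div′ s)) ,
      inj₂ (attained {t} div max) , minimum {t} div
    case : Dec (∃[ s ] wt s ≢ 0) → ∃[ v ] (CodeValuation K D p v × IsMinimum Valueᵛ (map ℕ⇒ℚ v))
    case (no none) = ⊤⁺ , (λ t → divisible⇐ {p ℕ.^ t} (div t)) , inj₁ ≡.refl , minimum-⊤ div
      where
      div : ∀ t → weights-divisible t
      div t s = ≡.subst (p ℕ.^ t ℕ∣.∣_) (≡.sym (decidable-stable (wt s ℕ.≟ 0) λ neq → none (s , neq))) (_ ℕ∣.∣0)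
    -- A nonzero weight n bounds the search for t, since p^n exceeds n and cannot divide it.
    case (yes (s , wt≢0)) = finite s wt≢0 (last-true weights-divisible? (λ s → ℕ∣.1∣ _) (wt s)
      λ div → ℕ.<⇒≱ (n<p^n 1<p (wt s)) (ℕ∣.∣⇒≤ {{ℕ.≢-nonZero wt≢0}} (div s)))

open import Data.Nat.Base using (_^_)

theorem3p2 : ∀ {c₁ ℓ₁ c₂ ℓ₂ c₃ ℓ₃ a : Level} {p e m n k : ℕ}
    (p-prime : Prime p) .{{_ : NonZero e}} .{{_ : NonZero m}} →
    (K : FiniteField c₁ ℓ₁ (p ^ e))
    (L : FiniteField c₂ ℓ₂ ((p ^ e) ^ m))
    (ι : FiniteField.Carrier K → FiniteField.Carrier L) →
    IsEmbedding (FiniteField.commutativeRing K) (FiniteField.commutativeRing L) ι →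
    (R : ℤₚ[ξ ((p ^ e) ^ m ∸ 1) ] p c₃ ℓ₃)
    (ρ : ℤₚ[ξ_].Carrier R → FiniteField.Carrier L) → IsReduction R L ρ →
    (T : FiniteField.Carrier L → ℤₚ[ξ_].Carrier R) → IsTeichmüller R L ρ T →
    (C : LinearCode L n a) (G : Fin k → Fin n → FiniteField.Carrier L) →
    IsGeneratorMatrix L C G →
    ∃[ v ] (CodeValuation K (TraceCode {m = m} K L ι C) p v
          × IsMinimum (Value {e = e} {m = m} p-prime L R T G) (map ℕ⇒ℚ v))
theorem3p2 {e = e} {m = m} p-prime K L ι ι-embedding R ρ ρ-reduction T T-teichmüller C G generator =
  TraceCodes.valuation {e = e} {m = m} p-prime K L ι ι-embedding R ρ ρ-reduction T T-teichmüller C G generator
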